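{- Let $k\geq 1$ be an integer and let $H$ be a graph that is KNRS. Then: (a) the $(2k-1)$-subdivision $H^{(2k-1)}$ is Sidorenko, and (b) the $2k$-subdivision $H^{(2k)}$ is weakly-KNRS.
   Context: All graphs are finite and simple. For graphs $H,G$, a homomorphism from $H$ to $G$ is a map $f:V(H)\to V(G)$ with $f(u)f(v)\in E(G)$ whenever $uv\in E(H)$; the homomorphism density $t(H,G)$ is the probability that a uniformly random map $V(H)\to V(G)$ is a homomorphism. For an integer $s\geq 1$, the $s$-subdivision $H^{(s)}$ of $H$ is obtained by replacing each edge $uv$ of $H$ by a path of length $s+1$ between $u$ and $v$, these paths being internally vertex-disjoint. A bipartite graph $H$ is Sidorenko if $t(H,G)\geq t(K_2,G)^{|E(H)|}$ for every graph $G$. An $n$-vertex graph $G$ is $(\rho,d)$-dense if every vertex subset $X$ with $|X|\geq \rho n$ spans at least $\frac d2|X|^2$ edges. A graph $H$ is KNRS if for all reals $d,\varepsilon>0$ there is $\rho=\rho(d,H,\varepsilon)>0$ such that $t(H,G)\geq(1-\varepsilon)d^{|E(H)|}$ for every sufficiently large $(\rho,d)$-dense graph $G$. A graph $H$ is weakly-KNRS if there is a constant $c_H\in(0,1]$ such that for every real $d>0$ there is $\rho=\rho(d,H)>0$ with $t(H,G)\geq c_H\, d^{|E(H)|}$ for every sufficiently large $(\rho,d)$-dense graph $G$. -}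

module Defs where

open import Data.Bool using (Bool; true; false; _∧_; _∨_; not)
open import Data.Bool.Properties using (∨-comm; ∧-zeroʳ)
open import Data.Nat as ℕ using (ℕ; zero; suc; _≡ᵇ_; _<ᵇ_)
open import Data.Nat.Properties using (m^n≢0)
open import Data.Fin using (Fin; zero; suc; toℕ; splitAt; remQuot)
open import Data.Fin.Subset using (Subset; ∣_∣)
open import Data.Vec using (lookup)
open import Data.List as List using (List; []; _∷_; length; allFin; concatMap; map)
open import Data.Integer using (+_)
open import Data.Rational using (ℚ; 0ℚ; 1ℚ; ½; _/_; _*_; _-_; _≤_; _<_)
open import Data.Product using (Σ; ∃; _×_; _,_; proj₁; proj₂)
open import Data.Sum using (_⊎_; inj₁; inj₂)
import Data.Sum as Sum
open import Relation.Binary.PropositionalEquality using (_≡_; refl)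

record Graph : Set where
  field
    n      : ℕ
    adj    : Fin n → Fin n → Bool
    sym    : ∀ u v → adj u v ≡ adj v u
    irrefl : ∀ u → adj u u ≡ false
open Graph public

countB : {A : Set} → (A → Bool) → List A → ℕ
countB p []       = 0
countB p (x ∷ xs) with p x
... | true  = suc (countB p xs)
... | false = countB p xs

allB : ∀ {m} → (Fin m → Bool) → Bool
allB {m} p = go (allFin m)
  where
  go : List (Fin m) → Bool
  go []       = true
  go (x ∷ xs) = p x ∧ go xs

allPairs : ∀ m → List (Fin m × Fin m)
allPairs m = concatMap (λ u → map (λ v → (u , v)) (allFin m)) (allFin m)

cons : ∀ {h m} → Fin m → (Fin h → Fin m) → Fin (suc h) → Fin m
cons x f zero    = x
cons x f (suc i) = f i

allMaps : (h m : ℕ) → List (Fin h → Fin m)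
allMaps zero    m = (λ ()) ∷ []
allMaps (suc h) m = concatMap (λ f → map (λ x → cons x f) (allFin m)) (allMaps h m)

edgeList : (H : Graph) → List (Fin (n H) × Fin (n H))
edgeList H = List.filterᵇ (λ p → (toℕ (proj₁ p) <ᵇ toℕ (proj₂ p)) ∧ adj H (proj₁ p) (proj₂ p))
                          (allPairs (n H))

e : Graph → ℕ
e H = length (edgeList H)

isHom : (H G : Graph) → (Fin (n H) → Fin (n G)) → Bool
isHom H G f = allB λ u → allB λ v → not (adj H u v) ∨ adj G (f u) (f v)

homCount : Graph → Graph → ℕ
homCount H G = countB (isHom H G) (allMaps (n H) (n G))

-- count / m^h ; convention for the empty target graph (m = 0): density 1
density : ℕ → ℕ → ℕ → ℚ
density c zero    h = 1ℚ
density c (suc m) h = (+ c / (suc m ℕ.^ h)) {{m^n≢0 (suc m) h}}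

t : Graph → Graph → ℚ
t H G = density (homCount H G) (n G) (n H)

_^ℚ_ : ℚ → ℕ → ℚ
q ^ℚ zero  = 1ℚ
q ^ℚ suc k = q * (q ^ℚ k)

K2 : Graph
K2 = record { n = 2 ; adj = a ; sym = s ; irrefl = i }
  where
  a : Fin 2 → Fin 2 → Bool
  a zero zero = false
  a zero (suc zero) = true
  a (suc zero) zero = true
  a (suc zero) (suc zero) = false
  s : ∀ u v → a u v ≡ a v u
  s zero zero = refl
  s zero (suc zero) = refl
  s (suc zero) zero = refl
  s (suc zero) (suc zero) = refl
  i : ∀ u → a u u ≡ false
  i zero = refl
  i (suc zero) = refl

-- s-subdivision H^(s): vertices V(H) ⊎ (E(H) × {0..s-1}); the edge
-- number i = (u , v) (u < v) becomes the path u, (i,0), ..., (i,s-1), v.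
-- (Intended for s ≥ 1.)

private
  suc≡ᵇ : ∀ m → (suc m ≡ᵇ m) ≡ false
  suc≡ᵇ zero    = refl
  suc≡ᵇ (suc m) = suc≡ᵇ m

subdivision : Graph → ℕ → Graph
subdivision H s = record { n = N ; adj = A ; sym = S ; irrefl = I }
  where
  m : ℕ
  m = e H
  N : ℕ
  N = n H ℕ.+ m ℕ.* s
  V : Set
  V = Fin (n H) ⊎ (Fin m × Fin s)
  edge : Fin m → Fin (n H) × Fin (n H)
  edge i = List.lookup (edgeList H) i
  dec : Fin N → V
  dec x = Sum.map₂ (remQuot s) (splitAt (n H) x)
  arc : V → V → Bool
  arc (inj₁ u) (inj₁ v) = false
  arc (inj₁ u) (inj₂ (i , j)) = (toℕ j ≡ᵇ 0) ∧ (toℕ (proj₁ (edge i)) ≡ᵇ toℕ u)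
  arc (inj₂ (i , j)) (inj₂ (i' , j')) = (toℕ i ≡ᵇ toℕ i') ∧ (suc (toℕ j) ≡ᵇ toℕ j')
  arc (inj₂ (i , j)) (inj₁ v) = (suc (toℕ j) ≡ᵇ s) ∧ (toℕ (proj₂ (edge i)) ≡ᵇ toℕ v)
  arcIrr : ∀ x → arc x x ≡ false
  arcIrr (inj₁ u) = refl
  arcIrr (inj₂ (i , j)) rewrite suc≡ᵇ (toℕ j) = ∧-zeroʳ (toℕ i ≡ᵇ toℕ i)
  A : Fin N → Fin N → Bool
  A x y = arc (dec x) (dec y) ∨ arc (dec y) (dec x)
  S : ∀ x y → A x y ≡ A y x
  S x y = ∨-comm (arc (dec x) (dec y)) (arc (dec y) (dec x))
  I : ∀ x → A x x ≡ false
  I x rewrite arcIrr (dec x) = refl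

Bipartite : Graph → Set
Bipartite H = Σ (Fin (n H) → Bool) λ col →
  ∀ u v → adj H u v ≡ true → (col u ≡ col v → Data.Empty.⊥)
  where import Data.Empty

Sidorenko : Graph → Set
Sidorenko H = Bipartite H × (∀ (G : Graph) → (t K2 G ^ℚ e H) ≤ t H G)

-- number of ordered pairs (u,v) ∈ X×X with u ~ v, i.e. twice e(G[X])
eOrd : (G : Graph) → Subset (n G) → ℕ
eOrd G X = countB (λ p → lookup X (proj₁ p) ∧ lookup X (proj₂ p) ∧ adj G (proj₁ p) (proj₂ p))
                  (allPairs (n G))

edgesIn : (G : Graph) → Subset (n G) → ℚ
edgesIn G X = + eOrd G X / 2

ℕ→ℚ : ℕ → ℚ
ℕ→ℚ k = + k / 1

Dense : ℚ → ℚ → Graph → Set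
Dense ρ d G = ∀ (X : Subset (n G)) → ρ * ℕ→ℚ (n G) ≤ ℕ→ℚ ∣ X ∣ →
  (d * ½) * (ℕ→ℚ ∣ X ∣ * ℕ→ℚ ∣ X ∣) ≤ edgesIn G X

KNRS : Graph → Set
KNRS H = ∀ (d ε : ℚ) → 0ℚ < d → 0ℚ < ε →
  Σ ℚ λ ρ → 0ℚ < ρ × Σ ℕ λ N → ∀ (G : Graph) → N ℕ.≤ n G → Dense ρ d G →
    (1ℚ - ε) * (d ^ℚ e H) ≤ t H G

WeaklyKNRS : Graph → Set
WeaklyKNRS H = Σ ℚ λ c → 0ℚ < c × c ≤ 1ℚ × (∀ (d : ℚ) → 0ℚ < d →
  Σ ℚ λ ρ → 0ℚ < ρ × Σ ℕ λ N → ∀ (G : Graph) → N ℕ.≤ n G → Dense ρ d G →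
    c * (d ^ℚ e H) ≤ t H G)

{-# OPTIONS --safe #-}
module Submission where

-- The homomorphism density of a subdivision of H in G is an average over maps V(H) → V(G) of
-- products of walk densities, one factor for each edge of H. Pass to a subset of G of large
-- minimum degree and let w count the walks of length k in it. Dividing the walk kernel by w x
-- * w y gives a kernel that is locally dense with respect to the measure proportional to w:
-- for walks of length 2k this is Cauchy–Schwarz and needs no hypothesis on G; for length 2k +
-- 1 the middle edge is handled by the density of G, after random rounding from sets to
-- functions. KNRS is stated for graphs, so the kernel is realised by an explicit quasirandom
-- blow-up. Each path end contributes a factor w, which pays for the change of measure at every
-- non-isolated vertex of H and leaves a constant-factor loss. For Sidorenko the constant is
-- removed by the tensor power trick.

open import Defs renaming (sym to adj-sym; irrefl to adj-irrefl)
open import Data.Nat as ℕ using (ℕ; zero; suc; s≤s; z≤n)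
import Data.Nat.Properties as ℕ
import Data.Nat.DivMod as ℕ
import Data.Integer as ℤ
import Data.Integer.Properties as ℤ
open import Data.Bool using (Bool; true; false; _∧_; _∨_; not; T; T?)
open import Data.Bool.Properties using (∧-zeroʳ; ∨-zeroʳ; not-involutive)
open import Data.Fin as Fin using (Fin; zero; suc; toℕ; splitAt; remQuot)
import Data.Fin.Properties as Fin
open import Data.Rational hiding (truncate; ∣_∣)
open import Data.Rational.Properties
import Data.Rational.Unnormalised as ℚᵘ
import Data.Rational.Unnormalised.Properties as ℚᵘ
open import Data.List as List using (List; []; _∷_; length; allFin; concatMap; map; _++_)
import Data.List.Properties as List
open import Data.List.Membership.Propositional using (_∈_)
open import Data.List.Membership.Propositional.Properties using (∈-filter⁺; ∈-filter⁻; ∈-cartesianProduct⁺; ∈-allFin; ∈-lookup)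
open import Data.Fin.Subset using (Subset; ∣_∣)
import Data.Vec as Vec
import Data.Vec.Properties as Vec
open import Data.List.Relation.Unary.Any as Any using (here; there)
import Data.List.Relation.Unary.Any.Properties as Any
open import Data.List.Relation.Unary.All as All using (All; []; _∷_)
open import Data.List.Relation.Unary.AllPairs using ([]; _∷_)
open import Data.List.Relation.Unary.Unique.Propositional using (Unique)
import Data.List.Relation.Unary.Unique.Propositional.Properties as Unique
open import Data.Maybe.Base using (Maybe; just; nothing)
open import Data.Product using (Σ; ∃; _×_; _,_; proj₁; proj₂)
open import Data.Product.Properties using (,-injectiveˡ; ,-injectiveʳ)
open import Data.Sum as Sum using (_⊎_; inj₁; inj₂)
open import Data.Sum.Properties using (inj₁-injective; inj₂-injective; [,]-cong)
open import Data.Empty using (⊥-elim)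
open import Function using (_∘_; case_of_; it)
open import Level using (0ℓ)
open import Relation.Nullary using (Dec; yes; no; does)
open import Relation.Binary.PropositionalEquality hiding ([_]; J)
open import Tactic.RingSolver using (solve-∀)
import Data.Nat.Tactic.RingSolver as ℕ-solver
import Tactic.RingSolver.Core.AlmostCommutativeRing as ACR

private variable
  A B X Y : Set

-- The exponents dictate the design; here k is one less than in the theorem. With η a quarter of the
-- edge density p, minimum degree η forces w ≥ θ = η^(k+1) wherever w is nonzero. Scaling L x y / (w
-- x * w y) into [0,1] then takes a factor θ², and θ² is a constant times p^(2k+2), exactly the
-- power owed to a path of length 2k+2. In the odd case the middle edge supplies one further factor
-- d. All other losses depend on H and k only. KNRS is invoked at half the required density and with
-- ε = ½; this slack absorbs the errors of the blow-up. The size of the blow-up is a free parameter,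
-- so it can always be made large enough, however small G is. Random rounding is forced because a
-- set of starting points, once spread along walks, becomes a weight function, while local density
-- speaks of sets. The even bound holds for every symmetric kernel with values in [0,1] and positive
-- mean, with one constant for all of them; this is what admits tensor powers.

ℚ-ring : ACR.AlmostCommutativeRing 0ℓ 0ℓ
ℚ-ring = ACR.fromCommutativeRing +-*-commutativeRing isZero
  where
  isZero : ∀ p → Maybe (0ℚ ≡ p)
  isZero p with 0ℚ ≟ p
  ... | yes eq = just eq
  ... | no _   = nothing

-- Rational arithmetic

≤-by : ∀ {a b} r → b ≡ a + r → 0ℚ ≤ r → a ≤ b
≤-by {a} r refl 0≤r = subst (_≤ a + r) (+-identityʳ a) (+-monoʳ-≤ a 0≤r)

≤⇒0≤- : ∀ {a b} → a ≤ b → 0ℚ ≤ b - a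
≤⇒0≤- {a} {b} p = subst (_≤ b - a) (+-inverseʳ a) (+-monoˡ-≤ (- a) p)

+-nonneg : ∀ {a b} → 0ℚ ≤ a → 0ℚ ≤ b → 0ℚ ≤ a + b
+-nonneg = +-mono-≤

*-nonneg : ∀ {a b} → 0ℚ ≤ a → 0ℚ ≤ b → 0ℚ ≤ a * b
*-nonneg {a} {b} p q =
  nonNegative⁻¹ (a * b) {{nonNeg*nonNeg⇒nonNeg a {{nonNegative p}} b {{nonNegative q}}}}

*-pos : ∀ {a b} → 0ℚ < a → 0ℚ < b → 0ℚ < a * b
*-pos {a} {b} p q = positive⁻¹ (a * b) {{pos*pos⇒pos a {{positive p}} b {{positive q}}}}

*-monoˡ : ∀ {a b c} → 0ℚ ≤ c → a ≤ b → c * a ≤ c * b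
*-monoˡ {c = c} p = *-monoˡ-≤-nonNeg c {{nonNegative p}}

*-monoʳ : ∀ {a b c} → 0ℚ ≤ c → a ≤ b → a * c ≤ b * c
*-monoʳ {c = c} p = *-monoʳ-≤-nonNeg c {{nonNegative p}}

*-mono : ∀ {a b c d} → 0ℚ ≤ a → 0ℚ ≤ c → a ≤ b → c ≤ d → a * c ≤ b * d
*-mono 0≤a 0≤c p q = ≤-trans (*-monoˡ 0≤a q) (*-monoʳ (≤-trans 0≤c q) p)

*-cancelˡ : ∀ {a b c} → 0ℚ < c → c * a ≤ c * b → a ≤ b
*-cancelˡ {c = c} p = *-cancelˡ-≤-pos c {{positive p}}

sq-nonneg : ∀ a → 0ℚ ≤ a * a
sq-nonneg a with ≤-total 0ℚ a
... | inj₁ p = *-nonneg p p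
... | inj₂ p = subst (0ℚ ≤_) (neg² a) (*-nonneg (neg-antimono-≤ p) (neg-antimono-≤ p))
  where
  neg² : ∀ a → (- a) * (- a) ≡ a * a
  neg² = solve-∀ ℚ-ring

sq-≤⇒≤ : ∀ {a b} → 0ℚ ≤ b → a * a ≤ b * b → a ≤ b
sq-≤⇒≤ {a} {b} 0≤b p with a ≤? b
... | yes q = q
... | no  q = ⊥-elim (<-irrefl refl (<-≤-trans (≤-<-trans (*-monoˡ 0≤b (<⇒≤ b<a)) (*-monoˡ-<-pos a {{positive 0<a}} b<a)) p))
  where
  b<a : b < a
  b<a = ≰⇒> q
  0<a : 0ℚ < a
  0<a = ≤-<-trans 0≤b b<a

interchange : ∀ a b c d → a * b * (c * d) ≡ a * c * (b * d)
interchange = solve-∀ ℚ-ring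

0≤1 : 0ℚ ≤ 1ℚ
0≤1 = <⇒≤ (positive⁻¹ 1ℚ)

0≤½ : 0ℚ ≤ ½
0≤½ = <⇒≤ (positive⁻¹ ½)

0<½ : 0ℚ < ½
0<½ = positive⁻¹ ½

In01 : ℚ → Set
In01 a = 0ℚ ≤ a × a ≤ 1ℚ

In01-1 : In01 1ℚ
In01-1 = 0≤1 , ≤-refl

In01-0 : In01 0ℚ
In01-0 = ≤-refl , 0≤1

In01-½ : In01 ½
In01-½ = 0≤½ , ≤-by ½ refl 0≤½

In01-* : ∀ {a b} → In01 a → In01 b → In01 (a * b)
In01-* (p , q) (r , s) = *-nonneg p r , *-mono p r q s

-- inv 0 = 0
inv : ℚ → ℚ
inv p with p ≟ 0ℚ
... | yes _   = 0ℚ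
... | no  p≢0 = (1/ p) {{≢-nonZero p≢0}}

*-inv : ∀ {p} → 0ℚ < p → p * inv p ≡ 1ℚ
*-inv {p} 0<p with p ≟ 0ℚ
... | yes refl = ⊥-elim (<-irrefl refl 0<p)
... | no  p≢0  = *-inverseʳ p {{≢-nonZero p≢0}}

inv-pos : ∀ {p} → 0ℚ < p → 0ℚ < inv p
inv-pos {p} 0<p with p ≟ 0ℚ
... | yes refl = ⊥-elim (<-irrefl refl 0<p)
... | no  p≢0  = positive⁻¹ _ {{1/pos⇒pos p {{positive 0<p}}}}

inv-nonneg : ∀ {p} → 0ℚ ≤ p → 0ℚ ≤ inv p
inv-nonneg {p} 0≤p with p ≟ 0ℚ
... | yes _    = ≤-refl
... | no  p≢0  = <⇒≤ (positive⁻¹ _ {{1/pos⇒pos p {{nonNeg∧nonZero⇒pos p {{nonNegative 0≤p}} {{≢-nonZero p≢0}}}}}})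

inv-unique : ∀ {p r} → 0ℚ < p → p * r ≡ 1ℚ → r ≡ inv p
inv-unique {p} {r} 0<p e = begin
  r                ≡⟨ lem r p (inv p) ⟩
  r * (1ℚ - p * inv p) + inv p * (p * r - 1ℚ) + inv p ≡⟨ cong₂ (λ x y → r * (1ℚ - x) + inv p * (y - 1ℚ) + inv p) (*-inv 0<p) e ⟩
  r * (1ℚ - 1ℚ) + inv p * (1ℚ - 1ℚ) + inv p ≡⟨ lem′ r (inv p) ⟩
  inv p ∎
  where
  open ≡-Reasoning
  lem : ∀ r p i → r ≡ r * (1ℚ - p * i) + i * (p * r - 1ℚ) + i
  lem = solve-∀ ℚ-ring
  lem′ : ∀ r i → r * (1ℚ - 1ℚ) + i * (1ℚ - 1ℚ) + i ≡ i
  lem′ = solve-∀ ℚ-ring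

inv-* : ∀ {p q} → 0ℚ < p → 0ℚ < q → inv (p * q) ≡ inv p * inv q
inv-* {p} {q} 0<p 0<q = sym (inv-unique (*-pos 0<p 0<q)
  (trans (lem p q (inv p) (inv q)) (cong₂ _*_ (*-inv 0<p) (*-inv 0<q))))
  where
  lem : ∀ p q i j → p * q * (i * j) ≡ (p * i) * (q * j)
  lem = solve-∀ ℚ-ring

ℕ→ℚ-+ : ∀ a b → ℕ→ℚ (a ℕ.+ b) ≡ ℕ→ℚ a + ℕ→ℚ b
ℕ→ℚ-+ a b = toℚᵘ-injective (ℚᵘ.≃-trans (toℚᵘ-fromℚᵘ (ℚᵘ.mkℚᵘ (ℤ.+ (a ℕ.+ b)) 0)) (ℚᵘ.≃-sym (ℚᵘ.≃-trans (toℚᵘ-homo-+ (ℕ→ℚ a) (ℕ→ℚ b))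
  (ℚᵘ.≃-trans (ℚᵘ.+-cong (toℚᵘ-fromℚᵘ (ℚᵘ.mkℚᵘ (ℤ.+ a) 0)) (toℚᵘ-fromℚᵘ (ℚᵘ.mkℚᵘ (ℤ.+ b) 0)))
    (ℚᵘ.*≡* (cong (ℤ._* (ℤ.+ 1)) (cong₂ ℤ._+_ (ℤ.*-identityʳ (ℤ.+ a)) (ℤ.*-identityʳ (ℤ.+ b)))))))))

ℕ→ℚ-* : ∀ a b → ℕ→ℚ (a ℕ.* b) ≡ ℕ→ℚ a * ℕ→ℚ b
ℕ→ℚ-* zero    b = sym (*-zeroˡ (ℕ→ℚ b))
ℕ→ℚ-* (suc a) b = begin
  ℕ→ℚ (b ℕ.+ a ℕ.* b)          ≡⟨ ℕ→ℚ-+ b (a ℕ.* b) ⟩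
  ℕ→ℚ b + ℕ→ℚ (a ℕ.* b)        ≡⟨ cong (ℕ→ℚ b +_) (ℕ→ℚ-* a b) ⟩
  ℕ→ℚ b + ℕ→ℚ a * ℕ→ℚ b        ≡⟨ lem (ℕ→ℚ a) (ℕ→ℚ b) ⟩
  (1ℚ + ℕ→ℚ a) * ℕ→ℚ b         ≡⟨ cong (_* ℕ→ℚ b) (ℕ→ℚ-+ 1 a) ⟨
  ℕ→ℚ (suc a) * ℕ→ℚ b ∎
  where
  open ≡-Reasoning
  lem : ∀ a b → b + a * b ≡ (1ℚ + a) * b
  lem = solve-∀ ℚ-ring

ℕ→ℚ-nonneg : ∀ a → 0ℚ ≤ ℕ→ℚ a
ℕ→ℚ-nonneg a = nonNegative⁻¹ (ℕ→ℚ a) {{normalize-nonNeg a 1}}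

ℕ→ℚ-mono : ∀ {a b} → a ℕ.≤ b → ℕ→ℚ a ≤ ℕ→ℚ b
ℕ→ℚ-mono {a} {b} a≤b = ≤-by (ℕ→ℚ (b ℕ.∸ a))
  (trans (cong ℕ→ℚ (sym (ℕ.m+[n∸m]≡n a≤b))) (ℕ→ℚ-+ a (b ℕ.∸ a))) (ℕ→ℚ-nonneg (b ℕ.∸ a))

ℕ→ℚ-suc : ∀ a → ℕ→ℚ (suc a) ≡ 1ℚ + ℕ→ℚ a
ℕ→ℚ-suc a = ℕ→ℚ-+ 1 a

ℕ→ℚ-pos : ∀ {a} → 0 ℕ.< a → 0ℚ < ℕ→ℚ a
ℕ→ℚ-pos {suc a} _ = positive⁻¹ (ℕ→ℚ (suc a)) {{normalize-pos (suc a) 1}}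

/-as-inv : ∀ c d .{{_ : ℕ.NonZero d}} → (ℤ.+ c) / d ≡ inv (ℕ→ℚ d) * ℕ→ℚ c
/-as-inv c (suc d) = begin
  q                            ≡⟨ *-identityˡ q ⟨
  1ℚ * q                       ≡⟨ cong (_* q) (*-inv 0<d) ⟨
  ℕ→ℚ (suc d) * i * q          ≡⟨ lem (ℕ→ℚ (suc d)) i q ⟩
  i * (ℕ→ℚ (suc d) * q)        ≡⟨ cong (i *_) dq≡c ⟩
  i * ℕ→ℚ c ∎
  where
  open ≡-Reasoning
  q i : ℚ
  q = (ℤ.+ c) / suc d
  i = inv (ℕ→ℚ (suc d))
  0<d : 0ℚ < ℕ→ℚ (suc d)
  0<d = ℕ→ℚ-pos {suc d} (s≤s z≤n)
  lem : ∀ d i q → d * i * q ≡ i * (d * q)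
  lem = solve-∀ ℚ-ring
  dq≡c : ℕ→ℚ (suc d) * q ≡ ℕ→ℚ c
  dq≡c = toℚᵘ-injective (ℚᵘ.≃-trans (toℚᵘ-homo-* (ℕ→ℚ (suc d)) q)
    (ℚᵘ.≃-trans (ℚᵘ.*-cong (toℚᵘ-fromℚᵘ (ℚᵘ.mkℚᵘ (ℤ.+ suc d) 0)) (toℚᵘ-fromℚᵘ (ℚᵘ.mkℚᵘ (ℤ.+ c) d)))
     (ℚᵘ.≃-trans (ℚᵘ.*≡* (trans (ℤ.*-identityʳ _) (trans (ℤ.*-comm (ℤ.+ suc d) (ℤ.+ c)) (cong ((ℤ.+ c) ℤ.*_) (cong (ℤ.+_) (sym (ℕ.*-identityˡ (suc d)))))))) (ℚᵘ.≃-sym (toℚᵘ-fromℚᵘ (ℚᵘ.mkℚᵘ (ℤ.+ c) 0))))))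

archimedean : ∀ p → ∃ λ N → p ≤ ℕ→ℚ N
archimedean p = ℤ.∣ ↥ p ∣ , subst (_≤ ℕ→ℚ ℤ.∣ ↥ p ∣) (↥p/↧p≡p p)
  (toℚᵘ-cancel-≤ (ℚᵘ.≤-respˡ-≃ (ℚᵘ.≃-sym (toℚᵘ-fromℚᵘ (ℚᵘ.mkℚᵘ (↥ p) (ℚ.denominator-1 p))))
     (ℚᵘ.≤-respʳ-≃ (ℚᵘ.≃-sym (toℚᵘ-fromℚᵘ (ℚᵘ.mkℚᵘ (ℤ.+ ℤ.∣ ↥ p ∣) 0)))
      (ℚᵘ.*≤* (le (↥ p) (ℚ.denominator-1 p))))))
  where
  le : ∀ z d → z ℤ.* ℤ.+ 1 ℤ.≤ (ℤ.+ ℤ.∣ z ∣) ℤ.* ℤ.+ suc d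
  le (ℤ.+ a) d = subst₂ ℤ._≤_ (sym (ℤ.*-identityʳ (ℤ.+ a))) (ℤ.pos-* a (suc d)) (ℤ.+≤+ (ℕ.m≤m*n a (suc d)))
  le (ℤ.-[1+ a ]) d = ℤ.-≤+

-- Finite sums and averages

∑ : List A → (A → ℚ) → ℚ
∑ []       F = 0ℚ
∑ (x ∷ xs) F = F x + ∑ xs F

∑-cong∈ : ∀ (l : List A) {F G : A → ℚ} → (∀ x → x ∈ l → F x ≡ G x) → ∑ l F ≡ ∑ l G
∑-cong∈ []       e = refl
∑-cong∈ (x ∷ xs) e = cong₂ _+_ (e x (here refl)) (∑-cong∈ xs λ y y∈ → e y (there y∈))

∑-cong : ∀ (l : List A) {F G : A → ℚ} → (∀ x → F x ≡ G x) → ∑ l F ≡ ∑ l G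
∑-cong l e = ∑-cong∈ l λ x _ → e x

∑-mono : ∀ (l : List A) {F G : A → ℚ} → (∀ x → F x ≤ G x) → ∑ l F ≤ ∑ l G
∑-mono []       e = ≤-refl
∑-mono (x ∷ xs) e = +-mono-≤ (e x) (∑-mono xs e)

∑-0 : ∀ (l : List A) → ∑ l (λ _ → 0ℚ) ≡ 0ℚ
∑-0 []       = refl
∑-0 (x ∷ xs) = trans (+-identityˡ _) (∑-0 xs)

∑-+ : ∀ (l : List A) (F G : A → ℚ) → ∑ l (λ x → F x + G x) ≡ ∑ l F + ∑ l G
∑-+ []       F G = refl
∑-+ (x ∷ xs) F G = trans (cong (F x + G x +_) (∑-+ xs F G)) (lem (F x) (G x) (∑ xs F) (∑ xs G))
  where
  lem : ∀ a b c d → a + b + (c + d) ≡ a + c + (b + d)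
  lem = solve-∀ ℚ-ring

∑-*ˡ : ∀ (l : List A) c (F : A → ℚ) → ∑ l (λ x → c * F x) ≡ c * ∑ l F
∑-*ˡ []       c F = sym (*-zeroʳ c)
∑-*ˡ (x ∷ xs) c F = trans (cong (c * F x +_) (∑-*ˡ xs c F)) (sym (*-distribˡ-+ c (F x) (∑ xs F)))

∑-const : ∀ (l : List A) c → ∑ l (λ _ → c) ≡ ℕ→ℚ (length l) * c
∑-const []       c = sym (*-zeroˡ c)
∑-const (x ∷ xs) c = begin
  c + ∑ xs (λ _ → c)          ≡⟨ cong (c +_) (∑-const xs c) ⟩
  c + ℕ→ℚ (length xs) * c     ≡⟨ lem c (ℕ→ℚ (length xs)) ⟩
  (1ℚ + ℕ→ℚ (length xs)) * c  ≡⟨ cong (_* c) (ℕ→ℚ-suc (length xs)) ⟨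
  ℕ→ℚ (suc (length xs)) * c   ∎
  where
  open ≡-Reasoning
  lem : ∀ c n → c + n * c ≡ (1ℚ + n) * c
  lem = solve-∀ ℚ-ring

∑-swap : ∀ (l : List A) (m : List B) (F : A → B → ℚ) →
  ∑ l (λ x → ∑ m (F x)) ≡ ∑ m (λ y → ∑ l (λ x → F x y))
∑-swap []       m F = sym (∑-0 m)
∑-swap (x ∷ xs) m F = trans (cong (∑ m (F x) +_) (∑-swap xs m F))
  (sym (∑-+ m (F x) (λ y → ∑ xs (λ x → F x y))))

∑-++ : ∀ (l m : List A) (F : A → ℚ) → ∑ (l ++ m) F ≡ ∑ l F + ∑ m F
∑-++ []       m F = sym (+-identityˡ _)
∑-++ (x ∷ xs) m F = trans (cong (F x +_) (∑-++ xs m F)) (sym (+-assoc (F x) (∑ xs F) (∑ m F)))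

∑-map : ∀ (g : A → B) (l : List A) (F : B → ℚ) → ∑ (map g l) F ≡ ∑ l (F ∘ g)
∑-map g []       F = refl
∑-map g (x ∷ xs) F = cong (F (g x) +_) (∑-map g xs F)

∑-concatMap : ∀ (g : A → List B) (l : List A) (F : B → ℚ) →
  ∑ (concatMap g l) F ≡ ∑ l (λ x → ∑ (g x) F)
∑-concatMap g []       F = refl
∑-concatMap g (x ∷ xs) F = trans (∑-++ (g x) (concatMap g xs) F) (cong (∑ (g x) F +_) (∑-concatMap g xs F))

∑-tabulate : ∀ {m} (g : Fin m → A) (F : A → ℚ) → ∑ (List.tabulate g) F ≡ ∑ (allFin m) (F ∘ g)
∑-tabulate {m = m} g F = trans (cong (λ l → ∑ l F) (sym (List.map-tabulate (λ i → i) g))) (∑-map g (allFin m) F)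

∑-lookup : ∀ (l : List A) (F : A → ℚ) → ∑ (allFin (length l)) (F ∘ List.lookup l) ≡ ∑ l F
∑-lookup l F = trans (sym (∑-tabulate (List.lookup l) F)) (cong (λ l → ∑ l F) (List.tabulate-lookup l))

∑-Fin-suc : ∀ {m} (F : Fin (suc m) → ℚ) → ∑ (allFin (suc m)) F ≡ F zero + ∑ (allFin m) (F ∘ suc)
∑-Fin-suc F = cong (F zero +_) (∑-tabulate suc F)

data NonEmpty {A : Set} : List A → Set where
  nonEmpty : ∀ {x xs} → NonEmpty (x ∷ xs)

length-pos : ∀ {l : List A} → NonEmpty l → 0ℚ < ℕ→ℚ (length l)
length-pos (nonEmpty {xs = xs}) = ℕ→ℚ-pos {suc (length xs)} (s≤s z≤n)

length-inv-nonneg : ∀ (l : List A) → 0ℚ ≤ inv (ℕ→ℚ (length l))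
length-inv-nonneg l = inv-nonneg (ℕ→ℚ-nonneg (length l))

-- A list stands for the probability measure that picks a position uniformly, so repetitions
-- encode weights. Averages over the empty list are 0.
opaque
  mean : List A → (A → ℚ) → ℚ
  mean l F = inv (ℕ→ℚ (length l)) * ∑ l F

  mean-def : ∀ (l : List A) (F : A → ℚ) → mean l F ≡ inv (ℕ→ℚ (length l)) * ∑ l F
  mean-def l F = refl

  mean-cong∈ : ∀ (l : List A) {F G : A → ℚ} → (∀ x → x ∈ l → F x ≡ G x) → mean l F ≡ mean l G
  mean-cong∈ l e = cong (inv (ℕ→ℚ (length l)) *_) (∑-cong∈ l e)

  mean-mono : ∀ (l : List A) {F G : A → ℚ} → (∀ x → F x ≤ G x) → mean l F ≤ mean l G
  mean-mono l e = *-monoˡ (length-inv-nonneg l) (∑-mono l e)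

  mean-+ : ∀ (l : List A) (F G : A → ℚ) → mean l (λ x → F x + G x) ≡ mean l F + mean l G
  mean-+ l F G = trans (cong (inv (ℕ→ℚ (length l)) *_) (∑-+ l F G))
    (*-distribˡ-+ (inv (ℕ→ℚ (length l))) (∑ l F) (∑ l G))

  mean-*ˡ : ∀ (l : List A) c (F : A → ℚ) → mean l (λ x → c * F x) ≡ c * mean l F
  mean-*ˡ l c F = trans (cong (inv (ℕ→ℚ (length l)) *_) (∑-*ˡ l c F)) (lem (inv (ℕ→ℚ (length l))) c (∑ l F))
    where
    lem : ∀ i c s → i * (c * s) ≡ c * (i * s)
    lem = solve-∀ ℚ-ring

  mean-const : ∀ {l : List A} → NonEmpty l → ∀ c → mean l (λ _ → c) ≡ c
  mean-const {l = l} ne c = begin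
    i * ∑ l (λ _ → c)  ≡⟨ cong (i *_) (∑-const l c) ⟩
    i * (N * c)        ≡⟨ lem i N c ⟩
    N * i * c          ≡⟨ cong (_* c) (*-inv (length-pos ne)) ⟩
    1ℚ * c             ≡⟨ *-identityˡ c ⟩
    c                  ∎
    where
    open ≡-Reasoning
    N i : ℚ
    N = ℕ→ℚ (length l)
    i = inv N
    lem : ∀ i N c → i * (N * c) ≡ N * i * c
    lem = solve-∀ ℚ-ring

  mean-∑-swap : ∀ (l : List A) (m : List B) (F : A → B → ℚ) →
    mean l (λ x → ∑ m (F x)) ≡ ∑ m (λ y → mean l (λ x → F x y))
  mean-∑-swap l m F = trans (cong (inv (ℕ→ℚ (length l)) *_) (∑-swap l m F))
    (sym (∑-*ˡ m (inv (ℕ→ℚ (length l))) (λ y → ∑ l (λ x → F x y))))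

  mean-lookup : ∀ (l : List A) (F : A → ℚ) → mean (allFin (length l)) (F ∘ List.lookup l) ≡ mean l F
  mean-lookup l F = cong₂ (λ n s → inv (ℕ→ℚ n) * s) (List.length-tabulate {n = length l} (λ i → i)) (∑-lookup l F)

mean-cong : ∀ (l : List A) {F G : A → ℚ} → (∀ x → F x ≡ G x) → mean l F ≡ mean l G
mean-cong l e = mean-cong∈ l λ x _ → e x

mean-*ʳ : ∀ (l : List A) c (F : A → ℚ) → mean l (λ x → F x * c) ≡ mean l F * c
mean-*ʳ l c F = trans (mean-cong l λ x → *-comm (F x) c) (trans (mean-*ˡ l c F) (*-comm c _))

mean-0 : ∀ (l : List A) → mean l (λ _ → 0ℚ) ≡ 0ℚ
mean-0 l = trans (mean-*ˡ l 0ℚ (λ _ → 0ℚ)) (*-zeroˡ (mean l (λ _ → 0ℚ)))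

mean-nonneg : ∀ (l : List A) {F : A → ℚ} → (∀ x → 0ℚ ≤ F x) → 0ℚ ≤ mean l F
mean-nonneg l {F} p = subst (_≤ mean l F) (mean-0 l) (mean-mono l p)

mean-≤1 : ∀ {l : List A} → NonEmpty l → {F : A → ℚ} → (∀ x → F x ≤ 1ℚ) → mean l F ≤ 1ℚ
mean-≤1 {l = l} ne {F} p = subst (mean l F ≤_) (mean-const ne 1ℚ) (mean-mono l p)

mean-01 : ∀ {l : List A} → NonEmpty l → {F : A → ℚ} → (∀ x → In01 (F x)) → In01 (mean l F)
mean-01 {l = l} ne p = mean-nonneg l (proj₁ ∘ p) , mean-≤1 ne (proj₂ ∘ p)

mean-swap : ∀ (l : List A) (m : List B) (F : A → B → ℚ) →
  mean l (λ x → mean m (F x)) ≡ mean m (λ y → mean l (λ x → F x y))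
mean-swap l m F = begin
  mean l (λ x → mean m (F x))          ≡⟨ mean-cong l (λ x → mean-def m (F x)) ⟩
  mean l (λ x → i * ∑ m (F x))         ≡⟨ mean-*ˡ l i (λ x → ∑ m (F x)) ⟩
  i * mean l (λ x → ∑ m (F x))         ≡⟨ cong (i *_) (mean-∑-swap l m F) ⟩
  i * ∑ m (λ y → mean l (λ x → F x y)) ≡⟨ mean-def m (λ y → mean l (λ x → F x y)) ⟨
  mean m (λ y → mean l (λ x → F x y))  ∎
  where
  open ≡-Reasoning
  i : ℚ
  i = inv (ℕ→ℚ (length m))

mean-neg : ∀ (l : List A) (F : A → ℚ) → mean l (λ x → - F x) ≡ - mean l F
mean-neg l F = trans (mean-cong l λ x → lem (F x)) (trans (mean-*ˡ l (- 1ℚ) F) (sym (lem (mean l F))))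
  where
  lem : ∀ a → - a ≡ (- 1ℚ) * a
  lem = solve-∀ ℚ-ring

mean-sub : ∀ (l : List A) (F G : A → ℚ) → mean l (λ x → F x - G x) ≡ mean l F - mean l G
mean-sub l F G = trans (mean-+ l F (λ x → - G x)) (cong (mean l F +_) (mean-neg l G))

mean-×-mean : ∀ (l : List A) (m : List B) (F : A → ℚ) (G : B → ℚ) →
  mean l (λ x → mean m (λ y → F x * G y)) ≡ mean l F * mean m G
mean-×-mean l m F G = trans (mean-cong l λ x → mean-*ˡ m (F x) G) (mean-*ʳ l (mean m G) F)

-- The difference of the two sides is the variance, a mean of squares. On the empty list both sides
-- are 0.
jensen : ∀ {A : Set} (l : List A) (F : A → ℚ) → mean l F * mean l F ≤ mean l (λ x → F x * F x)
jensen {A} []        F = ≤-reflexive (trans (cong₂ _*_ (empty F) (empty F)) (sym (empty λ x → F x * F x)))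
  where
  empty : ∀ (F : A → ℚ) → mean [] F ≡ 0ℚ
  empty F = trans (mean-def [] F) (*-zeroʳ (inv (ℕ→ℚ 0)))
jensen l@(_ ∷ _) F = ≤-by (mean l λ x → (F x - c) * (F x - c)) eq (mean-nonneg l λ x → sq-nonneg (F x - c))
  where
  open ≡-Reasoning
  c : ℚ
  c = mean l F
  expand : ∀ f c → (f - c) * (f - c) ≡ f * f + (- (c + c) * f + c * c)
  expand = solve-∀ ℚ-ring
  collect : ∀ s c → s ≡ c * c + (s + (- (c + c) * c + c * c))
  collect = solve-∀ ℚ-ring
  S : ℚ
  S = mean l (λ x → F x * F x)
  eq : S ≡ c * c + mean l (λ x → (F x - c) * (F x - c))
  eq = begin
    S ≡⟨ collect S c ⟩
    c * c + (S + (- (c + c) * c + c * c)) ≡⟨ cong (λ z → c * c + (S + z)) (cong₂ _+_ (mean-*ˡ l (- (c + c)) F) (mean-const {l = l} nonEmpty (c * c))) ⟨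
    c * c + (S + (mean l (λ x → - (c + c) * F x) + mean l (λ _ → c * c))) ≡⟨ cong (λ z → c * c + (S + z)) (mean-+ l (λ x → - (c + c) * F x) (λ _ → c * c)) ⟨
    c * c + (S + mean l (λ x → - (c + c) * F x + c * c)) ≡⟨ cong (c * c +_) (mean-+ l (λ x → F x * F x) (λ x → - (c + c) * F x + c * c)) ⟨
    c * c + mean l (λ x → F x * F x + (- (c + c) * F x + c * c)) ≡⟨ cong (c * c +_) (mean-cong l λ x → sym (expand (F x) c)) ⟩
    c * c + mean l (λ x → (F x - c) * (F x - c)) ∎

∏ : List A → (A → ℚ) → ℚ
∏ []       F = 1ℚ
∏ (x ∷ xs) F = F x * ∏ xs F

∏-cong∈ : ∀ (l : List A) {F G : A → ℚ} → (∀ x → x ∈ l → F x ≡ G x) → ∏ l F ≡ ∏ l G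
∏-cong∈ []       e = refl
∏-cong∈ (x ∷ xs) e = cong₂ _*_ (e x (here refl)) (∏-cong∈ xs λ y y∈ → e y (there y∈))

∏-cong : ∀ (l : List A) {F G : A → ℚ} → (∀ x → F x ≡ G x) → ∏ l F ≡ ∏ l G
∏-cong l e = ∏-cong∈ l λ x _ → e x

∏-01 : ∀ (l : List A) {F : A → ℚ} → (∀ x → In01 (F x)) → In01 (∏ l F)
∏-01 []       p = In01-1
∏-01 (x ∷ xs) p = In01-* (p x) (∏-01 xs p)

∏-nonneg : ∀ (l : List A) {F : A → ℚ} → (∀ x → 0ℚ ≤ F x) → 0ℚ ≤ ∏ l F
∏-nonneg []       p = 0≤1
∏-nonneg (x ∷ xs) p = *-nonneg (p x) (∏-nonneg xs p)

∏-mono : ∀ (l : List A) {F G : A → ℚ} → (∀ x → 0ℚ ≤ F x) → (∀ x → F x ≤ G x) → ∏ l F ≤ ∏ l G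
∏-mono []       p q = ≤-refl
∏-mono (x ∷ xs) p q = *-mono (p x) (∏-nonneg xs p) (q x) (∏-mono xs p q)

∏-* : ∀ (l : List A) (F G : A → ℚ) → ∏ l (λ x → F x * G x) ≡ ∏ l F * ∏ l G
∏-* []       F G = refl
∏-* (x ∷ xs) F G = trans (cong (F x * G x *_) (∏-* xs F G)) (interchange (F x) (G x) (∏ xs F) (∏ xs G))

∏-1 : ∀ (l : List A) → ∏ l (λ _ → 1ℚ) ≡ 1ℚ
∏-1 []      = refl
∏-1 (_ ∷ l) = trans (*-identityˡ (∏ l (λ _ → 1ℚ))) (∏-1 l)

∏-Fin-suc : ∀ {m} (F : Fin (suc m) → ℚ) → ∏ (allFin (suc m)) F ≡ F zero * ∏ (allFin m) (F ∘ suc)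
∏-Fin-suc {m} F = cong (F zero *_) (tab {m = m} suc)
  where
  tab : ∀ {A : Set} {m} {G : A → ℚ} (g : Fin m → A) → ∏ (List.tabulate g) G ≡ ∏ (allFin m) (G ∘ g)
  tab {m = zero}      g = refl
  tab {m = suc m} {G} g = cong (G (g zero) *_) (trans (tab {m = m} (g ∘ suc)) (sym (tab {m = m} {G ∘ g} suc)))

^ℚ-nonneg : ∀ {a} k → 0ℚ ≤ a → 0ℚ ≤ a ^ℚ k
^ℚ-nonneg zero    p = 0≤1
^ℚ-nonneg (suc k) p = *-nonneg p (^ℚ-nonneg k p)

^ℚ-pos : ∀ {a} k → 0ℚ < a → 0ℚ < a ^ℚ k
^ℚ-pos zero    p = positive⁻¹ 1ℚ
^ℚ-pos (suc k) p = *-pos p (^ℚ-pos k p)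

^ℚ-01 : ∀ {a} k → In01 a → In01 (a ^ℚ k)
^ℚ-01 zero    p = In01-1
^ℚ-01 (suc k) p = In01-* p (^ℚ-01 k p)

^ℚ-distrib-* : ∀ a b k → (a * b) ^ℚ k ≡ (a ^ℚ k) * (b ^ℚ k)
^ℚ-distrib-* a b zero    = refl
^ℚ-distrib-* a b (suc k) = trans (cong (a * b *_) (^ℚ-distrib-* a b k)) (interchange a b (a ^ℚ k) (b ^ℚ k))

^ℚ-+ : ∀ a j k → a ^ℚ (j ℕ.+ k) ≡ (a ^ℚ j) * (a ^ℚ k)
^ℚ-+ a zero    k = sym (*-identityˡ _)
^ℚ-+ a (suc j) k = trans (cong (a *_) (^ℚ-+ a j k)) (sym (*-assoc a _ _))

^ℚ-* : ∀ a j k → a ^ℚ (j ℕ.* k) ≡ (a ^ℚ k) ^ℚ j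
^ℚ-* a zero    k = refl
^ℚ-* a (suc j) k = trans (^ℚ-+ a k (j ℕ.* k)) (cong ((a ^ℚ k) *_) (^ℚ-* a j k))

^ℚ-antimono : ∀ {a} → In01 a → ∀ {j k} → j ℕ.≤ k → a ^ℚ k ≤ a ^ℚ j
^ℚ-antimono {a} p {j} {k} j≤k = subst₂ _≤_ (trans (sym (^ℚ-+ a j (k ℕ.∸ j))) (cong (a ^ℚ_) (ℕ.m+[n∸m]≡n j≤k)))
  (*-identityʳ _) (*-monoˡ (proj₁ (^ℚ-01 j p)) (proj₂ (^ℚ-01 (k ℕ.∸ j) p)))

-- Averages over maps Fin h → X, the value at v being drawn from the list ls v

infixr 5 _◂_
_◂_ : ∀ {h} → X → (Fin h → X) → Fin (suc h) → X
(x ◂ f) zero    = x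
(x ◂ f) (suc i) = f i

E : ∀ h → (Fin h → List X) → ((Fin h → X) → ℚ) → ℚ
E zero    ls F = F (λ ())
E (suc h) ls F = mean (ls zero) λ x → E h (ls ∘ suc) λ f → F (x ◂ f)

-- Maps built in different ways, such as `x ◂ f` and `upd`, agree only pointwise, so functionals of
-- maps carry this condition.
Extensional : ∀ {h} → ((Fin h → X) → ℚ) → Set
Extensional F = ∀ f g → (∀ i → f i ≡ g i) → F f ≡ F g

◂-ext : ∀ {h} {F : (Fin (suc h) → X) → ℚ} → Extensional F → ∀ x → Extensional (λ f → F (x ◂ f))
◂-ext ext x f g e = ext (x ◂ f) (x ◂ g) λ { zero → refl ; (suc i) → e i }

E-cong : ∀ h (ls : Fin h → List X) {F G} → (∀ f → F f ≡ G f) → E h ls F ≡ E h ls G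
E-cong zero    ls e = e _
E-cong (suc h) ls e = mean-cong (ls zero) λ x → E-cong h (ls ∘ suc) λ f → e (x ◂ f)

E-mono : ∀ h (ls : Fin h → List X) {F G} → (∀ f → F f ≤ G f) → E h ls F ≤ E h ls G
E-mono zero    ls e = e _
E-mono (suc h) ls e = mean-mono (ls zero) λ x → E-mono h (ls ∘ suc) λ f → e (x ◂ f)

E-+ : ∀ h (ls : Fin h → List X) F G → E h ls (λ f → F f + G f) ≡ E h ls F + E h ls G
E-+ zero    ls F G = refl
E-+ (suc h) ls F G = trans (mean-cong (ls zero) λ x → E-+ h (ls ∘ suc) _ _) (mean-+ (ls zero) _ _)

E-*ˡ : ∀ h (ls : Fin h → List X) c F → E h ls (λ f → c * F f) ≡ c * E h ls F
E-*ˡ zero    ls c F = refl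
E-*ˡ (suc h) ls c F = trans (mean-cong (ls zero) λ x → E-*ˡ h (ls ∘ suc) c _) (mean-*ˡ (ls zero) c _)

E-const : ∀ h (ls : Fin h → List X) → (∀ v → NonEmpty (ls v)) → ∀ c → E h ls (λ _ → c) ≡ c
E-const zero    ls ne c = refl
E-const (suc h) ls ne c = trans (mean-cong (ls zero) λ x → E-const h (ls ∘ suc) (ne ∘ suc) c) (mean-const (ne zero) c)

E-mean-swap : ∀ h (ls : Fin h → List X) (m : List Y) (F : (Fin h → X) → Y → ℚ) →
  E h ls (λ f → mean m (F f)) ≡ mean m (λ y → E h ls (λ f → F f y))
E-mean-swap zero    ls m F = refl
E-mean-swap (suc h) ls m F = trans (mean-cong (ls zero) λ x → E-mean-swap h (ls ∘ suc) m λ f → F (x ◂ f))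
  (mean-swap (ls zero) m _)

E-nonneg : ∀ h (ls : Fin h → List X) {F} → (∀ f → 0ℚ ≤ F f) → 0ℚ ≤ E h ls F
E-nonneg zero    ls p = p _
E-nonneg (suc h) ls p = mean-nonneg (ls zero) λ x → E-nonneg h (ls ∘ suc) λ f → p (x ◂ f)

E-jensen : ∀ h (ls : Fin h → List X) F → E h ls F * E h ls F ≤ E h ls (λ f → F f * F f)
E-jensen zero    ls F = ≤-refl
E-jensen (suc h) ls F = ≤-trans (jensen (ls zero) _) (mean-mono (ls zero) λ x → E-jensen h (ls ∘ suc) λ f → F (x ◂ f))

upd : ∀ {h} → Fin h → X → (Fin h → X) → Fin h → X
upd zero    a x zero    = a
upd zero    a x (suc i) = x (suc i)
upd (suc u) a x zero    = x zero
upd (suc u) a x (suc i) = upd u a (x ∘ suc) i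

upd-same : ∀ {h} (u : Fin h) (a : X) x → upd u a x u ≡ a
upd-same zero    a x = refl
upd-same (suc u) a x = upd-same u a (x ∘ suc)

upd-other : ∀ {h} (u : Fin h) (a : X) x {i} → i ≢ u → upd u a x i ≡ x i
upd-other zero    a x {zero}  i≢u = ⊥-elim (i≢u refl)
upd-other zero    a x {suc i} i≢u = refl
upd-other (suc u) a x {zero}  i≢u = refl
upd-other (suc u) a x {suc i} i≢u = upd-other u a (x ∘ suc) (i≢u ∘ cong suc)

-- The coordinates are independent, so replacing the value at u by a fresh copy does not change the
-- law. This exposes one coordinate while the others stay frozen.
E-resample : ∀ {h} (ls : Fin h → List X) → (∀ v → NonEmpty (ls v)) → ∀ u F → Extensional F →
  E h ls F ≡ E h ls (λ x → mean (ls u) (λ a → F (upd u a x)))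
E-resample {h = suc h} ls ne zero F ext = begin
  mean l (λ a → E h ls′ (λ f → F (a ◂ f)))                    ≡⟨ E-mean-swap h ls′ l (λ f a → F (a ◂ f)) ⟨
  E h ls′ (λ f → mean l (λ a → F (a ◂ f)))                    ≡⟨ mean-const (ne zero) _ ⟨
  mean l (λ x → E h ls′ (λ f → mean l (λ a → F (a ◂ f))))     ≡⟨ mean-cong l (λ x → E-cong h ls′ λ f → mean-cong l λ a →
                                                                    ext _ _ λ { zero → refl ; (suc i) → refl }) ⟩
  mean l (λ x → E h ls′ (λ f → mean l (λ a → F (upd zero a (x ◂ f))))) ∎
  where
  open ≡-Reasoning
  l   = ls zero
  ls′ = ls ∘ suc
E-resample {h = suc h} ls ne (suc u) F ext = mean-cong (ls zero) λ x →
  trans (E-resample (ls ∘ suc) (ne ∘ suc) u (λ f → F (x ◂ f)) (◂-ext ext x))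
    (E-cong h (ls ∘ suc) λ f → mean-cong (ls (suc u)) λ a → ext _ _ λ { zero → refl ; (suc i) → refl })

-- Change of product measure: `ω v` is the density of `ls′ v` with respect to `ls v`.
E-density : ∀ h (ls ls′ : Fin h → List X) (ω : Fin h → X → ℚ) →
  (∀ v G → mean (ls v) (λ x → ω v x * G x) ≡ mean (ls′ v) G) →
  ∀ F → E h ls (λ x → ∏ (allFin h) (λ v → ω v (x v)) * F x) ≡ E h ls′ F
E-density zero    ls ls′ ω dens F = *-identityˡ _
E-density (suc h) ls ls′ ω dens F = begin
  mean (ls zero) (λ a → E h (ls ∘ suc) λ f → ∏ (allFin (suc h)) (λ v → ω v ((a ◂ f) v)) * F (a ◂ f))
    ≡⟨ mean-cong (ls zero) (λ a → trans (E-cong h (ls ∘ suc) λ f → split a f) (E-*ˡ h (ls ∘ suc) (ω zero a) _)) ⟩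
  mean (ls zero) (λ a → ω zero a * E h (ls ∘ suc) λ f → ∏ (allFin h) (λ v → ω (suc v) (f v)) * F (a ◂ f))
    ≡⟨ dens zero _ ⟩
  mean (ls′ zero) (λ a → E h (ls ∘ suc) λ f → ∏ (allFin h) (λ v → ω (suc v) (f v)) * F (a ◂ f))
    ≡⟨ mean-cong (ls′ zero) (λ a → E-density h (ls ∘ suc) (ls′ ∘ suc) (ω ∘ suc) (dens ∘ suc) (λ f → F (a ◂ f))) ⟩
  mean (ls′ zero) (λ a → E h (ls′ ∘ suc) λ f → F (a ◂ f)) ∎
  where
  open ≡-Reasoning
  split : ∀ a f → ∏ (allFin (suc h)) (λ v → ω v ((a ◂ f) v)) * F (a ◂ f)
    ≡ ω zero a * (∏ (allFin h) (λ v → ω (suc v) (f v)) * F (a ◂ f))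
  split a f = trans (cong (_* F (a ◂ f)) (∏-Fin-suc (λ v → ω v ((a ◂ f) v))))
    (*-assoc (ω zero a) _ _)

-- A coordinate outside T integrates to a constant whatever list it is drawn from. It serves to give
-- isolated vertices of H the uniform measure.
E-irrelevant : ∀ h (T : Fin h → Bool) (ls ls′ : Fin h → List X) →
  (∀ v → NonEmpty (ls v)) → (∀ v → NonEmpty (ls′ v)) → (∀ v → T v ≡ true → ls v ≡ ls′ v) →
  ∀ F → (∀ f g → (∀ v → T v ≡ true → f v ≡ g v) → F f ≡ F g) → E h ls F ≡ E h ls′ F
E-irrelevant zero    T ls ls′ ne ne′ same F dep = refl
E-irrelevant {X = X} (suc h) T ls ls′ ne ne′ same F dep = trans (mean-cong (ls zero) λ a → tail a) (head (T zero) refl)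
  where
  tail : ∀ a → E h (ls ∘ suc) (λ f → F (a ◂ f)) ≡ E h (ls′ ∘ suc) (λ f → F (a ◂ f))
  tail a = E-irrelevant h (T ∘ suc) (ls ∘ suc) (ls′ ∘ suc) (ne ∘ suc) (ne′ ∘ suc) (same ∘ suc) (λ f → F (a ◂ f))
    λ f g e → dep _ _ λ { zero _ → refl ; (suc v) t → e v t }
  head : ∀ b → T zero ≡ b → mean (ls zero) (λ a → E h (ls′ ∘ suc) (λ f → F (a ◂ f)))
    ≡ mean (ls′ zero) (λ a → E h (ls′ ∘ suc) (λ f → F (a ◂ f)))
  head true  e = cong (λ l → mean l (λ a → E h (ls′ ∘ suc) (λ f → F (a ◂ f)))) (same zero e)
  head false e = trans (const (ls zero) (ne zero)) (sym (const (ls′ zero) (ne′ zero)))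
    where
    a₀ : X
    a₀ with ls zero | ne zero
    ... | x ∷ _ | nonEmpty = x
    const : ∀ l → NonEmpty l → mean l (λ a → E h (ls′ ∘ suc) (λ f → F (a ◂ f))) ≡ E h (ls′ ∘ suc) (λ f → F (a₀ ◂ f))
    const l nel = trans (mean-cong l λ a → E-cong h (ls′ ∘ suc) λ f →
      dep _ _ λ { zero t → case trans (sym e) t of λ () ; (suc v) _ → refl }) (mean-const nel _)

E-map : ∀ h (ls : Fin h → List X) (ls′ : Fin h → List Y) (g : X → Y) →
  (∀ v (G : Y → ℚ) → mean (ls v) (G ∘ g) ≡ mean (ls′ v) G) →
  ∀ F → Extensional F → E h ls (λ f → F (g ∘ f)) ≡ E h ls′ F
E-map zero    ls ls′ g e F ext = ext _ _ λ ()
E-map (suc h) ls ls′ g e F ext = trans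
  (mean-cong (ls zero) λ a → trans (E-cong h (ls ∘ suc) λ f → ext _ _ λ { zero → refl ; (suc i) → refl })
    (E-map h (ls ∘ suc) (ls′ ∘ suc) g (e ∘ suc) (λ f → F (g a ◂ f)) (◂-ext ext (g a))))
  (e zero _)

-- Counting lemma

hom : ∀ {h} → List (Fin h × Fin h) → (X → X → ℚ) → (Fin h → X) → ℚ
hom es k x = ∏ es λ e → k (x (proj₁ e)) (x (proj₂ e))

hom-ext : ∀ {h} (es : List (Fin h × Fin h)) (k : X → X → ℚ) → Extensional (hom es k)
hom-ext es k f g e = ∏-cong es λ p → cong₂ k (e (proj₁ p)) (e (proj₂ p))

upd-ext : ∀ {h} (u : Fin h) (a : X) f g → (∀ i → f i ≡ g i) → ∀ i → upd u a f i ≡ upd u a g i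
upd-ext zero    a f g e zero    = refl
upd-ext zero    a f g e (suc i) = e (suc i)
upd-ext (suc u) a f g e zero    = e zero
upd-ext (suc u) a f g e (suc i) = upd-ext u a (f ∘ suc) (g ∘ suc) (e ∘ suc) i

E-resample₂ : ∀ {h} (ls : Fin h → List X) → (∀ v → NonEmpty (ls v)) → ∀ u v F → Extensional F →
  E h ls F ≡ E h ls (λ x → mean (ls u) λ a → mean (ls v) λ b → F (upd v b (upd u a x)))
E-resample₂ ls ne u v F ext = trans (E-resample ls ne v F ext)
  (E-resample ls ne u _ λ f g e → mean-cong (ls v) λ b → ext _ _ (upd-ext v b f g e))

-- With all coordinates but those at u and v frozen, R is a product of a function of each.
-- Discrepancy can be tested only against such products.
Split : ∀ {h} → Fin h → Fin h → ((Fin h → X) → ℚ) → Set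
Split {X} u v R = ∀ x → Σ (X → ℚ) λ φ → Σ (X → ℚ) λ ψ → (∀ a → In01 (φ a)) × (∀ b → In01 (ψ b)) ×
  (∀ a b → R (upd v b (upd u a x)) ≡ φ a * ψ b)

Split-* : ∀ {h} {u v : Fin h} {R S : (Fin h → X) → ℚ} → Split u v R → Split u v S → Split u v (λ x → R x * S x)
Split-* p q x with p x | q x
... | φ , ψ , φ01 , ψ01 , e | φ′ , ψ′ , φ01′ , ψ01′ , e′ =
  (λ a → φ a * φ′ a) , (λ b → ψ b * ψ′ b) , (λ a → In01-* (φ01 a) (φ01′ a)) , (λ b → In01-* (ψ01 b) (ψ01′ b)) ,
  λ a b → trans (cong₂ _*_ (e a b) (e′ a b)) (interchange (φ a) (ψ b) (φ′ a) (ψ′ b))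

Split-1 : ∀ {h} (u v : Fin h) → Split {X} u v (λ _ → 1ℚ)
Split-1 u v x = (λ _ → 1ℚ) , (λ _ → 1ℚ) , (λ _ → In01-1) , (λ _ → In01-1) , λ a b → refl

infix 4 _≺_
_≺_ : ∀ {h} → Fin h → Fin h → Set
u ≺ v = toℕ u ℕ.< toℕ v

≺⇒≢ : ∀ {h} {u v : Fin h} → u ≺ v → u ≢ v
≺⇒≢ p refl = ℕ.<-irrefl refl p

-- Two increasingly ordered pairs that differ cannot have the same endpoints, so the edge (s , t)
-- misses u or v and its factor depends on at most one of the two values. This is where simplicity
-- of H enters.
Split-edge : ∀ {h} {u v s t : Fin h} (k : X → X → ℚ) → (∀ a b → In01 (k a b)) →
  u ≺ v → s ≺ t → (u , v) ≢ (s , t) → Split u v (λ x → k (x s) (x t))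
Split-edge {h = h} {u = u} {v} {s} {t} k k01 u≺v s≺t ≢e x with s Fin.≟ u | s Fin.≟ v | t Fin.≟ u | t Fin.≟ v
... | yes refl | _ | _ | yes refl = ⊥-elim (≢e refl)
... | yes refl | _ | _ | no t≢v = (λ a → k a (x t)) , (λ _ → 1ℚ) , (λ a → k01 a _) , (λ _ → In01-1) ,
  λ a b → trans (cong₂ k (trans (upd-other v b (upd u a x) (≺⇒≢ u≺v)) (upd-same u a x))
                         (trans (upd-other v b (upd u a x) t≢v) (upd-other u a x (≢-sym (≺⇒≢ s≺t)))))
                (sym (*-identityʳ _))
... | no s≢u | yes refl | _ | _ = (λ _ → 1ℚ) , (λ b → k b (x t)) , (λ _ → In01-1) , (λ b → k01 b _) ,
  λ a b → trans (cong₂ k (upd-same v b (upd u a x))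
                         (trans (upd-other v b (upd u a x) (≢-sym (≺⇒≢ s≺t))) (upd-other u a x (≢-sym (≺⇒≢ (ℕ.<-trans u≺v s≺t))))))
                (sym (*-identityˡ _))
... | no s≢u | no s≢v | yes refl | _ = (λ a → k (x s) a) , (λ _ → 1ℚ) , (λ a → k01 _ a) , (λ _ → In01-1) ,
  λ a b → trans (cong₂ k (trans (upd-other v b (upd u a x) s≢v) (upd-other u a x s≢u))
                         (trans (upd-other v b (upd u a x) (≺⇒≢ u≺v)) (upd-same u a x)))
                (sym (*-identityʳ _))
... | no s≢u | no s≢v | no t≢u | yes refl = (λ _ → 1ℚ) , (λ b → k (x s) b) , (λ _ → In01-1) , (λ b → k01 _ b) ,
  λ a b → trans (cong₂ k (trans (upd-other v b (upd u a x) s≢v) (upd-other u a x s≢u)) (upd-same v b (upd u a x)))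
                (sym (*-identityˡ _))
... | no s≢u | no s≢v | no t≢u | no t≢v = (λ _ → k (x s) (x t)) , (λ _ → 1ℚ) , (λ _ → k01 _ _) , (λ _ → In01-1) ,
  λ a b → trans (cong₂ k (trans (upd-other v b (upd u a x) s≢v) (upd-other u a x s≢u))
                         (trans (upd-other v b (upd u a x) t≢v) (upd-other u a x t≢u)))
                (sym (*-identityʳ _))

-- `disc` is a one-sided cut-norm bound, with [0,1]-valued test functions in place of sets; it gives
-- the corresponding upper bound on `hom es k`.
module Counting {X : Set} (l : List X) (ne : NonEmpty l) (k k′ : X → X → ℚ)
  (k01 : ∀ a b → In01 (k a b)) (k′01 : ∀ a b → In01 (k′ a b)) (δ : ℚ)
  (disc : ∀ (φ ψ : X → ℚ) → (∀ a → In01 (φ a)) → (∀ b → In01 (ψ b)) →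
    mean l (λ a → mean l λ b → (k a b - k′ a b) * (φ a * ψ b)) ≤ δ) where

  𝔼 : ∀ {h} → ((Fin h → X) → ℚ) → ℚ
  𝔼 {h} = E h (λ _ → l)

  swap-edge : ∀ {h} {u v : Fin h} → u ≺ v → (R : (Fin h → X) → ℚ) → Extensional R → Split u v R →
    𝔼 (λ x → (k (x u) (x v) - k′ (x u) (x v)) * R x) ≤ δ
  swap-edge {h} {u} {v} u≺v R ext split = ≤-trans
    (≤-reflexive (E-resample₂ (λ _ → l) (λ _ → ne) u v _ λ f g e →
      cong₂ _*_ (cong₂ (λ a b → k a b - k′ a b) (e u) (e v)) (ext f g e)))
    (subst (𝔼 G ≤_) (E-const h (λ _ → l) (λ _ → ne) δ) (E-mono h (λ _ → l) bound))
    where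
    G : (Fin h → X) → ℚ
    G x = mean l λ a → mean l λ b → let y = upd v b (upd u a x) in (k (y u) (y v) - k′ (y u) (y v)) * R y
    bound : ∀ x → G x ≤ δ
    bound x with split x
    ... | φ , ψ , φ01 , ψ01 , e = ≤-trans
      (≤-reflexive (mean-cong l λ a → mean-cong l λ b →
        cong₂ _*_ (cong₂ (λ a b → k a b - k′ a b) (trans (upd-other v b (upd u a x) (≺⇒≢ u≺v)) (upd-same u a x))
                                                  (upd-same v b (upd u a x))) (e a b)))
      (disc φ ψ φ01 ψ01)

  -- Edges are switched from k to k′ one at a time. R collects the factors already switched, which
  -- is why it has to split at every remaining edge.
  telescope : ∀ {h} (es : List (Fin h × Fin h)) → (∀ e → e ∈ es → proj₁ e ≺ proj₂ e) → Unique es →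
    ∀ R → Extensional R → (∀ e → e ∈ es → Split (proj₁ e) (proj₂ e) R) →
    𝔼 (λ x → R x * hom es k x) ≤ 𝔼 (λ x → R x * hom es k′ x) + ℕ→ℚ (length es) * δ
  telescope {h} []             ord un R ext split = ≤-reflexive
    (sym (trans (cong (𝔼 {h} (λ x → R x * 1ℚ) +_) (*-zeroˡ δ)) (+-identityʳ _)))
  telescope {h} (e₀@(u , v) ∷ es) ord (apart ∷ un) R ext split = begin
    𝔼 (λ x → R x * (K x * H x))
      ≡⟨ E-cong h ls (λ x → expand (R x) (K x) (K′ x) (H x)) ⟩
    𝔼 (λ x → R′ x * H x + (K x - K′ x) * (R x * H x))
      ≡⟨ E-+ h ls (λ x → R′ x * H x) (λ x → (K x - K′ x) * (R x * H x)) ⟩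
    𝔼 (λ x → R′ x * H x) + 𝔼 (λ x → (K x - K′ x) * (R x * H x))
      ≤⟨ +-mono-≤ (telescope es (λ e → ord e ∘ there) un R′ ext′ split′) (swap-edge u≺v (λ x → R x * H x)
           (λ f g e → cong₂ _*_ (ext f g e) (hom-ext es k f g e))
           (Split-* {u = u} {v} {R = R} {S = H} (split e₀ (here refl)) (split-hom es (λ e e∈ → ord e (there e∈)) apart))) ⟩
    𝔼 (λ x → R′ x * H′ x) + ℕ→ℚ (length es) * δ + δ
      ≡⟨ cong₂ (λ y z → y + ℕ→ℚ (length es) * δ + z) (E-cong h ls λ x → *-assoc (R x) (K′ x) (H′ x)) refl ⟩
    𝔼 (λ x → R x * (K′ x * H′ x)) + ℕ→ℚ (length es) * δ + δ
      ≡⟨ lem (𝔼 (λ x → R x * (K′ x * H′ x))) (ℕ→ℚ (length es)) δ ⟩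
    𝔼 (λ x → R x * (K′ x * H′ x)) + (1ℚ + ℕ→ℚ (length es)) * δ
      ≡⟨ cong (λ z → 𝔼 (λ x → R x * (K′ x * H′ x)) + z * δ) (ℕ→ℚ-suc (length es)) ⟨
    𝔼 (λ x → R x * (K′ x * H′ x)) + ℕ→ℚ (suc (length es)) * δ ∎
    where
    open ≤-Reasoning
    ls : Fin h → List X
    ls _ = l
    u≺v : u ≺ v
    u≺v = ord e₀ (here refl)
    K K′ H H′ R′ : (Fin h → X) → ℚ
    K x = k (x u) (x v)
    K′ x = k′ (x u) (x v)
    H = hom es k
    H′ = hom es k′
    R′ x = R x * K′ x
    ext′ : Extensional R′
    ext′ f g e = cong₂ _*_ (ext f g e) (cong₂ k′ (e u) (e v))
    expand : ∀ r k k′ h → r * (k * h) ≡ r * k′ * h + (k - k′) * (r * h)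
    expand = solve-∀ ℚ-ring
    lem : ∀ a n d → a + n * d + d ≡ a + (1ℚ + n) * d
    lem = solve-∀ ℚ-ring
    split-hom : ∀ es → (∀ e → e ∈ es → proj₁ e ≺ proj₂ e) → All (e₀ ≢_) es → Split u v (hom es k)
    split-hom []       o []       = Split-1 u v
    split-hom (e ∷ es) o (p ∷ ps) = Split-* {u = u} {v} {R = λ x → k (x (proj₁ e)) (x (proj₂ e))} {S = hom es k}
      (Split-edge k k01 u≺v (o e (here refl)) p) (split-hom es (λ e e∈ → o e (there e∈)) ps)
    split′ : ∀ e → e ∈ es → Split (proj₁ e) (proj₂ e) R′
    split′ e e∈ = Split-* {u = proj₁ e} {proj₂ e} {R = R} {S = K′} (split e (there e∈))
      (Split-edge k′ k′01 (ord e (there e∈)) u≺v (λ q → All.lookup apart e∈ (sym q)))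

  counting : ∀ {h} (es : List (Fin h × Fin h)) → (∀ e → e ∈ es → proj₁ e ≺ proj₂ e) → Unique es →
    𝔼 (hom es k) ≤ 𝔼 (hom es k′) + ℕ→ℚ (length es) * δ
  counting {h} es ord un = subst₂ (λ a b → a ≤ b + ℕ→ℚ (length es) * δ)
    (E-cong h (λ _ → l) λ x → *-identityˡ _) (E-cong h (λ _ → l) λ x → *-identityˡ _)
    (telescope es ord un (λ _ → 1ℚ) (λ _ _ _ → refl) λ e _ → Split-1 (proj₁ e) (proj₂ e))

-- Cauchy–Schwarz in the row variable leaves only correlations of columns of D.
module _ {X : Set} (l : List X) (D same : X → X → ℚ)
  (same-nonneg : ∀ b b′ → 0ℚ ≤ same b b′)
  (corr : ∀ b b′ → mean l (λ a → D a b * D a b′) ≤ same b b′) where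

  discrepancy² : ∀ (φ ψ : X → ℚ) → (∀ a → In01 (φ a)) → (∀ b → In01 (ψ b)) →
    let S = mean l (λ a → mean l λ b → D a b * (φ a * ψ b)) in
    S * S ≤ mean l (λ b → mean l (same b))
  discrepancy² φ ψ φ01 ψ01 = begin
    S * S
      ≡⟨ cong (λ z → z * z) (mean-cong l λ a → trans (mean-cong l λ b → lem₁ (D a b) (φ a) (ψ b)) (mean-*ˡ l (φ a) _)) ⟩
    mean l (λ a → φ a * g a) * mean l (λ a → φ a * g a)
      ≤⟨ jensen l (λ a → φ a * g a) ⟩
    mean l (λ a → φ a * g a * (φ a * g a))
      ≤⟨ mean-mono l (λ a → φ²≤1 (φ01 a)) ⟩
    mean l (λ a → g a * g a)
      ≡⟨ mean-cong l (λ a → mean-×-mean l l (λ b → D a b * ψ b) (λ b → D a b * ψ b)) ⟨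
    mean l (λ a → mean l λ b → mean l λ b′ → D a b * ψ b * (D a b′ * ψ b′))
      ≡⟨ trans (mean-swap l l _) (mean-cong l λ b → mean-swap l l _) ⟩
    mean l (λ b → mean l λ b′ → mean l λ a → D a b * ψ b * (D a b′ * ψ b′))
      ≡⟨ mean-cong l (λ b → mean-cong l λ b′ → trans (mean-cong l λ a → lem₂ (D a b) (ψ b) (D a b′) (ψ b′)) (mean-*ˡ l (ψ b * ψ b′) _)) ⟩
    mean l (λ b → mean l λ b′ → ψ b * ψ b′ * mean l (λ a → D a b * D a b′))
      ≤⟨ mean-mono l (λ b → mean-mono l λ b′ → ≤-trans (*-monoˡ (proj₁ (In01-* (ψ01 b) (ψ01 b′))) (corr b b′))
           (subst (ψ b * ψ b′ * same b b′ ≤_) (*-identityˡ (same b b′)) (*-monoʳ (same-nonneg b b′) (proj₂ (In01-* (ψ01 b) (ψ01 b′)))))) ⟩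
    mean l (λ b → mean l (same b)) ∎
    where
    open ≤-Reasoning
    S : ℚ
    S = mean l (λ a → mean l λ b → D a b * (φ a * ψ b))
    g : X → ℚ
    g a = mean l λ b → D a b * ψ b
    lem₁ : ∀ d p q → d * (p * q) ≡ p * (d * q)
    lem₁ = solve-∀ ℚ-ring
    lem₂ : ∀ d p d′ p′ → d * p * (d′ * p′) ≡ p * p′ * (d * d′)
    lem₂ = solve-∀ ℚ-ring
    lem₃ : ∀ p g → p * g * (p * g) ≡ p * p * (g * g)
    lem₃ = solve-∀ ℚ-ring
    φ²≤1 : ∀ {p g} → In01 p → p * g * (p * g) ≤ g * g
    φ²≤1 {p} {g} p01 = subst₂ _≤_ (sym (lem₃ p g)) (*-identityˡ (g * g)) (*-monoʳ (sq-nonneg g) (proj₂ (In01-* p01 p01)))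

-- Uniform labels modulo q; averages over products and over all maps.

[_] : Bool → ℚ
[ true ]  = 1ℚ
[ false ] = 0ℚ

[]-01 : ∀ b → In01 [ b ]
[]-01 true  = In01-1
[]-01 false = In01-0

[∧] : ∀ a b → [ a ∧ b ] ≡ [ a ] * [ b ]
[∧] true  b = sym (*-identityˡ [ b ])
[∧] false b = sym (*-zeroˡ [ b ])

∑ᶠ : ℕ → (ℕ → ℚ) → ℚ
∑ᶠ m h = ∑ (allFin m) (h ∘ toℕ)

∑ᶠ-suc : ∀ m h → ∑ᶠ (suc m) h ≡ h 0 + ∑ᶠ m (h ∘ ℕ.suc)
∑ᶠ-suc m h = ∑-Fin-suc {m} (h ∘ toℕ)

∑ᶠ-shift : ∀ m h → ∑ᶠ m (h ∘ ℕ.suc) + h 0 ≡ ∑ᶠ m h + h m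
∑ᶠ-shift zero    h = refl
∑ᶠ-shift (suc m) h = begin
  ∑ᶠ (suc m) (h ∘ ℕ.suc) + h 0                  ≡⟨ cong (_+ h 0) (∑ᶠ-suc m (h ∘ ℕ.suc)) ⟩
  h 1 + ∑ᶠ m (h ∘ ℕ.suc ∘ ℕ.suc) + h 0            ≡⟨ cong (_+ h 0) (trans (+-comm (h 1) _) (∑ᶠ-shift m (h ∘ ℕ.suc))) ⟩
  ∑ᶠ m (h ∘ ℕ.suc) + h (suc m) + h 0            ≡⟨ lem (∑ᶠ m (h ∘ ℕ.suc)) (h (suc m)) (h 0) ⟩
  h 0 + ∑ᶠ m (h ∘ ℕ.suc) + h (suc m)            ≡⟨ cong (_+ h (suc m)) (∑ᶠ-suc m h) ⟨
  ∑ᶠ (suc m) h + h (suc m)                    ∎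
  where
  open ≡-Reasoning
  lem : ∀ a b c → a + b + c ≡ c + a + b
  lem = solve-∀ ℚ-ring

+-cancelʳ : ∀ {a b} c → a + c ≡ b + c → a ≡ b
+-cancelʳ {a} {b} c e = trans (lem a c) (trans (cong (_- c) e) (sym (lem b c)))
  where
  lem : ∀ a c → a ≡ a + c - c
  lem = solve-∀ ℚ-ring

-- Raising b by one drops the term at 0 and gains the term at q, and these agree modulo q.
∑ᶠ-rotate : ∀ q .{{_ : ℕ.NonZero q}} (g : ℕ → ℚ) b →
  ∑ᶠ q (λ a → g ((a ℕ.+ b) ℕ.% q)) ≡ ∑ᶠ q g
∑ᶠ-rotate q g zero    = ∑-cong (allFin q) λ a →
  cong g (trans (cong (ℕ._% q) (ℕ.+-identityʳ (toℕ a))) (ℕ.m<n⇒m%n≡m (Fin.toℕ<n a)))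
∑ᶠ-rotate q g (suc b) = begin
  ∑ᶠ q (λ a → g ((a ℕ.+ suc b) ℕ.% q))  ≡⟨ ∑-cong (allFin q) (λ a → cong (λ z → g (z ℕ.% q)) (ℕ.+-suc (toℕ a) b)) ⟩
  ∑ᶠ q (H ∘ ℕ.suc)                        ≡⟨ +-cancelʳ (H 0) (trans (∑ᶠ-shift q H) (cong (∑ᶠ q H +_) wrap)) ⟩
  ∑ᶠ q H                                ≡⟨ ∑ᶠ-rotate q g b ⟩
  ∑ᶠ q g                                ∎
  where
  open ≡-Reasoning
  H : ℕ → ℚ
  H a = g ((a ℕ.+ b) ℕ.% q)
  wrap : H q ≡ H 0
  wrap = cong g (trans (cong (ℕ._% q) (ℕ.+-comm q b)) (ℕ.[m+n]%n≡m%n b q))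

∑ᶠ-threshold : ∀ q c → c ℕ.≤ q → ∑ᶠ q (λ a → [ a ℕ.<ᵇ c ]) ≡ ℕ→ℚ c
∑ᶠ-threshold q       zero    _         = ∑-0 (allFin q)
∑ᶠ-threshold (suc q) (suc c) (s≤s c≤q) = begin
  ∑ᶠ (suc q) (λ a → [ a ℕ.<ᵇ suc c ])    ≡⟨ ∑ᶠ-suc q (λ a → [ a ℕ.<ᵇ suc c ]) ⟩
  1ℚ + ∑ᶠ q (λ a → [ a ℕ.<ᵇ c ])         ≡⟨ cong (1ℚ +_) (∑ᶠ-threshold q c c≤q) ⟩
  1ℚ + ℕ→ℚ c                             ≡⟨ ℕ→ℚ-suc c ⟨
  ℕ→ℚ (suc c)                            ∎
  where open ≡-Reasoning

length-allFin : ∀ m → length (allFin m) ≡ m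
length-allFin m = List.length-tabulate {n = m} (λ i → i)

allFin-nonEmpty : ∀ {m} → 0 ℕ.< m → NonEmpty (allFin m)
allFin-nonEmpty {suc m} _ = nonEmpty

-- A uniform label shifted by a fixed b is again uniform modulo q. The probability is exactly c / q,
-- without error term, and this gives exact orthogonality of columns below.
mean-threshold : ∀ q .{{_ : ℕ.NonZero q}} c b → c ℕ.≤ q →
  mean (allFin q) (λ a → [ ((toℕ a ℕ.+ b) ℕ.% q) ℕ.<ᵇ c ]) ≡ inv (ℕ→ℚ q) * ℕ→ℚ c
mean-threshold q c b c≤q = trans (mean-def (allFin q) (λ a → [ ((toℕ a ℕ.+ b) ℕ.% q) ℕ.<ᵇ c ])) (cong₂ (λ n s → inv (ℕ→ℚ n) * s) (length-allFin q)
  (trans (∑ᶠ-rotate q (λ a → [ a ℕ.<ᵇ c ]) b) (∑ᶠ-threshold q c c≤q)))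

pairs : List A → List B → List (A × B)
pairs l m = concatMap (λ a → map (a ,_) m) l

length-pairs : ∀ (l : List A) (m : List B) → length (pairs l m) ≡ length l ℕ.* length m
length-pairs []      m = refl
length-pairs (x ∷ l) m = trans (List.length-++ (map (x ,_) m)) (cong₂ ℕ._+_ (List.length-map (x ,_) m) (length-pairs l m))

pairs-nonEmpty : ∀ {l : List A} {m : List B} → NonEmpty l → NonEmpty m → NonEmpty (pairs l m)
pairs-nonEmpty nonEmpty nonEmpty = nonEmpty

∑-pairs : ∀ (l : List A) (m : List B) F → ∑ (pairs l m) F ≡ ∑ l (λ a → ∑ m (λ b → F (a , b)))
∑-pairs l m F = trans (∑-concatMap (λ a → map (a ,_) m) l F) (∑-cong l λ a → ∑-map (a ,_) m F)

∑∑-mean : ∀ {l : List A} {m : List B} → NonEmpty l → NonEmpty m → ∀ (F : A → B → ℚ) →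
  inv (ℕ→ℚ (length l ℕ.* length m)) * ∑ l (λ a → ∑ m (F a)) ≡ mean l (λ a → mean m (F a))
∑∑-mean {l = l} {m} nl nm F = begin
  inv (ℕ→ℚ (length l ℕ.* length m)) * S   ≡⟨ cong (_* S) (trans (cong inv (ℕ→ℚ-* (length l) (length m))) (inv-* (length-pos nl) (length-pos nm))) ⟩
  i * j * S                               ≡⟨ *-assoc i j S ⟩
  i * (j * S)                             ≡⟨ cong (i *_) (∑-*ˡ l j (λ a → ∑ m (F a))) ⟨
  i * ∑ l (λ a → j * ∑ m (F a))           ≡⟨ mean-def l (λ a → j * ∑ m (F a)) ⟨
  mean l (λ a → j * ∑ m (F a))            ≡⟨ mean-cong l (λ a → mean-def m (F a)) ⟨
  mean l (λ a → mean m (F a))             ∎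
  where
  open ≡-Reasoning
  S i j : ℚ
  S = ∑ l (λ a → ∑ m (F a))
  i = inv (ℕ→ℚ (length l))
  j = inv (ℕ→ℚ (length m))

mean-pairs : ∀ {l : List A} {m : List B} → NonEmpty l → NonEmpty m → ∀ F →
  mean (pairs l m) F ≡ mean l (λ a → mean m (λ b → F (a , b)))
mean-pairs {l = l} {m} nl nm F = trans (mean-def (pairs l m) F)
  (trans (cong₂ (λ n s → inv (ℕ→ℚ n) * s) (length-pairs l m) (∑-pairs l m F)) (∑∑-mean nl nm (λ a b → F (a , b))))

mean-Fin-1 : ∀ {m} (F : Fin m → ℚ) → mean (allFin m) F ≡ inv (ℕ→ℚ m) * ∑ (allFin m) F
mean-Fin-1 {m} F = trans (mean-def (allFin m) F) (cong (λ k → inv (ℕ→ℚ k) * ∑ (allFin m) F) (length-allFin m))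

length-allMaps : ∀ h m → length (allMaps h m) ≡ m ℕ.^ h
length-allMaps zero    m = refl
length-allMaps (suc h) m = trans (len (allMaps h m)) (trans (cong (ℕ._* m) (length-allMaps h m)) (ℕ.*-comm (m ℕ.^ h) m))
  where
  len : ∀ (l : List (Fin h → Fin m)) → length (concatMap (λ f → map (λ x → cons x f) (allFin m)) l) ≡ length l ℕ.* m
  len []      = refl
  len (f ∷ l) = trans (List.length-++ (map (λ x → cons x f) (allFin m)))
    (cong₂ ℕ._+_ (trans (List.length-map (λ x → cons x f) (allFin m)) (length-allFin m)) (len l))

^-pos : ∀ {m} h → 0 ℕ.< m → 0 ℕ.< m ℕ.^ h
^-pos {suc m} h _ = ℕ.m^n>0 (suc m) h

∑-allMaps : ∀ h m → 0 ℕ.< m → ∀ F → Extensional F →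
  inv (ℕ→ℚ (m ℕ.^ h)) * ∑ (allMaps h m) F ≡ E h (λ _ → allFin m) F
∑-allMaps zero    m 0<m F ext = trans (cong₂ _*_ (sym (inv-unique {1ℚ} {1ℚ} (positive⁻¹ 1ℚ) refl)) (+-identityʳ (F (λ ())))) (trans (*-identityˡ _) (ext _ _ λ ()))
∑-allMaps (suc h) m 0<m F ext = begin
  inv (ℕ→ℚ (m ℕ.* m ℕ.^ h)) * ∑ (allMaps (suc h) m) F
    ≡⟨ cong₂ _*_ (trans (cong inv (ℕ→ℚ-* m (m ℕ.^ h))) (inv-* (ℕ→ℚ-pos 0<m) (ℕ→ℚ-pos (^-pos h 0<m))))
        (trans (∑-concatMap (λ f → map (λ x → cons x f) (allFin m)) (allMaps h m) F)
          (trans (∑-cong (allMaps h m) λ f → ∑-map (λ x → cons x f) (allFin m) F)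
            (∑-swap (allMaps h m) (allFin m) λ f x → F (cons x f)))) ⟩
  i * j * ∑ (allFin m) (λ x → ∑ (allMaps h m) (λ f → F (cons x f)))
    ≡⟨ *-assoc i j _ ⟩
  i * (j * ∑ (allFin m) (λ x → ∑ (allMaps h m) (λ f → F (cons x f))))
    ≡⟨ cong (i *_) (∑-*ˡ (allFin m) j _) ⟨
  i * ∑ (allFin m) (λ x → j * ∑ (allMaps h m) (λ f → F (cons x f)))
    ≡⟨ mean-Fin-1 (λ x → j * ∑ (allMaps h m) (λ f → F (cons x f))) ⟨
  mean (allFin m) (λ x → j * ∑ (allMaps h m) (λ f → F (cons x f)))
    ≡⟨ mean-cong (allFin m) (λ x → cong (j *_) (∑-cong (allMaps h m) λ f → ext _ _ λ { zero → refl ; (suc i) → refl })) ⟩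
  mean (allFin m) (λ x → j * ∑ (allMaps h m) (λ f → F (x ◂ f)))
    ≡⟨ mean-cong (allFin m) (λ x → ∑-allMaps h m 0<m (λ f → F (x ◂ f)) (◂-ext ext x)) ⟩
  mean (allFin m) (λ x → E h (λ _ → allFin m) (λ f → F (x ◂ f))) ∎
  where
  open ≡-Reasoning
  i j : ℚ
  i = inv (ℕ→ℚ m)
  j = inv (ℕ→ℚ (m ℕ.^ h))

mean-allMaps : ∀ h m → 0 ℕ.< m → ∀ F → Extensional F → mean (allMaps h m) F ≡ E h (λ _ → allFin m) F
mean-allMaps h m 0<m F ext = trans (mean-def (allMaps h m) F)
  (trans (cong (λ k → inv (ℕ→ℚ k) * ∑ (allMaps h m) F) (length-allMaps h m)) (∑-allMaps h m 0<m F ext))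

pos⇒nonEmpty : ∀ {l : List A} → 0 ℕ.< length l → NonEmpty l
pos⇒nonEmpty {l = x ∷ l} _ = nonEmpty

allMaps-nonEmpty : ∀ h {m} → 0 ℕ.< m → NonEmpty (allMaps h m)
allMaps-nonEmpty h {m} 0<m = pos⇒nonEmpty (subst (0 ℕ.<_) (sym (length-allMaps h m)) (^-pos h 0<m))

∑-δ : ∀ {m} (i : Fin m) (F : Fin m → ℚ) → ∑ (allFin m) (λ j → [ does (i Fin.≟ j) ] * F j) ≡ F i
∑-δ {suc m} zero F = begin
  ∑ (allFin (suc m)) (λ j → [ does (zero Fin.≟ j) ] * F j)
    ≡⟨ ∑-Fin-suc (λ j → [ does (zero Fin.≟ j) ] * F j) ⟩
  1ℚ * F zero + ∑ (allFin m) (λ j → 0ℚ * F (suc j))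
    ≡⟨ cong₂ _+_ (*-identityˡ (F zero)) (trans (∑-cong (allFin m) λ j → *-zeroˡ (F (suc j))) (∑-0 (allFin m))) ⟩
  F zero + 0ℚ ≡⟨ +-identityʳ (F zero) ⟩
  F zero ∎
  where open ≡-Reasoning
∑-δ {suc m} (suc i) F = begin
  ∑ (allFin (suc m)) (λ j → [ does (suc i Fin.≟ j) ] * F j)
    ≡⟨ ∑-Fin-suc (λ j → [ does (suc i Fin.≟ j) ] * F j) ⟩
  0ℚ * F zero + ∑ (allFin m) (λ j → [ does (suc i Fin.≟ suc j) ] * F (suc j))
    ≡⟨ cong₂ _+_ (*-zeroˡ (F zero)) (∑-δ i (F ∘ suc)) ⟩
  0ℚ + F (suc i) ≡⟨ +-identityˡ (F (suc i)) ⟩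
  F (suc i) ∎
  where open ≡-Reasoning

-- Homomorphism densities as averages

-- allB recurses through a local function; unification in allB≡foldr-allFin supplies its name.
private
  allB≡foldr : ∀ {m} (p : Fin m → Bool) (l : List (Fin m)) → _ ≡ List.foldr (λ x b → p x ∧ b) true l

allB≡foldr-allFin : ∀ {m} (p : Fin m → Bool) → allB p ≡ List.foldr (λ x b → p x ∧ b) true (allFin m)
allB≡foldr-allFin {m} p with allFin m
... | l = allB≡foldr p l

allB≡foldr p []      = refl
allB≡foldr p (x ∷ l) = cong (p x ∧_) (allB≡foldr p l)

∧-true : ∀ {a b} → a ∧ b ≡ true → a ≡ true × b ≡ true
∧-true {true} {true} _ = refl , refl

allB-elim : ∀ {m} (p : Fin m → Bool) → allB p ≡ true → ∀ x → p x ≡ true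
allB-elim {m} p e x = go (allFin m) (trans (sym (allB≡foldr-allFin p)) e) (∈-allFin x)
  where
  go : ∀ l → List.foldr (λ x b → p x ∧ b) true l ≡ true → x ∈ l → p x ≡ true
  go (y ∷ l) e (here refl) = proj₁ (∧-true e)
  go (y ∷ l) e (there x∈)  = go l (proj₂ (∧-true {p y} e)) x∈

allB-intro : ∀ {m} (p : Fin m → Bool) → (∀ x → p x ≡ true) → allB p ≡ true
allB-intro {m} p e = trans (allB≡foldr-allFin p) (go (allFin m))
  where
  go : ∀ l → List.foldr (λ x b → p x ∧ b) true l ≡ true
  go []      = refl
  go (y ∷ l) rewrite e y = go l

allB-cong : ∀ {m} {p q : Fin m → Bool} → (∀ x → p x ≡ q x) → allB p ≡ allB q
allB-cong {m} {p} {q} e = trans (allB≡foldr-allFin p)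
  (trans (List.foldr-cong (λ x b → cong (_∧ b) (e x)) refl (allFin m)) (sym (allB≡foldr-allFin q)))

isHom-elim : ∀ H G f → isHom H G f ≡ true → ∀ u v → adj H u v ≡ true → adj G (f u) (f v) ≡ true
isHom-elim H G f e u v uv = go (adj H u v) uv (allB-elim _ (allB-elim _ e u) v)
  where
  go : ∀ b {c} → b ≡ true → not b ∨ c ≡ true → c ≡ true
  go true _ e = e

isHom-intro : ∀ H G f → (∀ u v → adj H u v ≡ true → adj G (f u) (f v) ≡ true) → isHom H G f ≡ true
isHom-intro H G f p = allB-intro _ λ u → allB-intro _ λ v → go (adj H u v) (p u v)
  where
  go : ∀ b {c} → (b ≡ true → c ≡ true) → not b ∨ c ≡ true
  go true  q = q refl
  go false q = refl

isHom-ext : ∀ H G → Extensional (λ f → [ isHom H G f ])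
isHom-ext H G f g e = cong [_] (allB-cong λ u → allB-cong λ v → cong (not (adj H u v) ∨_) (cong₂ (adj G) (e u) (e v)))

countB-∑ : ∀ (p : A → Bool) l → ℕ→ℚ (countB p l) ≡ ∑ l ([_] ∘ p)
countB-∑ p []      = refl
countB-∑ p (x ∷ l) with p x
... | true  = trans (ℕ→ℚ-suc (countB p l)) (cong (1ℚ +_) (countB-∑ p l))
... | false = trans (countB-∑ p l) (sym (+-identityˡ _))

density-def : ∀ c m h → 0 ℕ.< m → density c m h ≡ inv (ℕ→ℚ (m ℕ.^ h)) * ℕ→ℚ c
density-def c (suc m) h _ = /-as-inv c (suc m ℕ.^ h) {{ℕ.m^n≢0 (suc m) h}}

t-as-E : ∀ H G → 0 ℕ.< n G → t H G ≡ E (n H) (λ _ → allFin (n G)) (λ f → [ isHom H G f ])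
t-as-E H G pos = trans (density-def (homCount H G) (n G) (n H) pos)
  (trans (cong (inv (ℕ→ℚ (n G ℕ.^ n H)) *_) (countB-∑ (isHom H G) (allMaps (n H) (n G))))
    (∑-allMaps (n H) (n G) pos (λ f → [ isHom H G f ]) (isHom-ext H G)))

adjℚ : (G : Graph) → Fin (n G) → Fin (n G) → ℚ
adjℚ G a b = [ adj G a b ]

T⇒≡ : ∀ {b} → T b → b ≡ true
T⇒≡ {true} _ = refl

≡⇒T : ∀ {b} → b ≡ true → T b
≡⇒T refl = _

∈-edgeList⁻ : ∀ H {p} → p ∈ edgeList H → (proj₁ p ≺ proj₂ p) × adj H (proj₁ p) (proj₂ p) ≡ true
∈-edgeList⁻ H {p} p∈ with ∧-true {toℕ (proj₁ p) ℕ.<ᵇ toℕ (proj₂ p)} (T⇒≡ (proj₂ (∈-filter⁻ (λ q → T? _) {xs = allPairs (n H)} p∈)))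
... | lt , a = ℕ.<ᵇ⇒< _ _ (≡⇒T lt) , a

allPairs≡cartesianProduct : ∀ m → allPairs m ≡ List.cartesianProduct (allFin m) (allFin m)
allPairs≡cartesianProduct m = go (allFin m)
  where
  go : ∀ l → concatMap (λ u → map (u ,_) (allFin m)) l ≡ List.cartesianProduct l (allFin m)
  go []      = refl
  go (u ∷ l) = cong (map (u ,_) (allFin m) ++_) (go l)

∈-allPairs : ∀ {m} (p : Fin m × Fin m) → p ∈ allPairs m
∈-allPairs {m} (u , v) = subst ((u , v) ∈_) (sym (allPairs≡cartesianProduct m)) (∈-cartesianProduct⁺ (∈-allFin u) (∈-allFin v))

∈-edgeList⁺ : ∀ H {u v} → u ≺ v → adj H u v ≡ true → (u , v) ∈ edgeList H
∈-edgeList⁺ H {u} {v} lt a = ∈-filter⁺ (λ q → T? _) (∈-allPairs (u , v)) (≡⇒T (cong₂ _∧_ (T⇒≡ (ℕ.<⇒<ᵇ lt)) a))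

edgeList-unique : ∀ H → Unique (edgeList H)
edgeList-unique H = Unique.filter⁺ (λ q → T? _)
  (subst Unique (sym (allPairs≡cartesianProduct (n H))) (Unique.cartesianProduct⁺ (Unique.allFin⁺ (n H)) (Unique.allFin⁺ (n H))))

t≤hom : ∀ H G → 0 ℕ.< n G → t H G ≤ E (n H) (λ _ → allFin (n G)) (hom (edgeList H) (adjℚ G))
t≤hom H G pos = subst (_≤ E (n H) (λ _ → allFin (n G)) (hom (edgeList H) (adjℚ G))) (sym (t-as-E H G pos))
  (E-mono (n H) (λ _ → allFin (n G)) λ f → le f (isHom H G f) refl)
  where
  le : ∀ f b → isHom H G f ≡ b → [ b ] ≤ hom (edgeList H) (adjℚ G) f
  le f false _ = ∏-nonneg (edgeList H) λ p → proj₁ ([]-01 (adj G (f (proj₁ p)) (f (proj₂ p))))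
  le f true  e = ≤-reflexive (sym (trans
    (∏-cong∈ (edgeList H) λ p p∈ → cong [_] (isHom-elim H G f e (proj₁ p) (proj₂ p) (proj₂ (∈-edgeList⁻ H p∈))))
    (∏-1 (edgeList H))))

-- Local density in terms of averages

ℕ→ℚ-∣∣ : ∀ {m} (S : Subset m) → ℕ→ℚ ∣ S ∣ ≡ ∑ (allFin m) (λ a → [ Vec.lookup S a ])
ℕ→ℚ-∣∣ {zero}  Vec.[]            = refl
ℕ→ℚ-∣∣ {suc m} (true Vec.∷ S)  = trans (ℕ→ℚ-suc ∣ S ∣) (trans (cong (1ℚ +_) (ℕ→ℚ-∣∣ S)) (sym (∑-Fin-suc λ a → [ Vec.lookup (true Vec.∷ S) a ])))
ℕ→ℚ-∣∣ {suc m} (false Vec.∷ S) = trans (trans (ℕ→ℚ-∣∣ S) (sym (+-identityˡ _))) (sym (∑-Fin-suc λ a → [ Vec.lookup (false Vec.∷ S) a ]))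

module _ (G : Graph) (pos : 0 ℕ.< n G) where
  private
    N i : ℚ
    N = ℕ→ℚ (n G)
    i = inv N
    0<N : 0ℚ < N
    0<N = ℕ→ℚ-pos pos
    l : List (Fin (n G))
    l = allFin (n G)

    *-mean : ∀ F → N * mean l F ≡ ∑ l F
    *-mean F = trans (cong (N *_) (mean-Fin-1 F)) (trans (sym (*-assoc N i (∑ l F)))
      (trans (cong (_* ∑ l F) (*-inv 0<N)) (*-identityˡ _)))

    β : (Fin (n G) → ℚ) → ℚ
    β φ = mean l λ a → mean l λ b → φ a * φ b * adjℚ G a b

    size : ∀ S → ℕ→ℚ ∣ S ∣ ≡ N * mean l (λ a → [ Vec.lookup S a ])
    size S = trans (ℕ→ℚ-∣∣ S) (sym (*-mean _))

    edges : ∀ S → ℕ→ℚ (eOrd G S) ≡ N * N * β (λ a → [ Vec.lookup S a ])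
    edges S = begin
      ℕ→ℚ (eOrd G S)
        ≡⟨ countB-∑ _ (allPairs (n G)) ⟩
      ∑ (pairs l l) (λ p → [ χ (proj₁ p) ∧ χ (proj₂ p) ∧ adj G (proj₁ p) (proj₂ p) ])
        ≡⟨ ∑-pairs l l _ ⟩
      ∑ l (λ a → ∑ l λ b → [ χ a ∧ χ b ∧ adj G a b ])
        ≡⟨ ∑-cong l (λ a → trans (∑-cong l λ b → three (χ a) (χ b) (adj G a b)) (sym (*-mean _))) ⟩
      ∑ l (λ a → N * mean l λ b → [ χ a ] * [ χ b ] * adjℚ G a b)
        ≡⟨ ∑-*ˡ l N _ ⟩
      N * ∑ l (λ a → mean l λ b → [ χ a ] * [ χ b ] * adjℚ G a b)
        ≡⟨ cong (N *_) (*-mean _) ⟨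
      N * (N * β (λ a → [ χ a ]))
        ≡⟨ *-assoc N N _ ⟨
      N * N * β (λ a → [ χ a ]) ∎
      where
      open ≡-Reasoning
      χ : Fin (n G) → Bool
      χ = Vec.lookup S
      three : ∀ a b c → [ a ∧ b ∧ c ] ≡ [ a ] * [ b ] * [ c ]
      three a b c = trans ([∧] a (b ∧ c)) (trans (cong ([ a ] *_) ([∧] b c)) (sym (*-assoc [ a ] [ b ] [ c ])))

    half : ∀ k → (ℤ.+ k) / 2 ≡ ½ * ℕ→ℚ k
    half k = /-as-inv k 2

    factor : ∀ d N h α → d * h * (N * α * (N * α)) ≡ h * (N * N) * (d * (α * α))
    factor = solve-∀ ℚ-ring

    factor′ : ∀ N h β → h * (N * N * β) ≡ h * (N * N) * β
    factor′ = solve-∀ ℚ-ring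

  -- With N vertices, a set of measure α has size N * α. `edgesIn` halves the ordered count and
  -- `Dense` halves d, so both sides carry the common factor ½ * (N * N), which is cancelled.
  Dense-intro : ∀ {ρ d} → (∀ (χ : Fin (n G) → Bool) → ρ ≤ mean l ([_] ∘ χ) →
    d * (mean l ([_] ∘ χ) * mean l ([_] ∘ χ)) ≤ β ([_] ∘ χ)) → Dense ρ d G
  Dense-intro {ρ} {d} H S large = subst₂ _≤_
    (sym (trans (cong (λ z → d * ½ * (z * z)) (size S)) (factor d N ½ α)))
    (sym (trans (half (eOrd G S)) (trans (cong (½ *_) (edges S)) (factor′ N ½ (β ([_] ∘ Vec.lookup S))))))
    (*-monoˡ (*-nonneg 0≤½ (*-nonneg (<⇒≤ 0<N) (<⇒≤ 0<N)))
      (H (Vec.lookup S) (*-cancelˡ 0<N (subst₂ _≤_ (*-comm ρ N) (size S) large))))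
    where
    α : ℚ
    α = mean l ([_] ∘ Vec.lookup S)

  Dense-elim : ∀ {ρ d} → Dense ρ d G → ∀ (χ : Fin (n G) → Bool) → ρ ≤ mean l ([_] ∘ χ) →
    d * (mean l ([_] ∘ χ) * mean l ([_] ∘ χ)) ≤ β ([_] ∘ χ)
  Dense-elim {ρ} {d} D χ large = subst₂ (λ a b → d * (a * a) ≤ b)
    (mean-cong l (λ a → same a)) (mean-cong l λ a → mean-cong l λ b → cong₂ (λ x y → x * y * adjℚ G a b) (same a) (same b))
    (*-cancelˡ (*-pos 0<½ (*-pos 0<N 0<N)) (subst₂ _≤_
      (trans (cong (λ z → d * ½ * (z * z)) (size S)) (factor d N ½ α))
      (trans (half (eOrd G S)) (trans (cong (½ *_) (edges S)) (factor′ N ½ (β ([_] ∘ Vec.lookup S)))))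
      (D S (subst₂ _≤_ (*-comm N ρ) (sym (size S)) (*-monoˡ (<⇒≤ 0<N) (subst (ρ ≤_) (sym (mean-cong l same)) large))))))
    where
    S : Subset (n G)
    S = Vec.tabulate χ
    α : ℚ
    α = mean l ([_] ∘ Vec.lookup S)
    same : ∀ a → [ Vec.lookup S a ] ≡ [ χ a ]
    same a = cong [_] (Vec.lookup∘tabulate χ a)

-- Clearing denominators

fraction : ∀ {a} → 0ℚ ≤ a → Σ ℕ λ q → Σ ℕ λ c → 0 ℕ.< q × ℕ→ℚ q * a ≡ ℕ→ℚ c
fraction {a@(mkℚ (ℤ.+ c) d _)} 0≤a = suc d , c , s≤s z≤n , (begin
  ℕ→ℚ (suc d) * a                                 ≡⟨ cong (ℕ→ℚ (suc d) *_) (trans (sym (↥p/↧p≡p a)) (/-as-inv c (suc d))) ⟩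
  ℕ→ℚ (suc d) * (inv (ℕ→ℚ (suc d)) * ℕ→ℚ c)       ≡⟨ *-assoc (ℕ→ℚ (suc d)) (inv (ℕ→ℚ (suc d))) (ℕ→ℚ c) ⟨
  ℕ→ℚ (suc d) * inv (ℕ→ℚ (suc d)) * ℕ→ℚ c         ≡⟨ cong (_* ℕ→ℚ c) (*-inv (ℕ→ℚ-pos {suc d} (s≤s z≤n))) ⟩
  1ℚ * ℕ→ℚ c                                      ≡⟨ *-identityˡ (ℕ→ℚ c) ⟩
  ℕ→ℚ c                                           ∎)
  where open ≡-Reasoning
fraction {mkℚ (ℤ.-[1+ c ]) d _} (*≤* ())

ℕ→ℚ-cancel-≤ : ∀ {a b} → ℕ→ℚ a ≤ ℕ→ℚ b → a ℕ.≤ b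
ℕ→ℚ-cancel-≤ {a} {b} p with a ℕ.≤? b
... | yes q = q
... | no  q = ⊥-elim (<-irrefl refl (<-≤-trans (<-≤-trans b<1+b (ℕ→ℚ-mono (ℕ.≰⇒> q))) p))
  where
  b<1+b : ℕ→ℚ b < ℕ→ℚ (suc b)
  b<1+b = subst₂ _<_ (+-identityˡ (ℕ→ℚ b)) (sym (ℕ→ℚ-suc b)) (+-monoˡ-< (ℕ→ℚ b) (positive⁻¹ 1ℚ))

ℕ→ℚ-injective : ∀ {a b} → ℕ→ℚ a ≡ ℕ→ℚ b → a ≡ b
ℕ→ℚ-injective e = ℕ.≤-antisym (ℕ→ℚ-cancel-≤ (≤-reflexive e)) (ℕ→ℚ-cancel-≤ (≤-reflexive (sym e)))

commonMultiple : ∀ {m} (q : Fin m → ℕ) → (∀ i → 0 ℕ.< q i) → Σ ℕ λ Q → 0 ℕ.< Q × (∀ i → Σ ℕ λ k → Q ≡ k ℕ.* q i)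
commonMultiple {zero}  q pos = 1 , s≤s z≤n , λ ()
commonMultiple {suc m} q pos with commonMultiple (q ∘ suc) (pos ∘ suc)
... | Q , Q>0 , mult = Q ℕ.* q zero , ℕ.*-mono-< {0} {Q} {0} {q zero} Q>0 (pos zero) , λ where
  zero    → Q , refl
  (suc i) → proj₁ (mult i) ℕ.* q zero ,
    trans (cong (ℕ._* q zero) (proj₂ (mult i))) (trans (ℕ.*-assoc (proj₁ (mult i)) (q (suc i)) (q zero))
      (trans (cong (proj₁ (mult i) ℕ.*_) (ℕ.*-comm (q (suc i)) (q zero))) (sym (ℕ.*-assoc (proj₁ (mult i)) (q zero) (q (suc i))))))

scale-integral : ∀ {Q q a} → (Σ ℕ λ k → Q ≡ k ℕ.* q) → (Σ ℕ λ c → ℕ→ℚ q * a ≡ ℕ→ℚ c) → Σ ℕ λ c → ℕ→ℚ Q * a ≡ ℕ→ℚ c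
scale-integral {q = q} {a} (k , refl) (c , e) = k ℕ.* c , trans (cong (_* a) (ℕ→ℚ-* k q))
  (trans (*-assoc (ℕ→ℚ k) (ℕ→ℚ q) a) (trans (cong (ℕ→ℚ k *_) e) (sym (ℕ→ℚ-* k c))))

commonDenominator : ∀ {m} (f : Fin m → ℚ) → (∀ i → 0ℚ ≤ f i) →
  Σ ℕ λ Q → 0 ℕ.< Q × (∀ i → Σ ℕ λ c → ℕ→ℚ Q * f i ≡ ℕ→ℚ c)
commonDenominator f 0≤f with commonMultiple (λ i → proj₁ (fraction (0≤f i))) (λ i → proj₁ (proj₂ (proj₂ (fraction (0≤f i)))))
... | Q , Q>0 , mult = Q , Q>0 , λ i → scale-integral (mult i)
  (proj₁ (proj₂ (fraction (0≤f i))) , proj₂ (proj₂ (proj₂ (fraction (0≤f i)))))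

-- The blow-up works modulo a single q, so all entries of the kernel must become multiples of 1 / q
-- at once.
commonDenominator₂ : ∀ {m m′} (f : Fin m → Fin m′ → ℚ) → (∀ i j → 0ℚ ≤ f i j) →
  Σ ℕ λ Q → 0 ℕ.< Q × (∀ i j → Σ ℕ λ c → ℕ→ℚ Q * f i j ≡ ℕ→ℚ c)
commonDenominator₂ f 0≤f with commonMultiple (λ i → proj₁ (commonDenominator (f i) (0≤f i))) (λ i → proj₁ (proj₂ (commonDenominator (f i) (0≤f i))))
... | Q , Q>0 , mult = Q , Q>0 , λ i j → scale-integral (mult i) (proj₂ (proj₂ (commonDenominator (f i) (0≤f i))) j)

∑-replicate : ∀ k (a : A) G → ∑ (List.replicate k a) G ≡ ℕ→ℚ k * G a
∑-replicate k a G = trans (go k) (trans (∑-const (List.replicate k a) (G a)) (cong (λ j → ℕ→ℚ j * G a) (List.length-replicate k)))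
  where
  go : ∀ k → ∑ (List.replicate k a) G ≡ ∑ (List.replicate k a) (λ _ → G a)
  go zero    = refl
  go (suc k) = cong (G a +_) (go k)

∑-concat-replicate : ∀ k (l : List A) G → ∑ (List.concat (List.replicate k l)) G ≡ ℕ→ℚ k * ∑ l G
∑-concat-replicate zero    l G = sym (*-zeroˡ (∑ l G))
∑-concat-replicate (suc k) l G = trans (∑-++ l _ G) (trans (cong (∑ l G +_) (∑-concat-replicate k l G))
  (trans (lem (∑ l G) (ℕ→ℚ k)) (cong (_* ∑ l G) (sym (ℕ→ℚ-suc k)))))
  where
  lem : ∀ c n → c + n * c ≡ (1ℚ + n) * c
  lem = solve-∀ ℚ-ring

-- Rational weights become repetitions, one denominator at a time: to insert `a` with weight c / q,
-- the list built so far is repeated q times and `a` is added R * c times. R is the product of the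
-- denominators.
∑-weighted : ∀ (l : List A) (f : A → ℚ) → (∀ a → 0ℚ ≤ f a) →
  Σ ℕ λ R → Σ (List A) λ l′ → 0 ℕ.< R × (∀ G → ∑ l′ G ≡ ℕ→ℚ R * ∑ l (λ a → f a * G a))
∑-weighted []      f 0≤f = 1 , [] , s≤s z≤n , λ G → refl
∑-weighted (a ∷ l) f 0≤f with ∑-weighted l f 0≤f | fraction (0≤f a)
... | R , l′ , R>0 , e | q , c , q>0 , e′ =
  q ℕ.* R , List.replicate (R ℕ.* c) a ++ List.concat (List.replicate q l′) , ℕ.*-mono-< {0} {q} {0} {R} q>0 R>0 , λ G → begin
    ∑ (List.replicate (R ℕ.* c) a ++ List.concat (List.replicate q l′)) G
      ≡⟨ ∑-++ (List.replicate (R ℕ.* c) a) _ G ⟩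
    ∑ (List.replicate (R ℕ.* c) a) G + ∑ (List.concat (List.replicate q l′)) G
      ≡⟨ cong₂ _+_ (trans (∑-replicate (R ℕ.* c) a G) (cong (_* G a) (trans (ℕ→ℚ-* R c) (cong (ℕ→ℚ R *_) (sym e′)))))
                   (trans (∑-concat-replicate q l′ G) (cong (ℕ→ℚ q *_) (e G))) ⟩
    ℕ→ℚ R * (ℕ→ℚ q * f a) * G a + ℕ→ℚ q * (ℕ→ℚ R * ∑ l (λ a → f a * G a))
      ≡⟨ lem (ℕ→ℚ R) (ℕ→ℚ q) (f a) (G a) (∑ l (λ a → f a * G a)) ⟩
    ℕ→ℚ q * ℕ→ℚ R * (f a * G a + ∑ l (λ a → f a * G a))
      ≡⟨ cong (_* (f a * G a + ∑ l (λ a → f a * G a))) (ℕ→ℚ-* q R) ⟨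
    ℕ→ℚ (q ℕ.* R) * (f a * G a + ∑ l (λ a → f a * G a)) ∎
  where
  open ≡-Reasoning
  lem : ∀ R q f g s → R * (q * f) * g + q * (R * s) ≡ q * R * (f * g + s)
  lem = solve-∀ ℚ-ring

weighted : ∀ {l : List A} → NonEmpty l → (f : A → ℚ) → (∀ a → 0ℚ ≤ f a) → mean l f ≡ 1ℚ →
  Σ (List A) λ l′ → NonEmpty l′ × (∀ G → mean l′ G ≡ mean l (λ a → f a * G a))
weighted {l = l} ne f 0≤f mass with ∑-weighted l f 0≤f
... | R , l′ , R>0 , e = l′ , pos⇒nonEmpty (ℕ→ℚ-cancel-pos (subst (0ℚ <_) (sym len) (*-pos (ℕ→ℚ-pos R>0) (length-pos ne)))) , λ G → begin
    mean l′ G                                         ≡⟨ mean-def l′ G ⟩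
    inv (ℕ→ℚ (length l′)) * ∑ l′ G                    ≡⟨ cong₂ (λ x y → inv x * y) len (e G) ⟩
    inv (r * N) * (r * ∑ l (λ a → f a * G a))         ≡⟨ cong (_* (r * ∑ l (λ a → f a * G a))) (inv-* (ℕ→ℚ-pos R>0) (length-pos ne)) ⟩
    inv r * inv N * (r * ∑ l (λ a → f a * G a))       ≡⟨ lem (inv r) (inv N) r (∑ l (λ a → f a * G a)) ⟩
    r * inv r * (inv N * ∑ l (λ a → f a * G a))       ≡⟨ cong₂ _*_ (*-inv (ℕ→ℚ-pos R>0)) (sym (mean-def l (λ a → f a * G a))) ⟩
    1ℚ * mean l (λ a → f a * G a)                     ≡⟨ *-identityˡ (mean l (λ a → f a * G a)) ⟩
    mean l (λ a → f a * G a)                          ∎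
  where
  open ≡-Reasoning
  r N : ℚ
  r = ℕ→ℚ R
  N = ℕ→ℚ (length l)
  lem : ∀ r′ n′ r s → r′ * n′ * (r * s) ≡ r * r′ * (n′ * s)
  lem = solve-∀ ℚ-ring
  ∑f : ∑ l (λ a → f a * 1ℚ) ≡ N
  ∑f = begin
    ∑ l (λ a → f a * 1ℚ)   ≡⟨ ∑-cong l (λ a → *-identityʳ (f a)) ⟩
    ∑ l f                  ≡⟨ *-identityˡ (∑ l f) ⟨
    1ℚ * ∑ l f             ≡⟨ cong (_* ∑ l f) (*-inv (length-pos ne)) ⟨
    N * inv N * ∑ l f      ≡⟨ *-assoc N (inv N) (∑ l f) ⟩
    N * (inv N * ∑ l f)    ≡⟨ cong (N *_) (trans (sym (mean-def l f)) mass) ⟩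
    N * 1ℚ                 ≡⟨ *-identityʳ N ⟩
    N                      ∎
  len : ℕ→ℚ (length l′) ≡ r * N
  len = trans (sym (trans (∑-const l′ 1ℚ) (*-identityʳ (ℕ→ℚ (length l′))))) (trans (e (λ _ → 1ℚ)) (cong (r *_) ∑f))
  ℕ→ℚ-cancel-pos : ∀ {a} → 0ℚ < ℕ→ℚ a → 0 ℕ.< a
  ℕ→ℚ-cancel-pos {zero}  p = ⊥-elim (<-irrefl refl p)
  ℕ→ℚ-cancel-pos {suc a} p = s≤s z≤n

small-inv : ∀ {ε} → 0ℚ < ε → Σ ℕ λ S → ∀ s → S ℕ.≤ s → inv (ℕ→ℚ (suc s)) ≤ ε
small-inv {ε} 0<ε = proj₁ (archimedean (inv ε)) , λ s S≤s → *-cancelˡ (suc-pos s) (subst₂ _≤_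
    (sym (*-inv (suc-pos s))) (*-comm ε (ℕ→ℚ (suc s)))
    (subst (_≤ ε * ℕ→ℚ (suc s)) (*-inv 0<ε) (*-monoˡ (<⇒≤ 0<ε)
      (≤-trans (proj₂ (archimedean (inv ε))) (ℕ→ℚ-mono (ℕ.≤-trans S≤s (ℕ.n≤1+n s)))))))
  where
  suc-pos : ∀ s → 0ℚ < ℕ→ℚ (suc s)
  suc-pos s = ℕ→ℚ-pos {suc s} (s≤s z≤n)

-- A graph that looks like the kernel c / q: vertices ((x , j) , i) and ((y , j′) , i′) are
-- joined iff i j′ + i′ j (mod q) is below c x y. Since i is an arbitrary map, the
-- values at j₁ ≢ j₂ are independent, so distinct columns are exactly orthogonal.
module Quasirandom {m : ℕ} (lx : List (Fin m)) (ne : NonEmpty lx) (q s : ℕ) .{{_ : ℕ.NonZero q}} .{{_ : ℕ.NonZero s}}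
  (c : Fin m → Fin m → ℕ) (c-sym : ∀ x y → c x y ≡ c y x) (c≤q : ∀ x y → c x y ℕ.≤ q)
  (K : Fin m → Fin m → ℚ) (K01 : ∀ x y → In01 (K x y)) (K≡ : ∀ x y → K x y ≡ inv (ℕ→ℚ q) * ℕ→ℚ (c x y)) where

  -- Cauchy-Schwarz bounds the squared discrepancy by the probability 1 / J that two indices
  -- coincide; a square J makes its root σ = 1 / s rational.
  J : ℕ
  J = s ℕ.* s

  V : Set
  V = (Fin m × Fin J) × (Fin J → Fin q)

  type : V → Fin m
  type v = proj₁ (proj₁ v)

  index : V → Fin J
  index v = proj₂ (proj₁ v)

  label : V → Fin J → Fin q
  label = proj₂

  0<q : 0 ℕ.< q
  0<q = ℕ.>-nonZero⁻¹ q

  0<s : 0 ℕ.< s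
  0<s = ℕ.>-nonZero⁻¹ s

  0<J : 0 ℕ.< J
  0<J = ℕ.*-mono-< {0} {s} {0} {s} 0<s 0<s

  σ : ℚ
  σ = inv (ℕ→ℚ s)

  0<σ : 0ℚ < σ
  0<σ = inv-pos (ℕ→ℚ-pos 0<s)

  σ≤1 : σ ≤ 1ℚ
  σ≤1 = *-cancelˡ (ℕ→ℚ-pos 0<s) (subst₂ _≤_ (sym (*-inv (ℕ→ℚ-pos 0<s))) (sym (*-identityʳ (ℕ→ℚ s))) (ℕ→ℚ-mono 0<s))

  vs : List V
  vs = pairs (pairs lx (allFin J)) (allMaps J q)

  vs-nonEmpty : NonEmpty vs
  vs-nonEmpty = pairs-nonEmpty (pairs-nonEmpty ne (allFin-nonEmpty 0<J)) (allMaps-nonEmpty J 0<q)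

  mean-vs : ∀ F → mean vs F ≡ mean lx (λ x → mean (allFin J) λ j → mean (allMaps J q) λ i → F ((x , j) , i))
  mean-vs F = trans (mean-pairs (pairs-nonEmpty ne (allFin-nonEmpty 0<J)) (allMaps-nonEmpty J 0<q) F)
    (mean-pairs ne (allFin-nonEmpty 0<J) _)

  mean-type : ∀ F → mean vs (F ∘ type) ≡ mean lx F
  mean-type F = trans (mean-vs (F ∘ type)) (mean-cong lx λ x →
    trans (mean-cong (allFin J) λ j → mean-const (allMaps-nonEmpty J 0<q) (F x)) (mean-const (allFin-nonEmpty 0<J) (F x)))

  thr : V → V → Bool
  thr a b = ((toℕ (label a (index b)) ℕ.+ toℕ (label b (index a))) ℕ.% q) ℕ.<ᵇ c (type a) (type b)

  thr-sym : ∀ a b → thr a b ≡ thr b a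
  thr-sym a b = cong₂ (λ z w → (z ℕ.% q) ℕ.<ᵇ w) (ℕ.+-comm (toℕ (label a (index b))) _) (c-sym (type a) (type b))

  D : V → V → ℚ
  D a b = [ thr a b ] - K (type a) (type b)

  same : V → V → ℚ
  same b b′ = [ does (index b Fin.≟ index b′) ]

  In01-diff : ∀ {a b a′ b′} → In01 a → In01 b → In01 a′ → In01 b′ → (a - b) * (a′ - b′) ≤ 1ℚ
  In01-diff {a} {b} {a′} {b′} (p , p′) (r , r′) (u , u′) (v , v′) =
    ≤-by (½ * ((1ℚ - (a - b)) * (1ℚ + (a′ - b′)) + (1ℚ + (a - b)) * (1ℚ - (a′ - b′))))
      (lem (a - b) (a′ - b′))
      (*-nonneg 0≤½ (+-nonneg (*-nonneg (lo p′ r) (hi u v′)) (*-nonneg (hi p r′) (lo u′ v))))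
    where
    lem : ∀ x y → 1ℚ ≡ x * y + ½ * ((1ℚ - x) * (1ℚ + y) + (1ℚ + x) * (1ℚ - y))
    lem = solve-∀ ℚ-ring
    e₁ : ∀ x y → 1ℚ - x + y ≡ 1ℚ - (x - y)
    e₁ = solve-∀ ℚ-ring
    e₂ : ∀ x y → x + (1ℚ - y) ≡ 1ℚ + (x - y)
    e₂ = solve-∀ ℚ-ring
    lo : ∀ {x y} → x ≤ 1ℚ → 0ℚ ≤ y → 0ℚ ≤ 1ℚ - (x - y)
    lo {x} {y} h k = subst (0ℚ ≤_) (e₁ x y) (+-nonneg (≤⇒0≤- h) k)
    hi : ∀ {x y} → 0ℚ ≤ x → y ≤ 1ℚ → 0ℚ ≤ 1ℚ + (x - y)
    hi {x} {y} h k = subst (0ℚ ≤_) (e₂ x y) (+-nonneg h (≤⇒0≤- k))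

  orthogonal : ∀ b b′ → index b ≢ index b′ → mean vs (λ a → D a b * D a b′) ≡ 0ℚ
  orthogonal b b′ j≢ = trans (mean-vs (λ a → D a b * D a b′))
    (trans (mean-cong lx λ x → trans (mean-cong (allFin J) λ j → vanish x j) (mean-0 (allFin J))) (mean-0 lx))
    where
    ls : Fin J → List (Fin q)
    ls _ = allFin q
    vanish : ∀ x j → mean (allMaps J q) (λ i → D ((x , j) , i) b * D ((x , j) , i) b′) ≡ 0ℚ
    vanish x j = begin
      mean (allMaps J q) P                                     ≡⟨ mean-allMaps J q 0<q P P-ext ⟩
      -- Only the label entry read by b is resampled; the factor of b′ reads another entry and stays
      -- fixed.
      E J ls P                                                 ≡⟨ E-resample ls (λ _ → allFin-nonEmpty 0<q) (index b) P P-ext ⟩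
      E J ls (λ i → mean (allFin q) λ a → P (upd (index b) a i))  ≡⟨ E-cong J ls (λ i → zero-mean i) ⟩
      E J ls (λ _ → 0ℚ)                                        ≡⟨ E-const J ls (λ _ → allFin-nonEmpty 0<q) 0ℚ ⟩
      0ℚ                                                       ∎
      where
      open ≡-Reasoning
      P : (Fin J → Fin q) → ℚ
      P i = D ((x , j) , i) b * D ((x , j) , i) b′
      P-ext : Extensional P
      P-ext f g e = cong₂ (λ y z → ([ ((toℕ y ℕ.+ toℕ (label b j)) ℕ.% q) ℕ.<ᵇ c x (type b) ] - K x (type b))
                                 * ([ ((toℕ z ℕ.+ toℕ (label b′ j)) ℕ.% q) ℕ.<ᵇ c x (type b′) ] - K x (type b′)))
                          (e (index b)) (e (index b′))
      Θ : Fin q → ℚ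
      Θ a = [ ((toℕ a ℕ.+ toℕ (label b j)) ℕ.% q) ℕ.<ᵇ c x (type b) ]
      zero-mean : ∀ i → mean (allFin q) (λ a → P (upd (index b) a i)) ≡ 0ℚ
      zero-mean i = begin
        mean (allFin q) (λ a → P (upd (index b) a i))
          ≡⟨ mean-cong (allFin q) (λ a → cong₂ (λ y z → (Θ y - K x (type b)) * ([ ((toℕ z ℕ.+ toℕ (label b′ j)) ℕ.% q) ℕ.<ᵇ c x (type b′) ] - K x (type b′)))
               (upd-same (index b) a i) (upd-other (index b) a i (j≢ ∘ sym))) ⟩
        mean (allFin q) (λ a → (Θ a - K x (type b)) * D ((x , j) , i) b′)
          ≡⟨ mean-*ʳ (allFin q) (D ((x , j) , i) b′) (λ a → Θ a - K x (type b)) ⟩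
        mean (allFin q) (λ a → Θ a - K x (type b)) * D ((x , j) , i) b′
          ≡⟨ cong (_* D ((x , j) , i) b′) (trans (mean-sub (allFin q) Θ (λ _ → K x (type b)))
               (trans (cong₂ _-_ (trans (mean-threshold q (c x (type b)) (toℕ (label b j)) (c≤q x (type b))) (sym (K≡ x (type b)))) (mean-const (allFin-nonEmpty 0<q) (K x (type b))))
                 (+-inverseʳ (K x (type b))))) ⟩
        0ℚ * D ((x , j) , i) b′
          ≡⟨ *-zeroˡ (D ((x , j) , i) b′) ⟩
        0ℚ ∎

  corr : ∀ b b′ → mean vs (λ a → D a b * D a b′) ≤ same b b′
  corr b b′ with index b Fin.≟ index b′
  ... | yes _ = mean-≤1 vs-nonEmpty λ a → In01-diff ([]-01 (thr a b)) (K01 (type a) (type b)) ([]-01 (thr a b′)) (K01 (type a) (type b′))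
  ... | no j≢ = ≤-reflexive (orthogonal b b′ j≢)

  mean-same : mean vs (λ b → mean vs (same b)) ≡ σ * σ
  mean-same = trans (mean-cong vs λ b → begin
      mean vs (same b)
        ≡⟨ mean-vs (same b) ⟩
      mean lx (λ x → mean (allFin J) λ j → mean (allMaps J q) λ i → [ does (index b Fin.≟ j) ])
        ≡⟨ mean-cong lx (λ x → mean-cong (allFin J) λ j → mean-const (allMaps-nonEmpty J 0<q) [ does (index b Fin.≟ j) ]) ⟩
      mean lx (λ x → mean (allFin J) λ j → [ does (index b Fin.≟ j) ])
        ≡⟨ mean-const ne _ ⟩
      mean (allFin J) (λ j → [ does (index b Fin.≟ j) ])
        ≡⟨ mean-Fin-1 (λ j → [ does (index b Fin.≟ j) ]) ⟩
      inv (ℕ→ℚ J) * ∑ (allFin J) (λ j → [ does (index b Fin.≟ j) ])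
        ≡⟨ cong₂ _*_ (trans (cong inv (ℕ→ℚ-* s s)) (inv-* (ℕ→ℚ-pos 0<s) (ℕ→ℚ-pos 0<s)))
             (trans (∑-cong (allFin J) λ j → sym (*-identityʳ [ does (index b Fin.≟ j) ])) (∑-δ (index b) (λ _ → 1ℚ))) ⟩
      σ * σ * 1ℚ
        ≡⟨ *-identityʳ (σ * σ) ⟩
      σ * σ ∎)
    (mean-const vs-nonEmpty (σ * σ))
    where open ≡-Reasoning

  N : ℕ
  N = length vs

  dec : Fin N → V
  dec = List.lookup vs

  lN : List (Fin N)
  lN = allFin N

  0<N : 0 ℕ.< N
  0<N with vs | vs-nonEmpty
  ... | _ ∷ _ | nonEmpty = s≤s z≤n

  s≤N : s ℕ.≤ N
  s≤N = subst (s ℕ.≤_) (sym eq) (ℕ.≤-trans (ℕ.m≤m*n s (s ℕ.* L)) (ℕ.≤-reflexive (rearrange s (length lx) (length (allMaps J q)))))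
    where
    L : ℕ
    L = length lx ℕ.* length (allMaps J q)
    eq : N ≡ length lx ℕ.* J ℕ.* length (allMaps J q)
    eq = trans (length-pairs (pairs lx (allFin J)) (allMaps J q))
      (cong (ℕ._* length (allMaps J q)) (trans (length-pairs lx (allFin J)) (cong (length lx ℕ.*_) (length-allFin J))))
    instance
      L≢0 : ℕ.NonZero (s ℕ.* L)
      L≢0 = ℕ.m*n≢0 s L {{it}} {{ℕ.m*n≢0 (length lx) (length (allMaps J q)) {{nz ne}} {{nz (allMaps-nonEmpty J 0<q)}}}}
        where
        nz : ∀ {A : Set} {l : List A} → NonEmpty l → ℕ.NonZero (length l)
        nz nonEmpty = _
    rearrange : ∀ s a b → s ℕ.* (s ℕ.* (a ℕ.* b)) ≡ a ℕ.* (s ℕ.* s) ℕ.* b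
    rearrange = ℕ-solver.solve-∀

  discrepancy : (φ ψ : Fin N → ℚ) → ℚ
  discrepancy φ ψ = mean lN λ a → mean lN λ b → D (dec a) (dec b) * (φ a * ψ b)

  discrepancy²≤ : ∀ φ ψ → (∀ a → In01 (φ a)) → (∀ b → In01 (ψ b)) → discrepancy φ ψ * discrepancy φ ψ ≤ σ * σ
  discrepancy²≤ φ ψ φ01 ψ01 = subst (discrepancy φ ψ * discrepancy φ ψ ≤_) eq
    (discrepancy² lN (λ a b → D (dec a) (dec b)) (λ a b → same (dec a) (dec b))
      (λ b b′ → proj₁ ([]-01 (does (index (dec b) Fin.≟ index (dec b′)))))
      (λ b b′ → subst (_≤ same (dec b) (dec b′)) (sym (mean-lookup vs (λ a → D a (dec b) * D a (dec b′)))) (corr (dec b) (dec b′)))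
      φ ψ φ01 ψ01)
    where
    eq : mean lN (λ b → mean lN (λ b′ → same (dec b) (dec b′))) ≡ σ * σ
    eq = trans (mean-cong lN λ b → mean-lookup vs (same (dec b))) (trans (mean-lookup vs (λ b → mean vs (same b))) mean-same)

  discrepancy≤ : ∀ φ ψ → (∀ a → In01 (φ a)) → (∀ b → In01 (ψ b)) → discrepancy φ ψ ≤ σ
  discrepancy≤ φ ψ φ01 ψ01 = sq-≤⇒≤ (<⇒≤ 0<σ) (discrepancy²≤ φ ψ φ01 ψ01)

  -discrepancy≤ : ∀ φ ψ → (∀ a → In01 (φ a)) → (∀ b → In01 (ψ b)) → - discrepancy φ ψ ≤ σ
  -discrepancy≤ φ ψ φ01 ψ01 = sq-≤⇒≤ (<⇒≤ 0<σ) (subst (_≤ σ * σ) (neg² (discrepancy φ ψ)) (discrepancy²≤ φ ψ φ01 ψ01))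
    where
    neg² : ∀ a → a * a ≡ (- a) * (- a)
    neg² = solve-∀ ℚ-ring

  -- A graph has no loops. Deleting all pairs of equal index removes the loops and costs the mean of
  -- `same`, which is only σ * σ.
  distinct : V → V → Bool
  distinct a b = not (does (index a Fin.≟ index b))

  distinct-sym : ∀ a b → distinct a b ≡ distinct b a
  distinct-sym a b with index a Fin.≟ index b | index b Fin.≟ index a
  ... | yes _ | yes _ = refl
  ... | no  _ | no  _ = refl
  ... | yes p | no ¬p = ⊥-elim (¬p (sym p))
  ... | no ¬p | yes p = ⊥-elim (¬p (sym p))

  distinct-irrefl : ∀ a → distinct a a ≡ false
  distinct-irrefl a with index a Fin.≟ index a
  ... | yes _ = refl
  ... | no ¬p = ⊥-elim (¬p refl)

  graph : Graph
  graph = record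
    { n      = N
    ; adj    = λ a b → thr (dec a) (dec b) ∧ distinct (dec a) (dec b)
    ; sym    = λ a b → cong₂ _∧_ (thr-sym (dec a) (dec b)) (distinct-sym (dec a) (dec b))
    ; irrefl = λ a → trans (cong (thr (dec a) (dec a) ∧_) (distinct-irrefl (dec a))) (∧-zeroʳ (thr (dec a) (dec a)))
    }

  K̂ T̂ : Fin N → Fin N → ℚ
  K̂ a b = K (type (dec a)) (type (dec b))
  T̂ a b = [ thr (dec a) (dec b) ]

  adj≤thr : ∀ a b → adjℚ graph a b ≤ T̂ a b
  adj≤thr a b = le (thr (dec a) (dec b)) (distinct (dec a) (dec b))
    where
    le : ∀ x y → [ x ∧ y ] ≤ [ x ]
    le true  y = proj₂ ([]-01 y)
    le false y = ≤-refl

  thr-same≤adj : ∀ a b → T̂ a b ≤ adjℚ graph a b + same (dec a) (dec b)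
  thr-same≤adj a b = le (thr (dec a) (dec b)) (does (index (dec a) Fin.≟ index (dec b)))
    where
    le : ∀ x y → [ x ] ≤ [ x ∧ not y ] + [ y ]
    le true  true  = ≤-refl
    le true  false = ≤-refl
    le false true  = 0≤1
    le false false = ≤-refl

  hom≤ : ∀ H → t H graph ≤ E (n H) (λ _ → lx) (hom (edgeList H) K) + ℕ→ℚ (e H) * σ
  hom≤ H = begin
    t H graph
      ≤⟨ t≤hom H graph 0<N ⟩
    E (n H) (λ _ → lN) (hom (edgeList H) (adjℚ graph))
      ≤⟨ E-mono (n H) (λ _ → lN) (λ x → ∏-mono (edgeList H) (λ p → proj₁ ([]-01 (adj graph (x (proj₁ p)) (x (proj₂ p))))) (λ p → adj≤thr (x (proj₁ p)) (x (proj₂ p)))) ⟩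
    E (n H) (λ _ → lN) (hom (edgeList H) T̂)
      ≤⟨ Counting.counting lN (allFin-nonEmpty 0<N) T̂ K̂ (λ a b → []-01 (thr (dec a) (dec b))) (λ a b → K01 (type (dec a)) (type (dec b))) σ discrepancy≤
           (edgeList H) (λ p p∈ → proj₁ (∈-edgeList⁻ H p∈)) (edgeList-unique H) ⟩
    E (n H) (λ _ → lN) (hom (edgeList H) K̂) + ℕ→ℚ (e H) * σ
      ≡⟨ cong (_+ ℕ→ℚ (e H) * σ) (E-map (n H) (λ _ → lN) (λ _ → lx) (type ∘ dec)
           (λ _ G → trans (mean-lookup vs (G ∘ type)) (mean-type G)) (hom (edgeList H) K) (hom-ext (edgeList H) K)) ⟩
    E (n H) (λ _ → lx) (hom (edgeList H) K) + ℕ→ℚ (e H) * σ ∎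
    where open ≤-Reasoning

  -- One σ pays for the discrepancy between threshold and kernel, the other for the deleted pairs of
  -- equal index, whose mean σ * σ is at most σ.
  density≥ : ∀ (φ : Fin N → ℚ) → (∀ a → In01 (φ a)) →
    mean lN (λ a → mean lN λ b → φ a * φ b * K̂ a b) ≤ mean lN (λ a → mean lN λ b → φ a * φ b * adjℚ graph a b) + (σ + σ)
  density≥ φ φ01 = begin
    mean lN (λ a → mean lN λ b → φ a * φ b * K̂ a b)
      ≤⟨ mean-mono lN (λ a → mean-mono lN λ b → pointwise a b) ⟩
    mean lN (λ a → mean lN λ b → φ a * φ b * adjℚ graph a b + same (dec a) (dec b) - D (dec a) (dec b) * (φ a * φ b))
      ≡⟨ mean-cong lN (λ a → trans (mean-sub lN _ _) (cong (_- mean lN (λ b → D (dec a) (dec b) * (φ a * φ b))) (mean-+ lN _ _))) ⟩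
    mean lN (λ a → mean lN (λ b → φ a * φ b * adjℚ graph a b) + mean lN (λ b → same (dec a) (dec b)) - mean lN (λ b → D (dec a) (dec b) * (φ a * φ b)))
      ≡⟨ trans (mean-sub lN _ _) (cong (_- discrepancy φ φ) (mean-+ lN _ _)) ⟩
    M + mean lN (λ a → mean lN (λ b → same (dec a) (dec b))) - discrepancy φ φ
      ≡⟨ cong (λ z → M + z - discrepancy φ φ) (trans (mean-cong lN λ b → mean-lookup vs (same (dec b))) (trans (mean-lookup vs (λ b → mean vs (same b))) mean-same)) ⟩
    M + σ * σ - discrepancy φ φ
      ≤⟨ +-mono-≤ (+-monoʳ-≤ M (subst (σ * σ ≤_) (*-identityʳ σ) (*-monoˡ (<⇒≤ 0<σ) σ≤1))) (-discrepancy≤ φ φ φ01 φ01) ⟩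
    M + σ + σ
      ≡⟨ +-assoc M σ σ ⟩
    M + (σ + σ) ∎
    where
    open ≤-Reasoning
    M : ℚ
    M = mean lN (λ a → mean lN λ b → φ a * φ b * adjℚ graph a b)
    lem : ∀ p k t a s → p * a + s - (t - k) * p ≡ p * k + (p * (a + s - t) + (1ℚ - p) * s)
    lem = solve-∀ ℚ-ring
    pointwise : ∀ a b → φ a * φ b * K̂ a b ≤ φ a * φ b * adjℚ graph a b + same (dec a) (dec b) - D (dec a) (dec b) * (φ a * φ b)
    pointwise a b = ≤-by _ (lem (φ a * φ b) (K̂ a b) (T̂ a b) (adjℚ graph a b) (same (dec a) (dec b)))
      (+-nonneg (*-nonneg (proj₁ p01) (≤⇒0≤- (thr-same≤adj a b))) (*-nonneg (≤⇒0≤- (proj₂ p01)) (proj₁ ([]-01 (does (index (dec a) Fin.≟ index (dec b)))))))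
      where
      p01 : In01 (φ a * φ b)
      p01 = In01-* (φ01 a) (φ01 b)

-- One more than the number of edges, so that division is possible even when H has no edge.
e⁺ : Graph → ℚ
e⁺ H = ℕ→ℚ (suc (e H))

-- Weighted versions of the KNRS property

does-sym : ∀ {m} (x y : Fin m) → does (x Fin.≟ y) ≡ does (y Fin.≟ x)
does-sym x y with x Fin.≟ y | y Fin.≟ x
... | yes _ | yes _ = refl
... | no  _ | no  _ = refl
... | yes p | no ¬p = ⊥-elim (¬p (sym p))
... | no ¬p | yes p = ⊥-elim (¬p (sym p))

-- `push` is the density, with respect to the uniform measure on Fin m, of the image under τ of the
-- measure φ on l. It turns a vertex set of the blow-up into a test function on types.
module Pushforward {m : ℕ} (0<m : 0 ℕ.< m) (l : List A) (τ : A → Fin m) (φ : A → ℚ) where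

  push : Fin m → ℚ
  push x = ℕ→ℚ m * mean l λ a → φ a * [ does (τ a Fin.≟ x) ]

  mean-push : ∀ h → mean (allFin m) (λ x → push x * h x) ≡ mean l (λ a → φ a * h (τ a))
  mean-push h = begin
    mean (allFin m) (λ x → push x * h x)
      ≡⟨ mean-Fin-1 (λ x → push x * h x) ⟩
    i * ∑ (allFin m) (λ x → push x * h x)
      ≡⟨ cong (i *_) (trans (∑-cong (allFin m) λ x → *-assoc M _ (h x)) (∑-*ˡ (allFin m) M _)) ⟩
    i * (M * ∑ (allFin m) (λ x → mean l (λ a → φ a * δ a x) * h x))
      ≡⟨ cancel ⟩
    ∑ (allFin m) (λ x → mean l (λ a → φ a * δ a x) * h x)
      ≡⟨ ∑-cong (allFin m) (λ x → sym (mean-*ʳ l (h x) _)) ⟩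
    ∑ (allFin m) (λ x → mean l (λ a → φ a * δ a x * h x))
      ≡⟨ mean-∑-swap l (allFin m) (λ a x → φ a * δ a x * h x) ⟨
    mean l (λ a → ∑ (allFin m) (λ x → φ a * δ a x * h x))
      ≡⟨ mean-cong l (λ a → trans (∑-cong (allFin m) λ x → *-assoc (φ a) (δ a x) (h x)) (trans (∑-*ˡ (allFin m) (φ a) _) (cong (φ a *_) (∑-δ (τ a) h)))) ⟩
    mean l (λ a → φ a * h (τ a)) ∎
    where
    open ≡-Reasoning
    M i : ℚ
    M = ℕ→ℚ m
    i = inv M
    δ : A → Fin m → ℚ
    δ a x = [ does (τ a Fin.≟ x) ]
    S : ℚ
    S = ∑ (allFin m) (λ x → mean l (λ a → φ a * δ a x) * h x)
    lem : ∀ i m s → i * (m * s) ≡ m * i * s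
    lem = solve-∀ ℚ-ring
    cancel : i * (M * S) ≡ S
    cancel = trans (lem i M S) (trans (cong (_* S) (*-inv (ℕ→ℚ-pos 0<m))) (*-identityˡ S))

  mean-push-1 : mean (allFin m) push ≡ mean l φ
  mean-push-1 = trans (mean-cong (allFin m) λ x → sym (*-identityʳ (push x)))
    (trans (mean-push (λ _ → 1ℚ)) (mean-cong l λ a → *-identityʳ (φ a)))

  push-nonneg : (∀ a → In01 (φ a)) → ∀ x → 0ℚ ≤ push x
  push-nonneg φ01 x = *-nonneg (ℕ→ℚ-nonneg m) (mean-nonneg l λ a → *-nonneg (proj₁ (φ01 a)) (proj₁ ([]-01 (does (τ a Fin.≟ x)))))

  -- As φ ≤ 1, the image of the measure φ lies below the image of the full measure, whose density is
  -- f. This makes `push` admissible in `LocallyDense`.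
  push≤ : (∀ a → In01 (φ a)) → ∀ f → (∀ G → mean l (G ∘ τ) ≡ mean (allFin m) (λ x → f x * G x)) → ∀ x → push x ≤ f x
  push≤ φ01 f law x = begin
    M * mean l (λ a → φ a * [ does (τ a Fin.≟ x) ])
      ≤⟨ *-monoˡ (ℕ→ℚ-nonneg m) (mean-mono l λ a → subst (φ a * [ does (τ a Fin.≟ x) ] ≤_) (*-identityˡ _) (*-monoʳ (proj₁ ([]-01 (does (τ a Fin.≟ x)))) (proj₂ (φ01 a)))) ⟩
    M * mean l (λ a → [ does (τ a Fin.≟ x) ])
      ≡⟨ cong (M *_) (trans (law (λ y → [ does (y Fin.≟ x) ])) (mean-Fin-1 (λ y → f y * [ does (y Fin.≟ x) ]))) ⟩
    M * (inv M * ∑ (allFin m) (λ y → f y * [ does (y Fin.≟ x) ]))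
      ≡⟨ cong (λ z → M * (inv M * z)) (trans (∑-cong (allFin m) λ y → trans (*-comm (f y) _) (cong (λ b → [ b ] * f y) (does-sym y x))) (∑-δ x f)) ⟩
    M * (inv M * f x)
      ≡⟨ *-assoc M (inv M) (f x) ⟨
    M * inv M * f x
      ≡⟨ trans (cong (_* f x) (*-inv (ℕ→ℚ-pos 0<m))) (*-identityˡ (f x)) ⟩
    f x ∎
    where
    open ≤-Reasoning
    M : ℚ
    M = ℕ→ℚ m

-- f is the density of the reference measure. The functions g between 0 and f play the part of
-- vertex subsets, and the mean of g is their measure.
LocallyDense : ∀ {m} → ℚ → ℚ → (Fin m → ℚ) → (Fin m → Fin m → ℚ) → Set
LocallyDense {m} ρ d f K = ∀ g → (∀ x → 0ℚ ≤ g x) → (∀ x → g x ≤ f x) → ρ ≤ mean (allFin m) g →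
  d * (mean (allFin m) g * mean (allFin m) g) ≤ mean (allFin m) (λ x → mean (allFin m) λ y → g x * g y * K x y)

-- Writing P for (½ * d) ^ e(H), the bounds on 1 / s say that σ is small twice over. First 2σ ≤
-- ½dρ², so a set of measure α ≥ ρ keeps dα² - 2σ ≥ ½dα² and the graph is dense with parameter ½ *
-- d. Secondly e(H)σ ≤ P / 4, so half of the guaranteed P / 2 survives the counting lemma.
module Blowup (H : Graph) {d ρ : ℚ} (0<d : 0ℚ < d) (0<ρ : 0ℚ < ρ) (N₀ : ℕ)
  (bound : ∀ G → N₀ ℕ.≤ n G → Dense ρ (½ * d) G → (1ℚ - ½) * ((½ * d) ^ℚ e H) ≤ t H G)
  {m : ℕ} (0<m : 0 ℕ.< m) (f : Fin m → ℚ) (K : Fin m → Fin m → ℚ)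
  (K01 : ∀ x y → In01 (K x y)) (K-sym : ∀ x y → K x y ≡ K y x) (dense : LocallyDense ρ d f K)
  (lx : List (Fin m)) (ne : NonEmpty lx) (law : ∀ G → mean lx G ≡ mean (allFin m) (λ x → f x * G x))
  (q : ℕ) (q>0 : 0 ℕ.< q) (integral : ∀ x y → Σ ℕ λ c → ℕ→ℚ q * K x y ≡ ℕ→ℚ c)
  (S₁ S₂ : ℕ) (small₁ : ∀ s → S₁ ℕ.≤ s → inv (ℕ→ℚ (suc s)) ≤ ½ * (½ * d * (ρ * ρ)))
  (small₂ : ∀ s → S₂ ℕ.≤ s → inv (ℕ→ℚ (suc s)) ≤ inv (e⁺ H) * (½ * ½ * ((½ * d) ^ℚ e H))) where

  s₀ s : ℕ
  s₀ = S₁ ℕ.+ S₂ ℕ.+ N₀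
  s = suc s₀
  instance
    q≢0 : ℕ.NonZero q
    q≢0 = ℕ.>-nonZero q>0
  0<ιq : 0ℚ < ℕ→ℚ q
  0<ιq = ℕ→ℚ-pos q>0
  c : Fin m → Fin m → ℕ
  c x y = proj₁ (integral x y)
  c-sym : ∀ x y → c x y ≡ c y x
  c-sym x y = ℕ→ℚ-injective (trans (sym (proj₂ (integral x y))) (trans (cong (ℕ→ℚ q *_) (K-sym x y)) (proj₂ (integral y x))))
  c≤q : ∀ x y → c x y ℕ.≤ q
  c≤q x y = ℕ→ℚ-cancel-≤ (subst₂ _≤_ (proj₂ (integral x y)) (*-identityʳ (ℕ→ℚ q)) (*-monoˡ (<⇒≤ 0<ιq) (proj₂ (K01 x y))))
  K≡ : ∀ x y → K x y ≡ inv (ℕ→ℚ q) * ℕ→ℚ (c x y)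
  K≡ x y = trans (sym (*-identityˡ (K x y))) (trans (cong (_* K x y) (sym (*-inv 0<ιq)))
    (trans (lem (ℕ→ℚ q) (inv (ℕ→ℚ q)) (K x y)) (cong (inv (ℕ→ℚ q) *_) (proj₂ (integral x y)))))
    where
    lem : ∀ a b c → a * b * c ≡ b * (a * c)
    lem = solve-∀ ℚ-ring
  module Q = Quasirandom lx ne q s c c-sym c≤q K K01 K≡
  σ≤₁ : Q.σ ≤ ½ * (½ * d * (ρ * ρ))
  σ≤₁ = small₁ s₀ (ℕ.≤-trans (ℕ.m≤m+n S₁ S₂) (ℕ.m≤m+n (S₁ ℕ.+ S₂) N₀))
  σ≤₂ : Q.σ ≤ inv (e⁺ H) * (½ * ½ * ((½ * d) ^ℚ e H))
  σ≤₂ = small₂ s₀ (ℕ.≤-trans (ℕ.m≤n+m S₂ S₁) (ℕ.m≤m+n (S₁ ℕ.+ S₂) N₀))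
  N₀≤ : N₀ ℕ.≤ Q.N
  N₀≤ = ℕ.≤-trans (ℕ.≤-trans (ℕ.m≤n+m N₀ (S₁ ℕ.+ S₂)) (ℕ.n≤1+n s₀)) Q.s≤N
  graph-dense : ∀ (χ : Fin Q.N → Bool) → ρ ≤ mean Q.lN ([_] ∘ χ) →
    ½ * d * (mean Q.lN ([_] ∘ χ) * mean Q.lN ([_] ∘ χ)) ≤ mean Q.lN (λ a → mean Q.lN λ b → [ χ a ] * [ χ b ] * adjℚ Q.graph a b)
  graph-dense χ ρ≤α = ≤-by _ (rearrange (½ * d * (α * α)) (½ * d * (ρ * ρ)) Q.σ β)
    (+-nonneg (≤⇒0≤- (≤-trans (≤-reflexive (double (½ * d * (α * α)))) step))
      (+-nonneg (+-nonneg (≤⇒0≤- σ≤₁) (≤⇒0≤- σ≤₁)) (≤⇒0≤- (*-monoˡ (<⇒≤ (*-pos 0<½ 0<d)) (*-mono (<⇒≤ 0<ρ) (<⇒≤ 0<ρ) ρ≤α ρ≤α)))))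
    where
    α β : ℚ
    α = mean Q.lN ([_] ∘ χ)
    β = mean Q.lN (λ a → mean Q.lN λ b → [ χ a ] * [ χ b ] * adjℚ Q.graph a b)
    module P = Pushforward 0<m Q.lN (Q.type ∘ Q.dec) ([_] ∘ χ)
    χ01 : ∀ a → In01 [ χ a ]
    χ01 a = []-01 (χ a)
    g≤f : ∀ x → P.push x ≤ f x
    g≤f = P.push≤ χ01 f λ G → trans (mean-lookup Q.vs (G ∘ Q.type)) (trans (Q.mean-type G) (law G))
    rearrange : ∀ a r s b → b ≡ a + (b + (s + s) - (a + a) + ((½ * r - s + (½ * r - s)) + (a - r)))
    rearrange = solve-∀ ℚ-ring
    double : ∀ a → a + a ≡ (1ℚ + 1ℚ) * a
    double = solve-∀ ℚ-ring
    two-halves : ∀ d a → (1ℚ + 1ℚ) * (½ * d * a) ≡ d * a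
    two-halves = solve-∀ ℚ-ring
    step : (1ℚ + 1ℚ) * (½ * d * (α * α)) ≤ β + (Q.σ + Q.σ)
    step = begin
      (1ℚ + 1ℚ) * (½ * d * (α * α))
        ≡⟨ two-halves d (α * α) ⟩
      d * (α * α)
        ≡⟨ cong (λ z → d * (z * z)) (sym P.mean-push-1) ⟩
      d * (mean (allFin m) P.push * mean (allFin m) P.push)
        ≤⟨ dense P.push (P.push-nonneg χ01) g≤f (subst (ρ ≤_) (sym P.mean-push-1) ρ≤α) ⟩
      mean (allFin m) (λ x → mean (allFin m) λ y → P.push x * P.push y * K x y)
        ≡⟨ mean-cong (allFin m) (λ x → trans (mean-cong (allFin m) λ y → *-assoc (P.push x) (P.push y) (K x y)) (mean-*ˡ (allFin m) (P.push x) _)) ⟩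
      mean (allFin m) (λ x → P.push x * mean (allFin m) λ y → P.push y * K x y)
        ≡⟨ mean-cong (allFin m) (λ x → cong (P.push x *_) (P.mean-push (K x))) ⟩
      mean (allFin m) (λ x → P.push x * mean Q.lN λ b → [ χ b ] * K x (Q.type (Q.dec b)))
        ≡⟨ P.mean-push _ ⟩
      mean Q.lN (λ a → [ χ a ] * mean Q.lN λ b → [ χ b ] * Q.K̂ a b)
        ≡⟨ mean-cong Q.lN (λ a → trans (sym (mean-*ˡ Q.lN [ χ a ] _)) (mean-cong Q.lN λ b → sym (*-assoc [ χ a ] [ χ b ] (Q.K̂ a b)))) ⟩
      mean Q.lN (λ a → mean Q.lN λ b → [ χ a ] * [ χ b ] * Q.K̂ a b)
        ≤⟨ Q.density≥ ([_] ∘ χ) χ01 ⟩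
      β + (Q.σ + Q.σ) ∎
      where open ≤-Reasoning
  P : ℚ
  P = (½ * d) ^ℚ e H
  hom≥ : (1ℚ - ½) * P ≤ t H Q.graph
  hom≥ = bound Q.graph N₀≤ (Dense-intro Q.graph Q.0<N {ρ} {½ * d} graph-dense)
  error : ℕ→ℚ (e H) * Q.σ ≤ ½ * ½ * P
  error = begin
    ℕ→ℚ (e H) * Q.σ
      ≤⟨ *-mono (ℕ→ℚ-nonneg (e H)) (<⇒≤ Q.0<σ) (ℕ→ℚ-mono (ℕ.n≤1+n (e H))) σ≤₂ ⟩
    e⁺ H * (inv (e⁺ H) * (½ * ½ * P))
      ≡⟨ *-assoc (e⁺ H) (inv (e⁺ H)) (½ * ½ * P) ⟨
    e⁺ H * inv (e⁺ H) * (½ * ½ * P)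
      ≡⟨ trans (cong (_* (½ * ½ * P)) (*-inv (ℕ→ℚ-pos {suc (e H)} (s≤s z≤n)))) (*-identityˡ (½ * ½ * P)) ⟩
    ½ * ½ * P ∎
    where open ≤-Reasoning
  result : ½ * ½ * P ≤ E (n H) (λ _ → lx) (hom (edgeList H) K)
  result = ≤-by _ (lem P (t H Q.graph) τ (ℕ→ℚ (e H) * Q.σ)) (+-nonneg (+-nonneg (≤⇒0≤- hom≥) (≤⇒0≤- (Q.hom≤ H))) (≤⇒0≤- error))
    where
    τ : ℚ
    τ = E (n H) (λ _ → lx) (hom (edgeList H) K)
    lem : ∀ p t τ ε → τ ≡ ½ * ½ * p + (t - (1ℚ - ½) * p + (τ + ε - t) + (½ * ½ * p - ε))
    lem = solve-∀ ℚ-ring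

-- Origin of the constants: one outer ½ is 1 - ε, the other is given up to the counting error, and
-- the ½ next to d to the error in local density.
KNRS-kernel : ∀ H → KNRS H → ∀ d → 0ℚ < d → Σ ℚ λ ρ → 0ℚ < ρ ×
  (∀ {m} → 0 ℕ.< m → (f : Fin m → ℚ) (K : Fin m → Fin m → ℚ) →
    (∀ x y → In01 (K x y)) → (∀ x y → K x y ≡ K y x) → LocallyDense ρ d f K →
    ∀ lx → NonEmpty lx → (∀ G → mean lx G ≡ mean (allFin m) (λ x → f x * G x)) →
    ½ * ½ * ((½ * d) ^ℚ e H) ≤ E (n H) (λ _ → lx) (hom (edgeList H) K))
KNRS-kernel H knrs d 0<d = ρ , 0<ρ , λ 0<m f K K01 K-sym dense lx ne law →
  let Q , Q>0 , integral = commonDenominator₂ K (λ x y → proj₁ (K01 x y))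
      S₁ , small₁ = small-inv (*-pos 0<½ (*-pos (*-pos 0<½ 0<d) (*-pos 0<ρ 0<ρ)))
      S₂ , small₂ = small-inv (*-pos (inv-pos (ℕ→ℚ-pos {suc (e H)} (s≤s z≤n))) (*-pos (*-pos 0<½ 0<½) (^ℚ-pos (e H) (*-pos 0<½ 0<d))))
  in Blowup.result H 0<d 0<ρ N₀ bound 0<m f K K01 K-sym dense lx ne law Q Q>0 integral S₁ S₂ small₁ small₂
  where
  given = knrs (½ * d) ½ (*-pos 0<½ 0<d) 0<½
  ρ : ℚ
  ρ = proj₁ given
  0<ρ : 0ℚ < ρ
  0<ρ = proj₁ (proj₂ given)
  N₀ : ℕ
  N₀ = proj₁ (proj₂ (proj₂ given))
  bound : ∀ G → N₀ ℕ.≤ n G → Dense ρ (½ * d) G → (1ℚ - ½) * ((½ * d) ^ℚ e H) ≤ t H G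
  bound = proj₂ (proj₂ (proj₂ given))

∏-bump : ∀ {h} (u : Fin h) (F G : Fin h → ℚ) c → 0ℚ ≤ c → (∀ v → 0ℚ ≤ F v) → (∀ v → 0ℚ ≤ G v) →
  (∀ v → v ≢ u → G v ≡ F v) → G u ≤ c * F u → ∏ (allFin h) G ≤ c * ∏ (allFin h) F
∏-bump {suc h} zero F G c 0≤c 0≤F 0≤G same le = begin
  ∏ (allFin (suc h)) G              ≡⟨ ∏-Fin-suc G ⟩
  G zero * ∏ (allFin h) (G ∘ suc)   ≡⟨ cong (G zero *_) (∏-cong (allFin h) λ v → same (suc v) λ ()) ⟩
  G zero * ∏ (allFin h) (F ∘ suc)   ≤⟨ *-monoʳ (∏-nonneg (allFin h) (0≤F ∘ suc)) le ⟩
  c * F zero * ∏ (allFin h) (F ∘ suc) ≡⟨ *-assoc c (F zero) _ ⟩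
  c * (F zero * ∏ (allFin h) (F ∘ suc)) ≡⟨ cong (c *_) (∏-Fin-suc F) ⟨
  c * ∏ (allFin (suc h)) F          ∎
  where open ≤-Reasoning
∏-bump {suc h} (suc u) F G c 0≤c 0≤F 0≤G same le = begin
  ∏ (allFin (suc h)) G              ≡⟨ ∏-Fin-suc G ⟩
  G zero * ∏ (allFin h) (G ∘ suc)   ≤⟨ *-monoˡ (0≤G zero) (∏-bump u (F ∘ suc) (G ∘ suc) c 0≤c (0≤F ∘ suc) (0≤G ∘ suc)
                                         (λ v v≢u → same (suc v) (v≢u ∘ Fin.suc-injective)) le) ⟩
  G zero * (c * ∏ (allFin h) (F ∘ suc)) ≡⟨ cong (_* (c * ∏ (allFin h) (F ∘ suc))) (same zero λ ()) ⟩
  F zero * (c * ∏ (allFin h) (F ∘ suc)) ≡⟨ lem (F zero) c _ ⟩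
  c * (F zero * ∏ (allFin h) (F ∘ suc)) ≡⟨ cong (c *_) (∏-Fin-suc F) ⟨
  c * ∏ (allFin (suc h)) F          ∎
  where
  open ≤-Reasoning
  lem : ∀ a b c → a * (b * c) ≡ b * (a * c)
  lem = solve-∀ ℚ-ring

-- Marks the non-isolated vertices. An isolated vertex has no path end to pay for a change of
-- measure.
touched : ∀ {h} → List (Fin h × Fin h) → Fin h → Bool
touched []             v = false
touched ((s , t) ∷ es) v = does (v Fin.≟ s) ∨ (does (v Fin.≟ t) ∨ touched es v)

touched-∈ : ∀ {h} {es : List (Fin h × Fin h)} {p} → p ∈ es → touched es (proj₁ p) ≡ true × touched es (proj₂ p) ≡ true
touched-∈ {es = (s , t) ∷ es} (here refl) = left , right
  where
  left : touched ((s , t) ∷ es) s ≡ true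
  left with s Fin.≟ s
  ... | yes _ = refl
  ... | no ¬p = ⊥-elim (¬p refl)
  right : touched ((s , t) ∷ es) t ≡ true
  right with t Fin.≟ t
  ... | yes _ = ∨-zeroʳ (does (t Fin.≟ s))
  ... | no ¬p = ⊥-elim (¬p refl)
touched-∈ {es = (s , t) ∷ es} {u , v} (there p∈) with touched-∈ {es = es} p∈
... | a , b rewrite a | b = trans (cong (does (u Fin.≟ s) ∨_) (∨-zeroʳ (does (u Fin.≟ t)))) (∨-zeroʳ (does (u Fin.≟ s)))
                          , trans (cong (does (v Fin.≟ s) ∨_) (∨-zeroʳ (does (v Fin.≟ t)))) (∨-zeroʳ (does (v Fin.≟ s)))

-- K is the kernel L normalised by the weights w, restricted to the support of w. Under the
-- density w / W the edges of H see K, while a touched vertex contributes at least its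
-- density; untouched vertices keep the uniform density.
module Normalised {m : ℕ} (0<m : 0 ℕ.< m) {θ : ℚ} (0<θ : 0ℚ < θ) (w : Fin m → ℚ)
  (w-dichotomy : ∀ x → w x ≡ 0ℚ ⊎ θ ≤ w x) (θ≤W : θ ≤ mean (allFin m) w)
  (L : Fin m → Fin m → ℚ) (L01 : ∀ x y → In01 (L x y)) where

  l : List (Fin m)
  l = allFin m

  W : ℚ
  W = mean l w

  0<W : 0ℚ < W
  0<W = <-≤-trans 0<θ θ≤W

  r : Fin m → ℚ
  r x with θ ≤? w x
  ... | yes _ = inv (w x)
  ... | no  _ = 0ℚ

  0≤w : ∀ x → 0ℚ ≤ w x
  0≤w x with w-dichotomy x
  ... | inj₁ z = ≤-reflexive (sym z)
  ... | inj₂ p = ≤-trans (<⇒≤ 0<θ) p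

  r-support : ∀ x → (w x ≡ 0ℚ × r x ≡ 0ℚ) ⊎ (θ ≤ w x × w x * r x ≡ 1ℚ)
  r-support x with θ ≤? w x | w-dichotomy x
  ... | yes p | _      = inj₂ (p , *-inv (<-≤-trans 0<θ p))
  ... | no ¬p | inj₁ z = inj₁ (z , refl)
  ... | no ¬p | inj₂ p = ⊥-elim (¬p p)

  r-nonneg : ∀ x → 0ℚ ≤ r x
  r-nonneg x with θ ≤? w x
  ... | yes p = inv-nonneg (0≤w x)
  ... | no  _ = ≤-refl

  θr01 : ∀ x → In01 (θ * r x)
  θr01 x with r-support x
  ... | inj₁ (_ , z) = subst In01 (sym (trans (cong (θ *_) z) (*-zeroʳ θ))) In01-0
  ... | inj₂ (p , e) = *-nonneg (<⇒≤ 0<θ) (r-nonneg x) , subst (θ * r x ≤_) e (*-monoʳ (r-nonneg x) p)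

  -- On the support of w the reciprocal r is at most 1 / θ, so one factor θ per endpoint puts the
  -- values into [0,1]. The price is the factor θ * θ in the density of `K-dense`.
  K : Fin m → Fin m → ℚ
  K x y = θ * r x * (θ * r y) * L x y

  K01 : ∀ x y → In01 (K x y)
  K01 x y = In01-* (In01-* (θr01 x) (θr01 y)) (L01 x y)

  K-sym : (∀ x y → L x y ≡ L y x) → ∀ x y → K x y ≡ K y x
  K-sym L-sym x y = cong₂ _*_ (*-comm (θ * r x) (θ * r y)) (L-sym x y)

  f : Fin m → ℚ
  f x = inv W * w x

  f-nonneg : ∀ x → 0ℚ ≤ f x
  f-nonneg x = *-nonneg (<⇒≤ (inv-pos 0<W)) (0≤w x)

  mean-f : mean l f ≡ 1ℚ
  mean-f = trans (mean-*ˡ l (inv W) w) (trans (*-comm (inv W) W) (*-inv 0<W))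

  -- A test function g ≤ w / W corresponds to γ = W * g / w, which takes values in [0,1] and
  -- satisfies γ * w = W * g. Under this substitution the forms of L at γ and of K at g agree up to
  -- the factors θ² and W².
  K-dense : ∀ {ρ d} → 0ℚ ≤ ρ →
    (∀ γ → (∀ x → In01 (γ x)) → ρ * W ≤ mean l (λ x → γ x * w x) →
      d * (mean l (λ x → γ x * w x) * mean l (λ x → γ x * w x)) ≤ mean l (λ x → mean l λ y → γ x * γ y * L x y)) →
    LocallyDense ρ (d * (θ * θ)) f K
  K-dense {ρ} {d} 0≤ρ dense g 0≤g g≤f ρ≤g = *-cancelˡ (*-pos 0<W 0<W) (begin
    W * W * (d * (θ * θ) * (α * α))
      ≡⟨ lem₁ W d θ α ⟩
    θ * θ * (d * (W * α * (W * α)))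
      ≡⟨ cong (λ z → θ * θ * (d * (z * z))) γw ⟨
    θ * θ * (d * (mean l (λ x → γ x * w x) * mean l (λ x → γ x * w x)))
      ≤⟨ *-monoˡ (sq-nonneg θ) (dense γ γ01 (subst₂ _≤_ (*-comm W ρ) (sym γw) (*-monoˡ (<⇒≤ 0<W) ρ≤g))) ⟩
    θ * θ * mean l (λ x → mean l λ y → γ x * γ y * L x y)
      ≡⟨ trans (mean-cong l λ x → mean-*ˡ l (θ * θ) _) (mean-*ˡ l (θ * θ) _) ⟨
    mean l (λ x → mean l λ y → θ * θ * (γ x * γ y * L x y))
      ≡⟨ mean-cong l (λ x → mean-cong l λ y → lem₂ W θ (r x) (r y) (g x) (g y) (L x y)) ⟩
    mean l (λ x → mean l λ y → W * W * (g x * g y * K x y))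
      ≡⟨ trans (mean-cong l λ x → mean-*ˡ l (W * W) _) (mean-*ˡ l (W * W) _) ⟩
    W * W * mean l (λ x → mean l λ y → g x * g y * K x y) ∎)
    where
    open ≤-Reasoning
    α : ℚ
    α = mean l g
    γ : Fin m → ℚ
    γ x = W * r x * g x
    lem₁ : ∀ W d θ α → W * W * (d * (θ * θ) * (α * α)) ≡ θ * θ * (d * (W * α * (W * α)))
    lem₁ = solve-∀ ℚ-ring
    lem₂ : ∀ W θ r r′ g g′ L → θ * θ * (W * r * g * (W * r′ * g′) * L) ≡ W * W * (g * g′ * (θ * r * (θ * r′) * L))
    lem₂ = solve-∀ ℚ-ring
    lem₃ : ∀ W r g w → W * r * g * w ≡ W * g * (w * r)
    lem₃ = solve-∀ ℚ-ring
    lem₄ : ∀ W r i w → W * r * (i * w) ≡ W * i * (w * r)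
    lem₄ = solve-∀ ℚ-ring
    pointwise : ∀ x → γ x * w x ≡ W * g x
    pointwise x with r-support x
    ... | inj₂ (_ , e) = trans (lem₃ W (r x) (g x) (w x)) (trans (cong (W * g x *_) e) (*-identityʳ (W * g x)))
    ... | inj₁ (z , _) = trans (trans (cong (γ x *_) z) (*-zeroʳ (γ x))) (sym (trans (cong (W *_) g0) (*-zeroʳ W)))
      where
      g0 : g x ≡ 0ℚ
      g0 = ≤-antisym (subst (g x ≤_) (trans (cong (inv W *_) z) (*-zeroʳ (inv W))) (g≤f x)) (0≤g x)
    γw : mean l (λ x → γ x * w x) ≡ W * α
    γw = trans (mean-cong l pointwise) (mean-*ˡ l W g)
    γ01 : ∀ x → In01 (γ x)
    γ01 x = *-nonneg (*-nonneg (<⇒≤ 0<W) (r-nonneg x)) (0≤g x) ,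
      ≤-trans (*-monoˡ (*-nonneg (<⇒≤ 0<W) (r-nonneg x)) (g≤f x)) (≤-trans (≤-reflexive (trans (lem₄ W (r x) (inv W) (w x)) (trans (cong (_* (w x * r x)) (*-inv 0<W)) (*-identityˡ (w x * r x))))) wr≤1)
      where
      wr≤1 : w x * r x ≤ 1ℚ
      wr≤1 with r-support x
      ... | inj₁ (z , _) = subst (_≤ 1ℚ) (sym (trans (cong (_* r x) z) (*-zeroˡ (r x)))) 0≤1
      ... | inj₂ (_ , e) = ≤-reflexive e

  ω : Bool → Fin m → ℚ
  ω true  x = f x
  ω false x = 1ℚ

  ω-nonneg : ∀ b x → 0ℚ ≤ ω b x
  ω-nonneg true  x = f-nonneg x
  ω-nonneg false x = 0≤1

  module _ {h : ℕ} where
    Ω : List (Fin h × Fin h) → (Fin h → Fin m) → ℚ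
    Ω es x = ∏ (allFin h) λ v → ω (touched es v) (x v)

    Ω-nonneg : ∀ es x → 0ℚ ≤ Ω es x
    Ω-nonneg es x = ∏-nonneg (allFin h) λ v → ω-nonneg (touched es v) (x v)

    -- On the support this is the reciprocal of θ * r, the factor that one endpoint contributes to
    -- K.
    weight : Fin m → ℚ
    weight x = inv θ * w x

    -- A vertex already touched gains a factor w / θ ≥ 1. A newly touched one passes from 1 to w /
    -- W, at most w / θ because θ ≤ W; this is the use made of the lower bound on the mean.
    ω-bump : ∀ b x → θ ≤ w x → f x ≤ weight x * ω b x
    ω-bump b x p = go b
      where
      1≤weight : 1ℚ ≤ weight x
      1≤weight = subst (_≤ weight x) (trans (*-comm (inv θ) θ) (*-inv 0<θ)) (*-monoˡ (<⇒≤ (inv-pos 0<θ)) p)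
      inv-anti : inv W ≤ inv θ
      inv-anti = *-cancelˡ (*-pos 0<W 0<θ) (subst₂ _≤_
        (sym (trans (lem₁ W θ (inv W)) (trans (cong (_* θ) (*-inv 0<W)) (*-identityˡ θ))))
        (sym (trans (*-assoc W θ (inv θ)) (trans (cong (W *_) (*-inv 0<θ)) (*-identityʳ W)))) θ≤W)
        where
        lem₁ : ∀ W θ i → W * θ * i ≡ W * i * θ
        lem₁ = solve-∀ ℚ-ring
      go : ∀ b → f x ≤ weight x * ω b x
      go true  = subst (_≤ weight x * f x) (*-identityˡ (f x)) (*-monoʳ (f-nonneg x) 1≤weight)
      go false = subst (f x ≤_) (sym (*-identityʳ (weight x))) (*-monoʳ (0≤w x) inv-anti)

    Ω-bump : ∀ s t es x → θ ≤ w (x s) → θ ≤ w (x t) → Ω ((s , t) ∷ es) x ≤ weight (x s) * (weight (x t) * Ω es x)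
    Ω-bump s t es x ps pt = ≤-trans
      (bump s (λ v → does (v Fin.≟ t) ∨ touched es v) ps)
      (*-monoˡ (weight-nonneg s) (bump t (touched es) pt))
      where
      weight-nonneg : ∀ v → 0ℚ ≤ weight (x v)
      weight-nonneg v = *-nonneg (<⇒≤ (inv-pos 0<θ)) (0≤w (x v))
      bump : ∀ u T → θ ≤ w (x u) →
        ∏ (allFin h) (λ v → ω (does (v Fin.≟ u) ∨ T v) (x v)) ≤ weight (x u) * ∏ (allFin h) (λ v → ω (T v) (x v))
      bump u T p = ∏-bump u _ _ (weight (x u)) (weight-nonneg u) (λ v → ω-nonneg (T v) (x v)) (λ v → ω-nonneg (does (v Fin.≟ u) ∨ T v) (x v)) other at
        where
        other : ∀ v → v ≢ u → ω (does (v Fin.≟ u) ∨ T v) (x v) ≡ ω (T v) (x v)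
        other v v≢u with v Fin.≟ u
        ... | yes q = ⊥-elim (v≢u q)
        ... | no  _ = refl
        at : ω (does (u Fin.≟ u) ∨ T u) (x u) ≤ weight (x u) * ω (T u) (x u)
        at with u Fin.≟ u
        ... | yes _ = ω-bump (T u) (x u) p
        ... | no ¬q = ⊥-elim (¬q refl)

    -- Induction on the edges: each new edge raises Ω by at most one `weight` per end, and these
    -- cancel against the factors θ * r in K. If an end lies outside the support, K is zero there
    -- and the left side vanishes.
    Ω-hom≤ : ∀ es x → Ω es x * hom es K x ≤ hom es L x
    Ω-hom≤ []             x = ≤-reflexive (trans (*-identityʳ (Ω [] x)) (∏-1 (allFin h)))
    Ω-hom≤ ((s , t) ∷ es) x with r-support (x s) | r-support (x t)
    ... | inj₁ (_ , z) | _ = subst (_≤ _) (sym (trans (cong (λ z → Ω ((s , t) ∷ es) x * (θ * z * (θ * r (x t)) * L (x s) (x t) * hom es K x)) z)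
                               (lem (Ω ((s , t) ∷ es) x) θ (r (x t)) (L (x s) (x t)) (hom es K x)))) (proj₁ (∏-01 ((s , t) ∷ es) λ p → L01 (x (proj₁ p)) (x (proj₂ p))))
      where
      lem : ∀ o t r l h → o * (t * 0ℚ * (t * r) * l * h) ≡ 0ℚ
      lem = solve-∀ ℚ-ring
    ... | inj₂ _ | inj₁ (_ , z) = subst (_≤ _) (sym (trans (cong (λ z → Ω ((s , t) ∷ es) x * (θ * r (x s) * (θ * z) * L (x s) (x t) * hom es K x)) z)
                               (lem (Ω ((s , t) ∷ es) x) θ (r (x s)) (L (x s) (x t)) (hom es K x)))) (proj₁ (∏-01 ((s , t) ∷ es) λ p → L01 (x (proj₁ p)) (x (proj₂ p))))
      where
      lem : ∀ o t r l h → o * (t * r * (t * 0ℚ) * l * h) ≡ 0ℚ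
      lem = solve-∀ ℚ-ring
    ... | inj₂ (ps , es₁) | inj₂ (pt , et₁) = begin
      Ω ((s , t) ∷ es) x * (K (x s) (x t) * hom es K x)
        ≤⟨ *-monoʳ (*-nonneg (proj₁ (K01 (x s) (x t))) (∏-nonneg es λ p → proj₁ (K01 (x (proj₁ p)) (x (proj₂ p))))) (Ω-bump s t es x ps pt) ⟩
      weight (x s) * (weight (x t) * Ω es x) * (K (x s) (x t) * hom es K x)
        ≡⟨ lem (inv θ) θ (w (x s)) (w (x t)) (r (x s)) (r (x t)) (L (x s) (x t)) (Ω es x) (hom es K x) ⟩
      θ * inv θ * (θ * inv θ) * (w (x s) * r (x s)) * (w (x t) * r (x t)) * (L (x s) (x t) * (Ω es x * hom es K x))
        ≡⟨ cong₂ (λ a b → θ * inv θ * (θ * inv θ) * a * b * (L (x s) (x t) * (Ω es x * hom es K x))) es₁ et₁ ⟩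
      θ * inv θ * (θ * inv θ) * 1ℚ * 1ℚ * (L (x s) (x t) * (Ω es x * hom es K x))
        ≡⟨ cong (λ z → z * z * 1ℚ * 1ℚ * (L (x s) (x t) * (Ω es x * hom es K x))) (*-inv 0<θ) ⟩
      1ℚ * 1ℚ * 1ℚ * 1ℚ * (L (x s) (x t) * (Ω es x * hom es K x))
        ≡⟨ *-identityˡ (L (x s) (x t) * (Ω es x * hom es K x)) ⟩
      L (x s) (x t) * (Ω es x * hom es K x)
        ≤⟨ *-monoˡ (proj₁ (L01 (x s) (x t))) (Ω-hom≤ es x) ⟩
      L (x s) (x t) * hom es L x ∎
      where
      open ≤-Reasoning
      lem : ∀ i θ w w′ r r′ L Ω h → i * w * (i * w′ * Ω) * (θ * r * (θ * r′) * L * h) ≡ θ * i * (θ * i) * (w * r) * (w′ * r′) * (L * (Ω * h))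
      lem = solve-∀ ℚ-ring

    -- Isolated vertices are first moved to the uniform measure; the density Ω then brings the
    -- others there too, and Ω is absorbed in passing from K to L.
    hom-transfer : ∀ es lx → NonEmpty lx → (∀ G → mean lx G ≡ mean l (λ x → f x * G x)) →
      E h (λ _ → lx) (hom es K) ≤ E h (λ _ → l) (hom es L)
    hom-transfer es lx ne law = begin
      E h (λ _ → lx) (hom es K)
        ≡⟨ E-irrelevant h (touched es) (λ _ → lx) ls (λ _ → ne) (λ v → ls-ne (touched es v)) (λ v e → sym (cong choose e)) (hom es K) dep ⟩
      E h ls (hom es K)
        ≡⟨ E-density h (λ _ → l) ls (λ v → ω (touched es v)) (λ v G → dens (touched es v) G) (hom es K) ⟨
      E h (λ _ → l) (λ x → Ω es x * hom es K x)
        ≤⟨ E-mono h (λ _ → l) (Ω-hom≤ es) ⟩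
      E h (λ _ → l) (hom es L) ∎
      where
      open ≤-Reasoning
      choose : Bool → List (Fin m)
      choose true  = lx
      choose false = l
      ls : Fin h → List (Fin m)
      ls v = choose (touched es v)
      ls-ne : ∀ b → NonEmpty (choose b)
      ls-ne true  = ne
      ls-ne false = allFin-nonEmpty 0<m
      dens : ∀ b G → mean l (λ x → ω b x * G x) ≡ mean (choose b) G
      dens true  G = sym (law G)
      dens false G = mean-cong l λ x → *-identityˡ (G x)
      dep : ∀ y z → (∀ v → touched es v ≡ true → y v ≡ z v) → hom es K y ≡ hom es K z
      dep y z agree = ∏-cong∈ es λ p p∈ → cong₂ K (agree (proj₁ p) (proj₁ (touched-∈ p∈))) (agree (proj₂ p) (proj₂ (touched-∈ p∈)))

-- ρ is fixed by H, d and θ before m, w and L appear. In the odd case it must be known before the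
-- graph is given.
KNRS-weighted : ∀ H → KNRS H → ∀ d θ → 0ℚ < d → 0ℚ < θ → Σ ℚ λ ρ → 0ℚ < ρ ×
  (∀ {m} → 0 ℕ.< m → (w : Fin m → ℚ) → (∀ x → w x ≡ 0ℚ ⊎ θ ≤ w x) → θ ≤ mean (allFin m) w →
    (L : Fin m → Fin m → ℚ) → (∀ x y → In01 (L x y)) → (∀ x y → L x y ≡ L y x) →
    (∀ γ → (∀ x → In01 (γ x)) → ρ * mean (allFin m) w ≤ mean (allFin m) (λ x → γ x * w x) →
      d * (mean (allFin m) (λ x → γ x * w x) * mean (allFin m) (λ x → γ x * w x))
        ≤ mean (allFin m) (λ x → mean (allFin m) λ y → γ x * γ y * L x y)) →
    ½ * ½ * ((½ * (d * (θ * θ))) ^ℚ e H) ≤ E (n H) (λ _ → allFin m) (hom (edgeList H) L))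
KNRS-weighted H knrs d θ 0<d 0<θ = ρ , 0<ρ , λ 0<m w dich θ≤W L L01 L-sym dense →
  let module N = Normalised 0<m 0<θ w dich θ≤W L L01
      lx , ne , law = weighted (allFin-nonEmpty 0<m) N.f N.f-nonneg N.mean-f
  in ≤-trans (kernel 0<m N.f N.K N.K01 (N.K-sym L-sym) (N.K-dense {ρ} {d} (<⇒≤ 0<ρ) dense) lx ne law)
       (N.hom-transfer (edgeList H) lx ne law)
  where
  given = KNRS-kernel H knrs (d * (θ * θ)) (*-pos 0<d (*-pos 0<θ 0<θ))
  ρ : ℚ
  ρ = proj₁ given
  0<ρ : 0ℚ < ρ
  0<ρ = proj₁ (proj₂ given)
  kernel = proj₂ (proj₂ given)

-- A subset of large minimum degree

-- Termination of pruning: a round that deletes anything lowers the count.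
countB-dichotomy : ∀ (S S′ : A → Bool) → (∀ x → S′ x ≡ true → S x ≡ true) → ∀ l →
  (∀ x → x ∈ l → S x ≡ true → S′ x ≡ true) × countB S′ l ≡ countB S l ⊎ countB S′ l ℕ.< countB S l
countB-dichotomy S S′ sub []      = inj₁ ((λ _ ()) , refl)
countB-dichotomy S S′ sub (x ∷ l) with countB-dichotomy S S′ sub l | S x in eq | S′ x in eq′
... | r             | false | true  = case trans (sym eq) (sub x eq′) of λ ()
... | inj₁ (f , e)  | true  | true  = inj₁ ((λ { y (here refl) _ → eq′ ; y (there y∈) → f y y∈ }) , cong suc e)
... | inj₁ (f , e)  | true  | false = inj₂ (s≤s (ℕ.≤-reflexive e))
... | inj₁ (f , e)  | false | false = inj₁ ((λ { y (here refl) q → case trans (sym eq) q of λ () ; y (there y∈) → f y y∈ }) , e)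
... | inj₂ lt       | true  | true  = inj₂ (s≤s lt)
... | inj₂ lt       | true  | false = inj₂ (ℕ.<-trans lt (ℕ.n<1+n _))
... | inj₂ lt       | false | false = inj₂ lt

module MinDegree {m : ℕ} (0<m : 0 ℕ.< m) (A : Fin m → Fin m → ℚ) (A01 : ∀ x y → In01 (A x y))
  (A-sym : ∀ x y → A x y ≡ A y x) (η : ℚ) (0≤η : 0ℚ ≤ η) where

  l : List (Fin m)
  l = allFin m

  deg : (Fin m → Bool) → Fin m → ℚ
  deg S x = mean l λ y → [ S y ] * A x y

  edges : (Fin m → Bool) → ℚ
  edges S = mean l λ x → [ S x ] * deg S x

  size : (Fin m → Bool) → ℚ
  size S = mean l ([_] ∘ S)

  -- Deleting the vertices of degree below η loses at most 2η times the deleted fraction in edges,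
  -- so the potential survives pruning; once pruning is stable it leaves edges S ≥ 2η.
  Potential : (Fin m → Bool) → Set
  Potential S = η + η + (η + η) ≤ edges S + (η + η) * (1ℚ - size S)

  prune : (Fin m → Bool) → Fin m → Bool
  prune S x = S x ∧ does (η ≤? deg S x)

  prune-sub : ∀ S x → prune S x ≡ true → S x ≡ true
  prune-sub S x e = proj₁ (∧-true e)

  prune-deg : ∀ S x → prune S x ≡ true → η ≤ deg S x
  prune-deg S x e = does⇒ (η ≤? deg S x) (proj₂ (∧-true {S x} e))
    where
    does⇒ : ∀ {P : Set} (p : Dec P) → does p ≡ true → P
    does⇒ (yes p) _ = p

  loss : ∀ S x → ([ S x ] - [ prune S x ]) * deg S x ≤ ([ S x ] - [ prune S x ]) * η
  loss S x = go (S x) (η ≤? deg S x)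
    where
    go : ∀ b (p : Dec (η ≤ deg S x)) → ([ b ] - [ b ∧ does p ]) * deg S x ≤ ([ b ] - [ b ∧ does p ]) * η
    go true  (yes _) = ≤-reflexive (trans (*-zeroˡ (deg S x)) (sym (*-zeroˡ η)))
    go true  (no ¬p) = *-monoˡ 0≤1 (<⇒≤ (≰⇒> ¬p))
    go false _       = ≤-reflexive (trans (*-zeroˡ (deg S x)) (sym (*-zeroˡ η)))

  prune≤ : ∀ S x → [ prune S x ] ≤ [ S x ]
  prune≤ S x with S x
  ... | true  = proj₂ ([]-01 (does (η ≤? deg S x)))
  ... | false = ≤-refl

  -- A lost pair has a deleted first or second vertex, and a deleted vertex has degree below η in S.
  -- By symmetry both cases cost η times the deleted measure; pairs with both ends deleted are
  -- counted twice, which is the slack.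
  prune-edges : ∀ S → edges S ≤ edges (prune S) + (η + η) * (size S - size (prune S))
  prune-edges S = begin
    edges S
      ≡⟨ expand S S ⟩
    mean l (λ x → mean l λ y → [ S x ] * ([ S y ] * A x y))
      ≤⟨ mean-mono l (λ x → mean-mono l λ y → pointwise x y) ⟩
    mean l (λ x → mean l λ y → [ S′ x ] * ([ S′ y ] * A x y) + (Δ x * ([ S y ] * A x y) + [ S x ] * (Δ y * A x y)))
      ≡⟨ trans (mean-cong l λ x → trans (mean-+ l _ _) (cong (mean l (λ y → [ S′ x ] * ([ S′ y ] * A x y)) +_) (mean-+ l _ _))) (trans (mean-+ l _ _) (cong (M +_) (mean-+ l _ _))) ⟩
    M + (mean l (λ x → mean l λ y → Δ x * ([ S y ] * A x y)) + mean l (λ x → mean l λ y → [ S x ] * (Δ y * A x y)))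
      ≡⟨ cong₂ _+_ (sym (expand S′ S′)) (cong₂ _+_ (mean-cong l λ x → mean-*ˡ l (Δ x) _) (trans (mean-swap l l _) (mean-cong l λ y → trans (mean-cong l λ x → flip x y) (mean-*ˡ l (Δ y) _)))) ⟩
    edges S′ + (mean l (λ x → Δ x * deg S x) + mean l (λ y → Δ y * deg S y))
      ≤⟨ +-monoʳ-≤ (edges S′) (+-mono-≤ (mean-mono l (loss S)) (mean-mono l (loss S))) ⟩
    edges S′ + (mean l (λ x → Δ x * η) + mean l (λ x → Δ x * η))
      ≡⟨ cong (λ z → edges S′ + (z + z)) (trans (mean-*ʳ l η Δ) (cong (_* η) (mean-sub l _ _))) ⟩
    edges S′ + ((size S - size S′) * η + (size S - size S′) * η)
      ≡⟨ lem (edges S′) (size S - size S′) η ⟩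
    edges S′ + (η + η) * (size S - size S′) ∎
    where
    open ≤-Reasoning
    S′ : Fin m → Bool
    S′ = prune S
    Δ : Fin m → ℚ
    Δ x = [ S x ] - [ S′ x ]
    M : ℚ
    M = mean l (λ x → mean l λ y → [ S′ x ] * ([ S′ y ] * A x y))
    lem : ∀ e s η → e + (s * η + s * η) ≡ e + (η + η) * s
    lem = solve-∀ ℚ-ring
    expand : ∀ S S″ → mean l (λ x → [ S x ] * deg S″ x) ≡ mean l (λ x → mean l λ y → [ S x ] * ([ S″ y ] * A x y))
    expand S S″ = mean-cong l λ x → sym (mean-*ˡ l [ S x ] _)
    swap₃ : ∀ a b c → a * (b * c) ≡ b * (a * c)
    swap₃ = solve-∀ ℚ-ring
    flip : ∀ x y → [ S x ] * (Δ y * A x y) ≡ Δ y * ([ S x ] * A y x)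
    flip x y = trans (swap₃ [ S x ] (Δ y) (A x y)) (cong (λ z → Δ y * ([ S x ] * z)) (A-sym x y))
    rearrange : ∀ a a′ b b′ k → a′ * (b′ * k) + ((a - a′) * (b * k) + a * ((b - b′) * k)) ≡ a * (b * k) + (a - a′) * (b - b′) * k
    rearrange = solve-∀ ℚ-ring
    pointwise : ∀ x y → [ S x ] * ([ S y ] * A x y) ≤ [ S′ x ] * ([ S′ y ] * A x y) + (Δ x * ([ S y ] * A x y) + [ S x ] * (Δ y * A x y))
    pointwise x y = ≤-by _ (rearrange [ S x ] [ S′ x ] [ S y ] [ S′ y ] (A x y))
      (*-nonneg (*-nonneg (≤⇒0≤- (prune≤ S x)) (≤⇒0≤- (prune≤ S y))) (proj₁ (A01 x y)))

  prune-potential : ∀ S → Potential S → Potential (prune S)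
  prune-potential S p = ≤-trans p (≤-by _ (lem (edges S) (edges (prune S)) (η + η) (size S) (size (prune S))) (≤⇒0≤- (prune-edges S)))
    where
    lem : ∀ a a′ h s s′ → a′ + h * (1ℚ - s′) ≡ a + h * (1ℚ - s) + (a′ + h * (s - s′) - a)
    lem = solve-∀ ℚ-ring

  Core : Set
  Core = Σ (Fin m → Bool) λ S → (∀ x → S x ≡ true → η ≤ deg S x) × η + η ≤ edges S

  search : ∀ k S → countB S l ℕ.< k → Potential S → Core
  search (suc k) S (s≤s lt) pot with countB-dichotomy S (prune S) (prune-sub S) l
  ... | inj₂ less = search k (prune S) (ℕ.<-≤-trans less lt) (prune-potential S pot)
  ... | inj₁ (stable , _) = S , (λ x Sx → prune-deg S x (stable x (∈-allFin x) Sx)) ,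
    ≤-by _ (lem (edges S) η (size S)) (+-nonneg (≤⇒0≤- pot) (*-nonneg (+-nonneg 0≤η 0≤η) (mean-nonneg l λ x → proj₁ ([]-01 (S x)))))
    where
    lem : ∀ e η s → e ≡ η + η + (e + (η + η) * (1ℚ - s) - (η + η + (η + η)) + (η + η) * s)
    lem = solve-∀ ℚ-ring

  core : η + η + (η + η) ≤ mean l (λ x → mean l (A x)) → Core
  core p = search (suc (countB full l)) full ℕ.≤-refl
    (subst (η + η + (η + η) ≤_) (sym (trans (cong₂ (λ a b → a + (η + η) * (1ℚ - b)) all-edges (mean-const (allFin-nonEmpty 0<m) 1ℚ)) (lem _ η))) p)
    where
    full : Fin m → Bool
    full _ = true
    all-edges : edges full ≡ mean l (λ x → mean l (A x))
    all-edges = mean-cong l λ x → trans (*-identityˡ (deg full x)) (mean-cong l λ y → *-identityˡ (A x y))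
    lem : ∀ a η → a + (η + η) * (1ℚ - 1ℚ) ≡ a
    lem = solve-∀ ℚ-ring

-- walk l K k has k internal vertices, hence length k + 1.

comp : List X → (X → X → ℚ) → (X → X → ℚ) → X → X → ℚ
comp l K L x y = mean l λ z → K x z * L z y

walk : List X → (X → X → ℚ) → ℕ → X → X → ℚ
walk l K zero    = K
walk l K (suc k) = comp l K (walk l K k)

module Walks {X : Set} (l : List X) (ne : NonEmpty l) where

  comp-01 : ∀ {K L : X → X → ℚ} → (∀ x y → In01 (K x y)) → (∀ x y → In01 (L x y)) → ∀ x y → In01 (comp l K L x y)
  comp-01 K01 L01 x y = mean-01 ne λ z → In01-* (K01 x z) (L01 z y)

  walk-01 : ∀ {K : X → X → ℚ} → (∀ x y → In01 (K x y)) → ∀ k x y → In01 (walk l K k x y)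
  walk-01 K01 zero    = K01
  walk-01 K01 (suc k) = comp-01 K01 (walk-01 K01 k)

  walk-mono : ∀ {K L : X → X → ℚ} → (∀ x y → 0ℚ ≤ K x y) → (∀ x y → 0ℚ ≤ L x y) → (∀ x y → K x y ≤ L x y) →
    ∀ k x y → 0ℚ ≤ walk l K k x y × walk l K k x y ≤ walk l L k x y
  walk-mono 0≤K 0≤L K≤L zero    x y = 0≤K x y , K≤L x y
  walk-mono 0≤K 0≤L K≤L (suc k) x y =
    mean-nonneg l (λ z → *-nonneg (0≤K x z) (proj₁ (walk-mono 0≤K 0≤L K≤L k z y))) ,
    mean-mono l λ z → *-mono (0≤K x z) (proj₁ (walk-mono 0≤K 0≤L K≤L k z y)) (K≤L x z) (proj₂ (walk-mono 0≤K 0≤L K≤L k z y))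

  comp-assoc : ∀ (K L M : X → X → ℚ) x y → comp l (comp l K L) M x y ≡ comp l K (comp l L M) x y
  comp-assoc K L M x y = begin
    mean l (λ z → mean l (λ u → K x u * L u z) * M z y)    ≡⟨ mean-cong l (λ z → sym (mean-*ʳ l (M z y) _)) ⟩
    mean l (λ z → mean l λ u → K x u * L u z * M z y)      ≡⟨ mean-swap l l _ ⟩
    mean l (λ u → mean l λ z → K x u * L u z * M z y)      ≡⟨ mean-cong l (λ u → trans (mean-cong l λ z → *-assoc (K x u) (L u z) (M z y)) (mean-*ˡ l (K x u) _)) ⟩
    mean l (λ u → K x u * mean l λ z → L u z * M z y)      ∎
    where open ≡-Reasoning

  -- The vertex where the two walks meet becomes internal, hence the `suc`.
  comp-walk : ∀ (K : X → X → ℚ) i j x y → comp l (walk l K i) (walk l K j) x y ≡ walk l K (suc (i ℕ.+ j)) x y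
  comp-walk K zero    j x y = refl
  comp-walk K (suc i) j x y = trans (comp-assoc K (walk l K i) (walk l K j) x y)
    (mean-cong l λ z → cong (K x z *_) (comp-walk K i j z y))

  walk-sym : ∀ (K : X → X → ℚ) → (∀ x y → K x y ≡ K y x) → ∀ k x y → walk l K k x y ≡ walk l K k y x
  walk-sym K K-sym zero    x y = K-sym x y
  walk-sym K K-sym (suc k) x y = begin
    mean l (λ z → K x z * walk l K k z y)   ≡⟨ mean-cong l (λ z → trans (*-comm (K x z) _) (cong₂ _*_ (walk-sym K K-sym k z y) (K-sym x z))) ⟩
    comp l (walk l K k) (walk l K 0) y x    ≡⟨ comp-walk K k 0 y x ⟩
    walk l K (suc (k ℕ.+ 0)) y x            ≡⟨ cong (λ j → walk l K (suc j) y x) (ℕ.+-identityʳ k) ⟩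
    walk l K (suc k) y x                    ∎
    where open ≡-Reasoning

-- Walk weights inside the subset of large minimum degree.

module CoreWalks {m : ℕ} (0<m : 0 ℕ.< m) (A : Fin m → Fin m → ℚ) (A01 : ∀ x y → In01 (A x y))
  (A-sym : ∀ x y → A x y ≡ A y x) (η : ℚ) (0<η : 0ℚ < η)
  (S : Fin m → Bool) (S-deg : ∀ x → S x ≡ true → η ≤ MinDegree.deg 0<m A A01 A-sym η (<⇒≤ 0<η) S x)
  (S-edges : η + η ≤ MinDegree.edges 0<m A A01 A-sym η (<⇒≤ 0<η) S) where

  open MinDegree 0<m A A01 A-sym η (<⇒≤ 0<η) using (l; deg)
  open Walks l (allFin-nonEmpty 0<m)

  A′ : Fin m → Fin m → ℚ
  A′ x y = [ S x ] * ([ S y ] * A x y)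

  A′01 : ∀ x y → In01 (A′ x y)
  A′01 x y = In01-* ([]-01 (S x)) (In01-* ([]-01 (S y)) (A01 x y))

  A′-sym : ∀ x y → A′ x y ≡ A′ y x
  A′-sym x y = trans (lem [ S x ] [ S y ] (A x y)) (cong (λ z → [ S y ] * ([ S x ] * z)) (A-sym x y))
    where
    lem : ∀ a b c → a * (b * c) ≡ b * (a * c)
    lem = solve-∀ ℚ-ring

  A′≤A : ∀ x y → A′ x y ≤ A x y
  A′≤A x y = ≤-trans (le (S x) (*-nonneg (proj₁ ([]-01 (S y))) (proj₁ (A01 x y)))) (le (S y) (proj₁ (A01 x y)))
    where
    le : ∀ b {a} → 0ℚ ≤ a → [ b ] * a ≤ a
    le b {a} p = subst ([ b ] * a ≤_) (*-identityˡ a) (*-monoʳ p (proj₂ ([]-01 b)))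

  walk≤ : ∀ k x y → walk l A′ k x y ≤ walk l A k x y
  walk≤ k x y = proj₂ (walk-mono (λ x y → proj₁ (A′01 x y)) (λ x y → proj₁ (A01 x y)) A′≤A k x y)

  w : ℕ → Fin m → ℚ
  w k x = mean l (walk l A′ k x)

  w-zero : ∀ x → w 0 x ≡ [ S x ] * deg S x
  w-zero x = mean-*ˡ l [ S x ] _

  w-suc : ∀ k x → w (suc k) x ≡ mean l (λ z → A′ x z * w k z)
  w-suc k x = trans (mean-swap l l _) (mean-cong l λ z → mean-*ˡ l (A′ x z) _)

  w01 : ∀ k x → In01 (w k x)
  w01 k x = mean-01 (allFin-nonEmpty 0<m) (walk-01 A′01 k x)

  w-outside : ∀ k x → S x ≡ false → w k x ≡ 0ℚ
  w-outside zero    x e = trans (w-zero x) (trans (cong (λ b → [ b ] * deg S x) e) (*-zeroˡ (deg S x)))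
  w-outside (suc k) x e = trans (w-suc k x) (trans (mean-cong l λ z →
    trans (cong (λ b → [ b ] * ([ S z ] * A x z) * w k z) e) (lem ([ S z ] * A x z) (w k z))) (mean-0 l))
    where
    lem : ∀ a b → 0ℚ * a * b ≡ 0ℚ
    lem = solve-∀ ℚ-ring

  w-zero-≥ : ∀ x → S x ≡ true → η ≤ w 0 x
  w-zero-≥ x e = subst (η ≤_) (sym (trans (w-zero x) (trans (cong (λ b → [ b ] * deg S x) e) (*-identityˡ (deg S x))))) (S-deg x e)

  -- The first step of a walk from x has at least η of the vertices available, all in S, and each of
  -- them satisfies the bound for k. Vertices outside S contribute 0 on both sides.
  w-inside : ∀ k x → S x ≡ true → η ^ℚ suc k ≤ w k x
  w-inside zero    x e = subst (_≤ w 0 x) (sym (*-identityʳ η)) (w-zero-≥ x e)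
  w-inside (suc k) x e = begin
    η * (η ^ℚ suc k)                           ≤⟨ *-monoʳ (^ℚ-nonneg (suc k) (<⇒≤ 0<η)) (w-zero-≥ x e) ⟩
    mean l (A′ x) * (η ^ℚ suc k)               ≡⟨ mean-*ʳ l (η ^ℚ suc k) (A′ x) ⟨
    mean l (λ z → A′ x z * (η ^ℚ suc k))       ≤⟨ mean-mono l (λ z → pointwise z (S z) refl) ⟩
    mean l (λ z → A′ x z * w k z)              ≡⟨ w-suc k x ⟨
    w (suc k) x                                ∎
    where
    open ≤-Reasoning
    lem : ∀ a b c → a * (0ℚ * b) * c ≡ 0ℚ
    lem = solve-∀ ℚ-ring
    pointwise : ∀ z b → S z ≡ b → A′ x z * (η ^ℚ suc k) ≤ A′ x z * w k z
    pointwise z true  e = *-monoˡ (proj₁ (A′01 x z)) (w-inside k z e)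
    pointwise z false e = ≤-reflexive (trans (zero′ (η ^ℚ suc k)) (sym (zero′ (w k z))))
      where
      zero′ : ∀ c → A′ x z * c ≡ 0ℚ
      zero′ c = trans (cong (λ b → [ S x ] * ([ b ] * A x z) * c) e) (lem [ S x ] (A x z) c)

  w-dichotomy : ∀ k x → w k x ≡ 0ℚ ⊎ η ^ℚ suc k ≤ w k x
  w-dichotomy k x with S x in e
  ... | true  = inj₂ (w-inside k x e)
  ... | false = inj₁ (w-outside k x e)

  -- Averaging the pointwise bound would lose the measure of S, which may be small. Instead the mean
  -- of `w (suc k)` is by symmetry the mean of `w 0 z * w k z`, at least η times that of `w k`; the
  -- base case is the edge bound for S.
  mean-w : ∀ k → η ^ℚ suc k ≤ mean l (w k)
  mean-w zero    = ≤-trans (≤-by η (cong (_+ η) (sym (*-identityʳ η))) (<⇒≤ 0<η))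
    (≤-trans S-edges (≤-reflexive (mean-cong l λ x → sym (w-zero x))))
  mean-w (suc k) = begin
    η * (η ^ℚ suc k)                                  ≤⟨ *-monoˡ (<⇒≤ 0<η) (mean-w k) ⟩
    η * mean l (w k)                                  ≡⟨ mean-*ˡ l η (w k) ⟨
    mean l (λ z → η * w k z)                          ≤⟨ mean-mono l (λ z → pointwise z (S z) refl) ⟩
    mean l (λ z → w 0 z * w k z)                      ≡⟨ mean-cong l (λ z → mean-*ʳ l (w k z) (A′ z)) ⟨
    mean l (λ z → mean l λ x → A′ z x * w k z)        ≡⟨ mean-swap l l _ ⟩
    mean l (λ x → mean l λ z → A′ z x * w k z)        ≡⟨ mean-cong l (λ x → trans (mean-cong l λ z → cong (_* w k z) (A′-sym z x)) (sym (w-suc k x))) ⟩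
    mean l (w (suc k))                                ∎
    where
    open ≤-Reasoning
    pointwise : ∀ z b → S z ≡ b → η * w k z ≤ w 0 z * w k z
    pointwise z true  e = *-monoʳ (proj₁ (w01 k z)) (w-zero-≥ z e)
    pointwise z false e = ≤-reflexive (trans (zero′ η) (sym (zero′ (w 0 z))))
      where
      zero′ : ∀ c → c * w k z ≡ 0ℚ
      zero′ c = trans (cong (c *_) (w-outside k z e)) (*-zeroʳ c)

  -- The distribution of endpoints when starting points carry the weight γ. It is a genuine function
  -- even if γ is an indicator.
  spread : ℕ → (Fin m → ℚ) → Fin m → ℚ
  spread k γ z = mean l λ x → γ x * walk l A′ k x z

  mean-spread : ∀ k γ → mean l (spread k γ) ≡ mean l (λ x → γ x * w k x)
  mean-spread k γ = trans (mean-swap l l _) (mean-cong l λ x → mean-*ˡ l (γ x) _)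

-- Local density of the kernel of even walks.

module EvenWalks (H : Graph) (knrs : KNRS H) {m : ℕ} (0<m : 0 ℕ.< m) (A : Fin m → Fin m → ℚ) (A01 : ∀ x y → In01 (A x y))
  (A-sym : ∀ x y → A x y ≡ A y x) (η : ℚ) (0<η : 0ℚ < η)
  (S : Fin m → Bool) (S-deg : ∀ x → S x ≡ true → η ≤ MinDegree.deg 0<m A A01 A-sym η (<⇒≤ 0<η) S x)
  (S-edges : η + η ≤ MinDegree.edges 0<m A A01 A-sym η (<⇒≤ 0<η) S) (k : ℕ) where

  open CoreWalks 0<m A A01 A-sym η 0<η S S-deg S-edges

  l : List (Fin m)
  l = allFin m

  open Walks l (allFin-nonEmpty 0<m)

  b : Fin m → Fin m → ℚ
  b = walk l A′ k

  L : Fin m → Fin m → ℚ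
  L x y = mean l λ z → b x z * b y z

  L01 : ∀ x y → In01 (L x y)
  L01 x y = mean-01 (allFin-nonEmpty 0<m) λ z → In01-* (walk-01 A′01 k x z) (walk-01 A′01 k y z)

  L≤walk : ∀ x y → L x y ≤ walk l A (suc (k ℕ.+ k)) x y
  L≤walk x y = ≤-trans (mean-mono l λ z → *-mono (proj₁ (walk-01 A′01 k x z)) (proj₁ (walk-01 A′01 k y z)) (walk≤ k x z)
      (≤-trans (walk≤ k y z) (≤-reflexive (walk-sym A A-sym k y z))))
    (≤-reflexive (comp-walk A k k x y))

  -- Splitting a walk at its middle vertex z makes the form of L at γ the mean of the square of
  -- `spread k γ z`, and Cauchy-Schwarz over z finishes: the density is 1.
  L-dense : ∀ γ → 1ℚ * (mean l (λ x → γ x * w k x) * mean l (λ x → γ x * w k x)) ≤ mean l (λ x → mean l λ y → γ x * γ y * L x y)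
  L-dense γ = begin
    1ℚ * (mean l (λ x → γ x * w k x) * mean l (λ x → γ x * w k x))
      ≡⟨ *-identityˡ _ ⟩
    mean l (λ x → γ x * w k x) * mean l (λ x → γ x * w k x)
      ≡⟨ cong (λ z → z * z) (mean-spread k γ) ⟨
    mean l (spread k γ) * mean l (spread k γ)
      ≤⟨ jensen l (spread k γ) ⟩
    mean l (λ z → spread k γ z * spread k γ z)
      ≡⟨ mean-cong l (λ z → mean-×-mean l l (λ x → γ x * b x z) (λ y → γ y * b y z)) ⟨
    mean l (λ z → mean l λ x → mean l λ y → γ x * b x z * (γ y * b y z))
      ≡⟨ trans (mean-swap l l _) (mean-cong l λ x → mean-swap l l _) ⟩
    mean l (λ x → mean l λ y → mean l λ z → γ x * b x z * (γ y * b y z))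
      ≡⟨ mean-cong l (λ x → mean-cong l λ y → trans (mean-cong l λ z → interchange (γ x) (b x z) (γ y) (b y z)) (mean-*ˡ l (γ x * γ y) _)) ⟩
    mean l (λ x → mean l λ y → γ x * γ y * L x y) ∎
    where open ≤-Reasoning

  θ : ℚ
  θ = η ^ℚ suc k

  bound : ½ * ½ * ((½ * (1ℚ * (θ * θ))) ^ℚ e H) ≤ E (n H) (λ _ → l) (hom (edgeList H) (walk l A (suc (k ℕ.+ k))))
  bound = ≤-trans
    (proj₂ (proj₂ (KNRS-weighted H knrs 1ℚ θ (positive⁻¹ 1ℚ) (^ℚ-pos (suc k) 0<η))) 0<m (w k) (w-dichotomy k) (mean-w k) L L01
      (λ x y → mean-cong l λ z → *-comm (b x z) (b y z)) (λ γ _ _ → L-dense γ))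
    (E-mono (n H) (λ _ → l) λ f → ∏-mono (edgeList H) (λ p → proj₁ (L01 (f (proj₁ p)) (f (proj₂ p)))) (λ p → L≤walk (f (proj₁ p)) (f (proj₂ p))))

-- Tensor powers

infixl 7 _⊗_
_⊗_ : (X → X → ℚ) → (Y → Y → ℚ) → X × Y → X × Y → ℚ
(K ⊗ L) (x , y) (x′ , y′) = K x x′ * L y y′

walk-⊗ : ∀ {l : List X} {l′ : List Y} → NonEmpty l → NonEmpty l′ → ∀ K L k p p′ →
  walk (pairs l l′) (K ⊗ L) k p p′ ≡ (walk l K k ⊗ walk l′ L k) p p′
walk-⊗ nl nl′ K L zero    p p′ = refl
walk-⊗ {l = l} {l′} nl nl′ K L (suc k) p@(x , y) p′@(x′ , y′) = begin
  mean (pairs l l′) (λ z → (K ⊗ L) p z * walk (pairs l l′) (K ⊗ L) k z p′)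
    ≡⟨ mean-cong (pairs l l′) (λ z → cong ((K ⊗ L) p z *_) (walk-⊗ nl nl′ K L k z p′)) ⟩
  mean (pairs l l′) (λ z → (K ⊗ L) p z * (walk l K k ⊗ walk l′ L k) z p′)
    ≡⟨ mean-pairs nl nl′ (λ z → (K ⊗ L) p z * (walk l K k ⊗ walk l′ L k) z p′) ⟩
  mean l (λ a → mean l′ λ b → K x a * L y b * (walk l K k a x′ * walk l′ L k b y′))
    ≡⟨ mean-cong l (λ a → mean-cong l′ λ b → interchange (K x a) (L y b) (walk l K k a x′) (walk l′ L k b y′)) ⟩
  mean l (λ a → mean l′ λ b → K x a * walk l K k a x′ * (L y b * walk l′ L k b y′))
    ≡⟨ mean-×-mean l l′ _ _ ⟩
  walk l K (suc k) x x′ * walk l′ L (suc k) y y′ ∎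
  where open ≡-Reasoning

E-pairs : ∀ h {l : List X} {l′ : List Y} → NonEmpty l → NonEmpty l′ → ∀ F G → Extensional F → Extensional G →
  E h (λ _ → pairs l l′) (λ z → F (proj₁ ∘ z) * G (proj₂ ∘ z)) ≡ E h (λ _ → l) F * E h (λ _ → l′) G
E-pairs zero    nl nl′ F G extF extG = cong₂ _*_ (extF _ _ λ ()) (extG _ _ λ ())
E-pairs (suc h) {l} {l′} nl nl′ F G extF extG = begin
  mean (pairs l l′) (λ p → E h (λ _ → pairs l l′) λ z → F (proj₁ ∘ (p ◂ z)) * G (proj₂ ∘ (p ◂ z)))
    ≡⟨ mean-pairs nl nl′ _ ⟩
  mean l (λ a → mean l′ λ b → E h (λ _ → pairs l l′) λ z → F (proj₁ ∘ ((a , b) ◂ z)) * G (proj₂ ∘ ((a , b) ◂ z)))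
    ≡⟨ mean-cong l (λ a → mean-cong l′ λ b → trans
         (E-cong h (λ _ → pairs l l′) λ z → cong₂ _*_ (extF _ _ λ { zero → refl ; (suc i) → refl }) (extG _ _ λ { zero → refl ; (suc i) → refl }))
         (E-pairs h nl nl′ (λ f → F (a ◂ f)) (λ g → G (b ◂ g)) (◂-ext extF a) (◂-ext extG b))) ⟩
  mean l (λ a → mean l′ λ b → E h (λ _ → l) (λ f → F (a ◂ f)) * E h (λ _ → l′) (λ g → G (b ◂ g)))
    ≡⟨ mean-×-mean l l′ _ _ ⟩
  E (suc h) (λ _ → l) F * E (suc h) (λ _ → l′) G ∎
  where open ≡-Reasoning

walk-lookup : ∀ (l : List X) K k i j →
  walk (allFin (length l)) (λ a b → K (List.lookup l a) (List.lookup l b)) k i j ≡ walk l K k (List.lookup l i) (List.lookup l j)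
walk-lookup l K zero    i j = refl
walk-lookup l K (suc k) i j = trans
  (mean-cong (allFin (length l)) λ z → cong (K (List.lookup l i) (List.lookup l z) *_) (walk-lookup l K k z j))
  (mean-lookup l (λ z → K (List.lookup l i) z * walk l K k z (List.lookup l j)))

hom-cong : ∀ {h} (es : List (Fin h × Fin h)) {K L : X → X → ℚ} → (∀ x y → K x y ≡ L x y) → ∀ x → hom es K x ≡ hom es L x
hom-cong es e x = ∏-cong es λ p → e (x (proj₁ p)) (x (proj₂ p))

mean₂ : List X → (X → X → ℚ) → ℚ
mean₂ l K = mean l λ x → mean l (K x)

walkDensity : ∀ {h} → List (Fin h × Fin h) → ℕ → List X → (X → X → ℚ) → ℚ
walkDensity {h = h} es k l K = E h (λ _ → l) (hom es (walk l K k))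

-- Pairs are re-indexed by Fin N so that the square is a kernel of the same kind and can be squared
-- again.
module Square {h : ℕ} (es : List (Fin h × Fin h)) (k : ℕ) {m : ℕ} (0<m : 0 ℕ.< m) (K : Fin m → Fin m → ℚ) where

  l : List (Fin m)
  l = allFin m

  ne : NonEmpty l
  ne = allFin-nonEmpty 0<m

  ps : List (Fin m × Fin m)
  ps = pairs l l

  N : ℕ
  N = length ps

  0<N : 0 ℕ.< N
  0<N = subst (0 ℕ.<_) (sym (trans (length-pairs l l) (cong₂ ℕ._*_ (length-allFin m) (length-allFin m)))) (ℕ.*-mono-< {0} {m} {0} {m} 0<m 0<m)

  K² : Fin N → Fin N → ℚ
  K² a b = (K ⊗ K) (List.lookup ps a) (List.lookup ps b)

  mean₂-K² : mean₂ (allFin N) K² ≡ mean₂ l K * mean₂ l K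
  mean₂-K² = begin
    mean (allFin N) (λ a → mean (allFin N) (K² a))
      ≡⟨ trans (mean-cong (allFin N) λ a → mean-lookup ps ((K ⊗ K) (List.lookup ps a))) (mean-lookup ps (λ p → mean ps ((K ⊗ K) p))) ⟩
    mean ps (λ p → mean ps ((K ⊗ K) p))
      ≡⟨ trans (mean-pairs ne ne _) (mean-cong l λ x → mean-cong l λ y → trans (mean-pairs ne ne _) (mean-×-mean l l (K x) (K y))) ⟩
    mean l (λ x → mean l λ y → mean l (K x) * mean l (K y))
      ≡⟨ mean-×-mean l l _ _ ⟩
    mean₂ l K * mean₂ l K ∎
    where open ≡-Reasoning

  walkDensity-K² : walkDensity es k (allFin N) K² ≡ walkDensity es k l K * walkDensity es k l K
  walkDensity-K² = begin
    E h (λ _ → allFin N) (hom es (walk (allFin N) K² k))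
      ≡⟨ E-cong h (λ _ → allFin N) (hom-cong es (walk-lookup ps (K ⊗ K) k)) ⟩
    E h (λ _ → allFin N) (λ f → hom es (walk ps (K ⊗ K) k) (List.lookup ps ∘ f))
      ≡⟨ E-map h (λ _ → allFin N) (λ _ → ps) (List.lookup ps) (λ _ G → mean-lookup ps G) _ (hom-ext es (walk ps (K ⊗ K) k)) ⟩
    E h (λ _ → ps) (hom es (walk ps (K ⊗ K) k))
      ≡⟨ E-cong h (λ _ → ps) (λ z → trans (hom-cong es (walk-⊗ ne ne K K k) z) (∏-* es _ _)) ⟩
    E h (λ _ → ps) (λ z → hom es (walk l K k) (proj₁ ∘ z) * hom es (walk l K k) (proj₂ ∘ z))
      ≡⟨ E-pairs h ne ne _ _ (hom-ext es (walk l K k)) (hom-ext es (walk l K k)) ⟩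
    walkDensity es k l K * walkDensity es k l K ∎
    where open ≡-Reasoning

½^≤ : ∀ j → ½ ^ℚ j ≤ inv (ℕ→ℚ (suc j))
½^≤ j = *-cancelˡ (ℕ→ℚ-pos {suc j} (s≤s z≤n)) (subst (ℕ→ℚ (suc j) * (½ ^ℚ j) ≤_) (sym (*-inv (ℕ→ℚ-pos {suc j} (s≤s z≤n)))) (go j))
  where
  go : ∀ j → ℕ→ℚ (suc j) * (½ ^ℚ j) ≤ 1ℚ
  go zero    = ≤-refl
  go (suc j) = subst (λ z → z * (½ * (½ ^ℚ j)) ≤ 1ℚ) (sym (ℕ→ℚ-suc (suc j)))
    (≤-by _ (lem (ℕ→ℚ (suc j)) (½ ^ℚ j)) (*-nonneg 0≤½ (+-nonneg (≤⇒0≤- (go j)) (≤⇒0≤- (proj₂ (^ℚ-01 j In01-½))))))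
    where
    lem : ∀ n p → 1ℚ ≡ (1ℚ + n) * (½ * p) + ½ * (1ℚ - n * p + (1ℚ - p))
    lem = solve-∀ ℚ-ring

-- If a exceeded b, some j would have x * ½^j ≤ ½ * (a - b); as b ≤ 1 the hypothesis would then give
-- a - b ≤ ½ * (a - b).
≤-limit : ∀ {a b x} → 0ℚ ≤ b → b ≤ 1ℚ → 0ℚ < x → (∀ j → a ≤ (1ℚ + x * (½ ^ℚ j)) * b) → a ≤ b
≤-limit {a} {b} {x} 0≤b b≤1 0<x H with a ≤? b
... | yes p = p
... | no ¬p = ⊥-elim (<-irrefl refl (<-≤-trans half< a-b≤))
  where
  δ : ℚ
  δ = a - b
  0<δ : 0ℚ < δ
  0<δ = subst (_< δ) (+-inverseʳ b) (+-monoˡ-< (- b) (≰⇒> ¬p))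
  S : Σ ℕ λ S → ∀ s → S ℕ.≤ s → inv (ℕ→ℚ (suc s)) ≤ inv x * (½ * δ)
  S = small-inv (*-pos (inv-pos 0<x) (*-pos 0<½ 0<δ))
  j : ℕ
  j = proj₁ S
  a-b≤ : δ ≤ ½ * δ
  a-b≤ = begin
    a - b                                     ≤⟨ +-monoˡ-≤ (- b) (H j) ⟩
    (1ℚ + x * (½ ^ℚ j)) * b - b               ≡⟨ lem x (½ ^ℚ j) b ⟩
    x * (½ ^ℚ j) * b                          ≤⟨ *-monoˡ (*-nonneg (<⇒≤ 0<x) (^ℚ-nonneg j 0≤½)) b≤1 ⟩
    x * (½ ^ℚ j) * 1ℚ                         ≡⟨ *-identityʳ _ ⟩
    x * (½ ^ℚ j)                              ≤⟨ *-monoˡ (<⇒≤ 0<x) (≤-trans (½^≤ j) (proj₂ S j ℕ.≤-refl)) ⟩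
    x * (inv x * (½ * δ))                     ≡⟨ *-assoc x (inv x) (½ * δ) ⟨
    x * inv x * (½ * δ)                       ≡⟨ trans (cong (_* (½ * δ)) (*-inv 0<x)) (*-identityˡ (½ * δ)) ⟩
    ½ * δ ∎
    where
    open ≤-Reasoning
    lem : ∀ x p b → (1ℚ + x * p) * b - b ≡ x * p * b
    lem = solve-∀ ℚ-ring
  half< : ½ * δ < δ
  half< = subst (½ * δ <_) (lem δ) (subst (_< ½ * δ + ½ * δ) (+-identityʳ (½ * δ)) (+-monoʳ-< (½ * δ) (*-pos 0<½ 0<δ)))
    where
    lem : ∀ d → ½ * d + ½ * d ≡ d
    lem = solve-∀ ℚ-ring

-- Squaring the kernel squares both sides, so a factor 1 + x can be improved to 1 + x / 2.
module TensorTrick {h : ℕ} (es : List (Fin h × Fin h)) (k E₀ : ℕ) {x : ℚ} (0<x : 0ℚ < x)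
  (bound : ∀ {m} → 0 ℕ.< m → (K : Fin m → Fin m → ℚ) → (∀ a b → In01 (K a b)) → (∀ a b → K a b ≡ K b a) →
    0ℚ < mean₂ (allFin m) K → mean₂ (allFin m) K ^ℚ E₀ ≤ (1ℚ + x) * walkDensity es k (allFin m) K) where

  improved : ∀ j {m} → 0 ℕ.< m → (K : Fin m → Fin m → ℚ) → (∀ a b → In01 (K a b)) → (∀ a b → K a b ≡ K b a) →
    0ℚ < mean₂ (allFin m) K → mean₂ (allFin m) K ^ℚ E₀ ≤ (1ℚ + x * (½ ^ℚ j)) * walkDensity es k (allFin m) K
  improved zero    {m} 0<m K K01 K-sym 0<p = subst (λ z → mean₂ (allFin m) K ^ℚ E₀ ≤ (1ℚ + z) * walkDensity es k (allFin m) K)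
    (sym (*-identityʳ x)) (bound 0<m K K01 K-sym 0<p)
  improved (suc j) {m} 0<m K K01 K-sym 0<p = sq-≤⇒≤ (*-nonneg (+-nonneg 0≤1 (*-nonneg (<⇒≤ 0<x) (^ℚ-nonneg (suc j) 0≤½))) 0≤τ) (begin
    (p ^ℚ E₀) * (p ^ℚ E₀)
      ≡⟨ ^ℚ-distrib-* p p E₀ ⟨
    (p * p) ^ℚ E₀
      ≡⟨ cong (_^ℚ E₀) Sq.mean₂-K² ⟨
    mean₂ (allFin Sq.N) Sq.K² ^ℚ E₀
      ≤⟨ improved j Sq.0<N Sq.K² (λ a b → In01-* (K01 _ _) (K01 _ _)) (λ a b → cong₂ _*_ (K-sym _ _) (K-sym _ _))
           (subst (0ℚ <_) (sym Sq.mean₂-K²) (*-pos 0<p 0<p)) ⟩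
    (1ℚ + x * y) * walkDensity es k (allFin Sq.N) Sq.K²
      ≡⟨ cong ((1ℚ + x * y) *_) Sq.walkDensity-K² ⟩
    (1ℚ + x * y) * (τ * τ)
      -- The square of 1 + xy/2 exceeds 1 + xy by the square of xy/2.
      ≤⟨ ≤-by ((x * (½ * y) * τ) * (x * (½ * y) * τ)) (lem x y τ) (sq-nonneg (x * (½ * y) * τ)) ⟩
    (1ℚ + x * (½ * y)) * τ * ((1ℚ + x * (½ * y)) * τ) ∎)
    where
    open ≤-Reasoning
    module Sq = Square es k 0<m K
    p τ y : ℚ
    p = mean₂ (allFin m) K
    τ = walkDensity es k (allFin m) K
    y = ½ ^ℚ j
    0≤τ : 0ℚ ≤ τ
    0≤τ = E-nonneg h (λ _ → allFin m) λ f → ∏-nonneg es λ q → proj₁ (Walks.walk-01 (allFin m) (allFin-nonEmpty 0<m) K01 k _ _)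
    lem : ∀ x y τ → (1ℚ + x * (½ * y)) * τ * ((1ℚ + x * (½ * y)) * τ) ≡ (1ℚ + x * y) * (τ * τ) + (x * (½ * y) * τ) * (x * (½ * y) * τ)
    lem = solve-∀ ℚ-ring

  exact : ∀ {m} → 0 ℕ.< m → (K : Fin m → Fin m → ℚ) → (∀ a b → In01 (K a b)) → (∀ a b → K a b ≡ K b a) →
    0ℚ < mean₂ (allFin m) K → mean₂ (allFin m) K ^ℚ E₀ ≤ walkDensity es k (allFin m) K
  exact {m} 0<m K K01 K-sym 0<p = ≤-limit (E-nonneg h (λ _ → allFin m) λ f → proj₁ (h01 f))
    (subst (walkDensity es k (allFin m) K ≤_) (E-const h (λ _ → allFin m) (λ _ → allFin-nonEmpty 0<m) 1ℚ) (E-mono h (λ _ → allFin m) λ f → proj₂ (h01 f)))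
    0<x (λ j → improved j 0<m K K01 K-sym 0<p)
    where
    h01 : ∀ f → In01 (hom es (walk (allFin m) K k) f)
    h01 f = ∏-01 es λ q → Walks.walk-01 (allFin m) (allFin-nonEmpty 0<m) K01 k _ _

four-quarters : ∀ p → ½ * ½ * p + ½ * ½ * p + (½ * ½ * p + ½ * ½ * p) ≡ p
four-quarters = solve-∀ ℚ-ring

-- Walks of even length: from a constant factor to the sharp bound.

module EvenSubdivision (H : Graph) (knrs : KNRS H) (k : ℕ) where

  -- For η = p / 4 and θ = η ^ suc k, the density ½ * (θ * θ) passed through KNRS equals κ *
  -- p^(2k+2). Neither constant involves p.
  κ C : ℚ
  κ = ½ * ((½ * ½) ^ℚ suc k * ((½ * ½) ^ℚ suc k))
  C = ½ * ½ * (κ ^ℚ e H)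

  0<C : 0ℚ < C
  0<C = *-pos (*-pos 0<½ 0<½) (^ℚ-pos (e H) (*-pos 0<½ (*-pos (^ℚ-pos (suc k) (*-pos 0<½ 0<½)) (^ℚ-pos (suc k) (*-pos 0<½ 0<½)))))

  E₀ : ℕ
  E₀ = e H ℕ.* (suc k ℕ.+ suc k)

  j : ℕ
  j = suc (k ℕ.+ k)

  weak : ∀ {m} → 0 ℕ.< m → (K : Fin m → Fin m → ℚ) → (∀ a b → In01 (K a b)) → (∀ a b → K a b ≡ K b a) →
    0ℚ < mean₂ (allFin m) K → C * (mean₂ (allFin m) K ^ℚ E₀) ≤ walkDensity (edgeList H) j (allFin m) K
  weak {m} 0<m K K01 K-sym 0<p = subst (_≤ walkDensity (edgeList H) j (allFin m) K) eq
    (EvenWalks.bound H knrs 0<m K K01 K-sym η 0<η (proj₁ c) (proj₁ (proj₂ c)) (proj₂ (proj₂ c)) k)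
    where
    p η : ℚ
    p = mean₂ (allFin m) K
    η = ½ * ½ * p
    0<η : 0ℚ < η
    0<η = *-pos (*-pos 0<½ 0<½) 0<p
    c = MinDegree.core 0<m K K01 K-sym η (<⇒≤ 0<η) (≤-reflexive (four-quarters p))
    rearrange : ∀ a b → ½ * (1ℚ * (a * b * (a * b))) ≡ ½ * (a * a) * (b * b)
    rearrange = solve-∀ ℚ-ring
    open ≡-Reasoning
    eq : ½ * ½ * ((½ * (1ℚ * (η ^ℚ suc k * (η ^ℚ suc k)))) ^ℚ e H) ≡ C * (p ^ℚ E₀)
    eq = begin
      ½ * ½ * ((½ * (1ℚ * (η ^ℚ suc k * (η ^ℚ suc k)))) ^ℚ e H)
        ≡⟨ cong (λ z → ½ * ½ * ((½ * (1ℚ * (z * z))) ^ℚ e H)) (^ℚ-distrib-* (½ * ½) p (suc k)) ⟩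
      ½ * ½ * ((½ * (1ℚ * ((½ * ½) ^ℚ suc k * (p ^ℚ suc k) * ((½ * ½) ^ℚ suc k * (p ^ℚ suc k))))) ^ℚ e H)
        ≡⟨ cong (λ z → ½ * ½ * (z ^ℚ e H)) (rearrange ((½ * ½) ^ℚ suc k) (p ^ℚ suc k)) ⟩
      ½ * ½ * ((κ * (p ^ℚ suc k * (p ^ℚ suc k))) ^ℚ e H)
        ≡⟨ cong (λ z → ½ * ½ * ((κ * z) ^ℚ e H)) (^ℚ-+ p (suc k) (suc k)) ⟨
      ½ * ½ * ((κ * (p ^ℚ (suc k ℕ.+ suc k))) ^ℚ e H)
        ≡⟨ cong (½ * ½ *_) (^ℚ-distrib-* κ (p ^ℚ (suc k ℕ.+ suc k)) (e H)) ⟩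
      ½ * ½ * (κ ^ℚ e H * ((p ^ℚ (suc k ℕ.+ suc k)) ^ℚ e H))
        ≡⟨ *-assoc (½ * ½) (κ ^ℚ e H) ((p ^ℚ (suc k ℕ.+ suc k)) ^ℚ e H) ⟨
      C * ((p ^ℚ (suc k ℕ.+ suc k)) ^ℚ e H)
        ≡⟨ cong (C *_) (^ℚ-* p (e H) (suc k ℕ.+ suc k)) ⟨
      C * (p ^ℚ E₀) ∎

  -- The loss 1 / C is put into the form 1 + x with x = 1 / C, at the cost of an extra nonnegative
  -- term.
  weak′ : ∀ {m} → 0 ℕ.< m → (K : Fin m → Fin m → ℚ) → (∀ a b → In01 (K a b)) → (∀ a b → K a b ≡ K b a) →
    0ℚ < mean₂ (allFin m) K → mean₂ (allFin m) K ^ℚ E₀ ≤ (1ℚ + inv C) * walkDensity (edgeList H) j (allFin m) K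
  weak′ {m} 0<m K K01 K-sym 0<p = ≤-by _ (lem C (inv C) P τ)
    (+-nonneg (+-nonneg 0≤τ (*-nonneg (<⇒≤ (inv-pos 0<C)) (≤⇒0≤- (weak 0<m K K01 K-sym 0<p))))
      (≤-reflexive (sym (trans (cong (λ z → (z - 1ℚ) * P) (*-inv 0<C)) (*-zeroˡ P)))))
    where
    P τ : ℚ
    P = mean₂ (allFin m) K ^ℚ E₀
    τ = walkDensity (edgeList H) j (allFin m) K
    lem : ∀ C i P τ → (1ℚ + i) * τ ≡ P + (τ + i * (τ - C * P) + (C * i - 1ℚ) * P)
    lem = solve-∀ ℚ-ring
    0≤τ : 0ℚ ≤ τ
    0≤τ = E-nonneg (n H) (λ _ → allFin m) λ f → ∏-nonneg (edgeList H) λ q → proj₁ (Walks.walk-01 (allFin m) (allFin-nonEmpty 0<m) K01 j _ _)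

  sharp : ∀ {m} → 0 ℕ.< m → (K : Fin m → Fin m → ℚ) → (∀ a b → In01 (K a b)) → (∀ a b → K a b ≡ K b a) →
    mean₂ (allFin m) K ^ℚ E₀ ≤ walkDensity (edgeList H) j (allFin m) K
  sharp {m} 0<m K K01 K-sym = go (0ℚ <? p)
    where
    p : ℚ
    p = mean₂ (allFin m) K
    -- Density zero is excluded from the tensor trick. The power of zero is 0 if H has an edge;
    -- without edges both sides are 1.
    zero-power : ∀ es → 0ℚ ^ℚ length es ≤ walkDensity es j (allFin m) K
    zero-power []       = ≤-reflexive (sym (E-const (n H) (λ _ → allFin m) (λ _ → allFin-nonEmpty 0<m) 1ℚ))
    zero-power (q ∷ es) = subst (_≤ walkDensity (q ∷ es) j (allFin m) K) (sym (*-zeroˡ (0ℚ ^ℚ length es)))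
      (E-nonneg (n H) (λ _ → allFin m) λ f → ∏-nonneg (q ∷ es) λ q → proj₁ (Walks.walk-01 (allFin m) (allFin-nonEmpty 0<m) K01 j _ _))
    go : Dec (0ℚ < p) → p ^ℚ E₀ ≤ walkDensity (edgeList H) j (allFin m) K
    go (yes 0<p) = TensorTrick.exact (edgeList H) j E₀ (inv-pos 0<C) weak′ 0<m K K01 K-sym 0<p
    go (no ¬0<p) = subst (_≤ walkDensity (edgeList H) j (allFin m) K) (sym eq) (zero-power (edgeList H))
      where
      p≡0 : p ≡ 0ℚ
      p≡0 = ≤-antisym (≮⇒≥ ¬0<p) (mean-nonneg (allFin m) λ a → mean-nonneg (allFin m) λ b → proj₁ (K01 a b))
      eq : p ^ℚ E₀ ≡ 0ℚ ^ℚ e H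
      eq = trans (^ℚ-* p (e H) (suc k ℕ.+ suc k)) (cong (_^ℚ e H) (trans (cong (_* (p ^ℚ (k ℕ.+ suc k))) p≡0) (*-zeroˡ (p ^ℚ (k ℕ.+ suc k)))))

-- From subsets to weight functions: round a weight function randomly to a subset.

coin : ∀ {a} → In01 a → Σ (List Bool) λ l → NonEmpty l × mean l [_] ≡ a
coin {a} (0≤a , a≤1) = proj₁ w , proj₁ (proj₂ w) , trans (proj₂ (proj₂ w) [_]) (trans (mean-def flips _) (value a))
  where
  flips : List Bool
  flips = true ∷ false ∷ []
  -- Density relative to the fair two-point measure, hence twice the probabilities a and 1 - a.
  f : Bool → ℚ
  f true  = a + a
  f false = (1ℚ - a) + (1ℚ - a)
  0≤f : ∀ b → 0ℚ ≤ f b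
  0≤f true  = +-nonneg 0≤a 0≤a
  0≤f false = +-nonneg (≤⇒0≤- a≤1) (≤⇒0≤- a≤1)
  value : ∀ a → ½ * ((a + a) * 1ℚ + (((1ℚ - a) + (1ℚ - a)) * 0ℚ + 0ℚ)) ≡ a
  value = solve-∀ ℚ-ring
  mass : ∀ a → ½ * (a + a + ((1ℚ - a) + (1ℚ - a) + 0ℚ)) ≡ 1ℚ
  mass = solve-∀ ℚ-ring
  w = weighted {l = flips} nonEmpty f 0≤f (trans (mean-def flips f) (mass a))

module Rounding (G : Graph) (pos : 0 ℕ.< n G) {ρ d : ℚ} (0<ρ : 0ℚ < ρ) (0≤d : 0ℚ ≤ d) (dense : Dense ρ d G) where

  l : List (Fin (n G))
  l = allFin (n G)

  β : (Fin (n G) → ℚ) → ℚ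
  β φ = mean l λ a → mean l λ b → φ a * φ b * adjℚ G a b

  -- Subtracting ρ * ρ extends the density condition to all sets: below measure ρ the left side is
  -- at most 0. A randomly rounded set may well be that small.
  subset-bound : ∀ (χ : Fin (n G) → Bool) → d * (mean l ([_] ∘ χ) * mean l ([_] ∘ χ) - ρ * ρ) ≤ β ([_] ∘ χ)
  subset-bound χ = Sum.[ small , large ]′ (≤-total α ρ)
    where
    α : ℚ
    α = mean l ([_] ∘ χ)
    0≤α : 0ℚ ≤ α
    0≤α = mean-nonneg l λ a → proj₁ ([]-01 (χ a))
    large-lem : ∀ d s r → d * s ≡ d * (s - r * r) + d * (r * r)
    large-lem = solve-∀ ℚ-ring
    large : ρ ≤ α → d * (α * α - ρ * ρ) ≤ β ([_] ∘ χ)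
    large p = ≤-trans (≤-by (d * (ρ * ρ)) (large-lem d (α * α) ρ) (*-nonneg 0≤d (sq-nonneg ρ))) (Dense-elim G pos {ρ} {d} dense χ p)
    small-lem : ∀ d s r → 0ℚ ≡ d * (s - r) + d * (r - s)
    small-lem = solve-∀ ℚ-ring
    small : α ≤ ρ → d * (α * α - ρ * ρ) ≤ β ([_] ∘ χ)
    small α≤ρ = ≤-trans (≤-by (d * (ρ * ρ - α * α)) (small-lem d (α * α) (ρ * ρ)) (*-nonneg 0≤d (≤⇒0≤- (*-mono 0≤α 0≤α α≤ρ α≤ρ))))
      (mean-nonneg l λ a → mean-nonneg l λ b → *-nonneg (*-nonneg (proj₁ ([]-01 (χ a))) (proj₁ ([]-01 (χ b)))) (proj₁ ([]-01 (adj G a b))))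

  module _ (φ : Fin (n G) → ℚ) (φ01 : ∀ a → In01 (φ a)) where

    ls : Fin (n G) → List Bool
    ls v = proj₁ (coin (φ01 v))

    ne : ∀ v → NonEmpty (ls v)
    ne v = proj₁ (proj₂ (coin (φ01 v)))

    ls-mean : ∀ v → mean (ls v) [_] ≡ φ v
    ls-mean v = proj₂ (proj₂ (coin (φ01 v)))

    𝔼 : ((Fin (n G) → Bool) → ℚ) → ℚ
    𝔼 = E (n G) ls

    𝔼-const : ∀ c → 𝔼 (λ _ → c) ≡ c
    𝔼-const = E-const (n G) ls ne

    𝔼-single : ∀ u → 𝔼 (λ χ → [ χ u ]) ≡ φ u
    𝔼-single u = trans (E-resample ls ne u _ λ f g e → cong [_] (e u))
      (trans (E-cong (n G) ls λ χ → trans (mean-cong (ls u) λ a → cong [_] (upd-same u a χ)) (ls-mean u)) (𝔼-const (φ u)))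

    -- Independent coins for u ≢ v. On the diagonal the expectation of the square would be φ u
    -- instead of φ u * φ u, but there the adjacency is 0.
    𝔼-pair : ∀ u v → 𝔼 (λ χ → [ χ u ] * [ χ v ] * adjℚ G u v) ≡ φ u * φ v * adjℚ G u v
    𝔼-pair u v = go (u Fin.≟ v)
      where
      Goal : Fin (n G) → Set
      Goal v = 𝔼 (λ χ → [ χ u ] * [ χ v ] * adjℚ G u v) ≡ φ u * φ v * adjℚ G u v
      vanish : ∀ c → c * adjℚ G u u ≡ 0ℚ
      vanish c = trans (cong (λ b → c * [ b ]) (adj-irrefl G u)) (*-zeroʳ c)
      pointwise : u ≢ v → ∀ χ → mean (ls u) (λ a → mean (ls v) λ b →
        [ upd v b (upd u a χ) u ] * [ upd v b (upd u a χ) v ] * adjℚ G u v) ≡ φ u * φ v * adjℚ G u v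
      pointwise u≢v χ = begin
        mean (ls u) (λ a → mean (ls v) λ b → [ upd v b (upd u a χ) u ] * [ upd v b (upd u a χ) v ] * adjℚ G u v)
          ≡⟨ mean-cong (ls u) (λ a → mean-cong (ls v) λ b → cong₂ (λ a b → [ a ] * [ b ] * adjℚ G u v)
               (trans (upd-other v b (upd u a χ) u≢v) (upd-same u a χ)) (upd-same v b (upd u a χ))) ⟩
        mean (ls u) (λ a → mean (ls v) λ b → [ a ] * [ b ] * adjℚ G u v)
          ≡⟨ trans (mean-cong (ls u) λ a → mean-*ʳ (ls v) (adjℚ G u v) _) (mean-*ʳ (ls u) (adjℚ G u v) _) ⟩
        mean (ls u) (λ a → mean (ls v) λ b → [ a ] * [ b ]) * adjℚ G u v
          ≡⟨ cong (_* adjℚ G u v) (trans (mean-×-mean (ls u) (ls v) [_] [_]) (cong₂ _*_ (ls-mean u) (ls-mean v))) ⟩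
        φ u * φ v * adjℚ G u v ∎
        where open ≡-Reasoning
      go : Dec (u ≡ v) → Goal v
      go (yes u≡v) = subst Goal u≡v (trans (E-cong (n G) ls λ χ → vanish ([ χ u ] * [ χ u ])) (trans (𝔼-const 0ℚ) (sym (vanish (φ u * φ u)))))
      go (no u≢v)  = trans (E-resample₂ ls ne u v _ λ f g e → cong₂ (λ a b → [ a ] * [ b ] * adjℚ G u v) (e u) (e v))
        (trans (E-cong (n G) ls (pointwise u≢v)) (𝔼-const _))

    -- The edge form has the right expectation, and the squared measure of the random set has
    -- expectation at least the square of its mean, so averaging `subset-bound` goes the right way.
    rounding : d * (mean l φ * mean l φ - ρ * ρ) ≤ β φ
    rounding = begin
      d * (mean l φ * mean l φ - ρ * ρ)
        ≡⟨ cong (λ z → d * (z * z - ρ * ρ)) (sym (trans (E-mean-swap (n G) ls l _) (mean-cong l 𝔼-single))) ⟩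
      d * (𝔼 α * 𝔼 α - ρ * ρ)
        ≤⟨ *-monoˡ 0≤d (+-monoˡ-≤ (- (ρ * ρ)) (E-jensen (n G) ls α)) ⟩
      d * (𝔼 (λ χ → α χ * α χ) - ρ * ρ)
        ≡⟨ cong (λ z → d * (𝔼 (λ χ → α χ * α χ) + z)) (𝔼-const (- (ρ * ρ))) ⟨
      d * (𝔼 (λ χ → α χ * α χ) + 𝔼 (λ _ → - (ρ * ρ)))
        ≡⟨ cong (d *_) (E-+ (n G) ls _ _) ⟨
      d * 𝔼 (λ χ → α χ * α χ - ρ * ρ)
        ≡⟨ E-*ˡ (n G) ls d _ ⟨
      𝔼 (λ χ → d * (α χ * α χ - ρ * ρ))
        ≤⟨ E-mono (n G) ls subset-bound ⟩
      𝔼 (λ χ → β ([_] ∘ χ))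
        ≡⟨ trans (E-mean-swap (n G) ls l _) (mean-cong l λ a → trans (E-mean-swap (n G) ls l _) (mean-cong l λ b → 𝔼-pair a b)) ⟩
      β φ ∎
      where
      open ≤-Reasoning
      α : (Fin (n G) → Bool) → ℚ
      α χ = mean l ([_] ∘ χ)

adj-01 : ∀ G a b → In01 (adjℚ G a b)
adj-01 G a b = []-01 (adj G a b)

adjℚ-sym : ∀ G a b → adjℚ G a b ≡ adjℚ G b a
adjℚ-sym G a b = cong [_] (adj-sym G a b)

-- Local density of the kernel of odd walks.

module OddWalks {m : ℕ} (0<m : 0 ℕ.< m) (A : Fin m → Fin m → ℚ) (A01 : ∀ x y → In01 (A x y))
  (A-sym : ∀ x y → A x y ≡ A y x) (η : ℚ) (0<η : 0ℚ < η)
  (S : Fin m → Bool) (S-deg : ∀ x → S x ≡ true → η ≤ MinDegree.deg 0<m A A01 A-sym η (<⇒≤ 0<η) S x)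
  (S-edges : η + η ≤ MinDegree.edges 0<m A A01 A-sym η (<⇒≤ 0<η) S) (k : ℕ) where

  open CoreWalks 0<m A A01 A-sym η 0<η S S-deg S-edges public

  l : List (Fin m)
  l = allFin m

  open Walks l (allFin-nonEmpty 0<m)

  b : Fin m → Fin m → ℚ
  b = walk l A′ k

  -- The two outer walks stay in the core, but the middle edge is taken in A, since the density
  -- hypothesis concerns all of G.
  L : Fin m → Fin m → ℚ
  L x y = mean l λ z → mean l λ z′ → b x z * b y z′ * A z z′

  L01 : ∀ x y → In01 (L x y)
  L01 x y = mean-01 (allFin-nonEmpty 0<m) λ z → mean-01 (allFin-nonEmpty 0<m) λ z′ →
    In01-* (In01-* (walk-01 A′01 k x z) (walk-01 A′01 k y z′)) (A01 z z′)

  L-sym : ∀ x y → L x y ≡ L y x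
  L-sym x y = trans (mean-swap l l _) (mean-cong l λ z → mean-cong l λ z′ → cong₂ _*_ (*-comm (b x z′) (b y z)) (A-sym z′ z))

  L≤walk : ∀ x y → L x y ≤ walk l A (suc (k ℕ.+ suc k)) x y
  L≤walk x y = begin
    mean l (λ z → mean l λ z′ → b x z * b y z′ * A z z′)
      ≤⟨ mean-mono l (λ z → mean-mono l λ z′ → *-monoʳ (proj₁ (A01 z z′)) (*-mono (proj₁ (walk-01 A′01 k x z)) (proj₁ (walk-01 A′01 k y z′)) (walk≤ k x z)
           (≤-trans (walk≤ k y z′) (≤-reflexive (walk-sym A A-sym k y z′))))) ⟩
    mean l (λ z → mean l λ z′ → walk l A k x z * walk l A k z′ y * A z z′)
      ≡⟨ mean-cong l (λ z → trans (mean-cong l λ z′ → lem (walk l A k x z) (walk l A k z′ y) (A z z′)) (mean-*ˡ l (walk l A k x z) _)) ⟩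
    comp l (walk l A k) (walk l A (suc k)) x y
      ≡⟨ comp-walk A k (suc k) x y ⟩
    walk l A (suc (k ℕ.+ suc k)) x y ∎
    where
    open ≤-Reasoning
    lem : ∀ a b c → a * b * c ≡ a * (c * b)
    lem = solve-∀ ℚ-ring

  L-form : ∀ γ → mean l (λ z → mean l λ z′ → spread k γ z * spread k γ z′ * A z z′) ≡ mean l (λ x → mean l λ y → γ x * γ y * L x y)
  L-form γ = begin
    mean l (λ z → mean l λ z′ → spread k γ z * spread k γ z′ * A z z′)
      ≡⟨ mean-cong l (λ z → mean-cong l λ z′ → trans (cong (_* A z z′) (sym (mean-×-mean l l _ _)))
           (trans (sym (mean-*ʳ l (A z z′) _)) (mean-cong l λ x → sym (mean-*ʳ l (A z z′) _)))) ⟩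
    mean l (λ z → mean l λ z′ → mean l λ x → mean l λ y → γ x * b x z * (γ y * b y z′) * A z z′)
      ≡⟨ mean-cong l (λ z → trans (mean-swap l l _) (mean-cong l λ x → mean-swap l l _)) ⟩
    mean l (λ z → mean l λ x → mean l λ y → mean l λ z′ → γ x * b x z * (γ y * b y z′) * A z z′)
      ≡⟨ trans (mean-swap l l _) (mean-cong l λ x → mean-swap l l _) ⟩
    mean l (λ x → mean l λ y → mean l λ z → mean l λ z′ → γ x * b x z * (γ y * b y z′) * A z z′)
      ≡⟨ mean-cong l (λ x → mean-cong l λ y → trans (mean-cong l λ z → trans (mean-cong l λ z′ → lem (γ x) (b x z) (γ y) (b y z′) (A z z′)) (mean-*ˡ l (γ x * γ y) _)) (mean-*ˡ l (γ x * γ y) _)) ⟩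
    mean l (λ x → mean l λ y → γ x * γ y * L x y) ∎
    where
    open ≡-Reasoning
    lem : ∀ g a g′ a′ c → g * a * (g′ * a′) * c ≡ g * g′ * (a * a′ * c)
    lem = solve-∀ ℚ-ring

  spread01 : ∀ γ → (∀ x → In01 (γ x)) → ∀ z → In01 (spread k γ z)
  spread01 γ γ01 z = mean-01 (allFin-nonEmpty 0<m) λ x → In01-* (γ01 x) (walk-01 A′01 k x z)

positive-below-1 : ∀ {a} → 0ℚ < a → Σ ℚ λ ρ → 0ℚ < ρ × ρ ≤ 1ℚ × ρ ≤ a
positive-below-1 {a} 0<a with ≤-total 1ℚ a
... | inj₁ 1≤a = 1ℚ , positive⁻¹ 1ℚ , ≤-refl , 1≤a
... | inj₂ a≤1 = a , 0<a , a≤1 , ≤-refl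

-- Walks of odd length: the bound up to a constant factor.

module OddSubdivision (H : Graph) (knrs : KNRS H) (k : ℕ) where

  -- Compared with the even case κ has a second factor ½: rounding preserves only half of the
  -- density d of the middle edge.
  κ C : ℚ
  κ = ½ * ½ * ((½ * ½) ^ℚ suc k * ((½ * ½) ^ℚ suc k))
  C = ½ * ½ * (κ ^ℚ e H)

  0<¼ : 0ℚ < ½ * ½
  0<¼ = *-pos 0<½ 0<½

  0<C : 0ℚ < C
  0<C = *-pos 0<¼ (^ℚ-pos (e H) (*-pos 0<¼ (*-pos (^ℚ-pos (suc k) 0<¼) (^ℚ-pos (suc k) 0<¼))))

  C≤1 : C ≤ 1ℚ
  C≤1 = proj₂ (In01-* ¼01 (^ℚ-01 (e H) (In01-* ¼01 (In01-* (^ℚ-01 (suc k) ¼01) (^ℚ-01 (suc k) ¼01)))))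
    where
    ¼01 : In01 (½ * ½)
    ¼01 = In01-* In01-½ In01-½

  module _ (d : ℚ) (0<d : 0ℚ < d) where

    η θ : ℚ
    η = ½ * ½ * d
    θ = η ^ℚ suc k

    0<η : 0ℚ < η
    0<η = *-pos 0<¼ 0<d

    0<θ : 0ℚ < θ
    0<θ = ^ℚ-pos (suc k) 0<η

    given = KNRS-weighted H knrs (½ * d) θ (*-pos 0<½ 0<d) 0<θ

    ρ′ : ℚ
    ρ′ = proj₁ given

    0<ρ′ : 0ℚ < ρ′
    0<ρ′ = proj₁ (proj₂ given)

    -- With ρ ≤ 1 the whole vertex set may be tested, which bounds d by the edge density. The other
    -- bound keeps the rounding loss ρ² small against a², where a ≥ ρ′ * θ for every γ to be
    -- considered.
    chosen : Σ ℚ λ ρ → 0ℚ < ρ × ρ ≤ 1ℚ × ρ ≤ ½ * (ρ′ * θ)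
    chosen = positive-below-1 (*-pos 0<½ (*-pos 0<ρ′ 0<θ))

    ρ : ℚ
    ρ = proj₁ chosen

    0<ρ : 0ℚ < ρ
    0<ρ = proj₁ (proj₂ chosen)

    module _ (G : Graph) (pos : 0 ℕ.< n G) (dense : Dense ρ d G) where

      l : List (Fin (n G))
      l = allFin (n G)

      K : Fin (n G) → Fin (n G) → ℚ
      K = adjℚ G

      d≤ : d ≤ mean₂ l K
      d≤ = subst₂ _≤_ (trans (cong (λ z → d * (z * z)) ones) (*-identityʳ d))
        (mean-cong l λ a → mean-cong l λ b → *-identityˡ (K a b))
        (Dense-elim G pos {ρ} {d} dense (λ _ → true) (subst (ρ ≤_) (sym ones) (proj₁ (proj₂ (proj₂ chosen)))))
        where
        ones : mean l (λ _ → 1ℚ) ≡ 1ℚ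
        ones = mean-const (allFin-nonEmpty pos) 1ℚ

      d≤1 : d ≤ 1ℚ
      d≤1 = ≤-trans d≤ (mean-≤1 (allFin-nonEmpty pos) λ a → mean-≤1 (allFin-nonEmpty pos) λ b → proj₂ (adj-01 G a b))

      bound : (S : Fin (n G) → Bool) → (∀ x → S x ≡ true → η ≤ MinDegree.deg pos K (adj-01 G) (adjℚ-sym G) η (<⇒≤ 0<η) S x) →
        η + η ≤ MinDegree.edges pos K (adj-01 G) (adjℚ-sym G) η (<⇒≤ 0<η) S →
        ½ * ½ * ((½ * (½ * d * (θ * θ))) ^ℚ e H) ≤ walkDensity (edgeList H) (suc (k ℕ.+ suc k)) l K
      bound S S-deg S-edges = ≤-trans
        (proj₂ (proj₂ given) pos (O.w k) (O.w-dichotomy k) (O.mean-w k) O.L O.L01 O.L-sym L-dense)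
        (E-mono (n H) (λ _ → l) λ f → ∏-mono (edgeList H) (λ p → proj₁ (O.L01 (f (proj₁ p)) (f (proj₂ p)))) (λ p → O.L≤walk (f (proj₁ p)) (f (proj₂ p))))
        where
        module O = OddWalks pos K (adj-01 G) (adjℚ-sym G) η 0<η S S-deg S-edges k
        L-dense : ∀ γ → (∀ x → In01 (γ x)) → ρ′ * mean l (O.w k) ≤ mean l (λ x → γ x * O.w k x) →
          ½ * d * (mean l (λ x → γ x * O.w k x) * mean l (λ x → γ x * O.w k x)) ≤ mean l (λ x → mean l λ y → γ x * γ y * O.L x y)
        L-dense γ γ01 large = begin
          ½ * d * (a * a)
            -- Here a ≥ ρ′θ ≥ 2ρ, so ρ² is at most a quarter of a².
            ≤⟨ ≤-by _ (lem d (a * a) (ρ * ρ) (½ * (ρ′ * θ) * (½ * (ρ′ * θ))) (ρ′ * θ * (ρ′ * θ)) (quarter (ρ′ * θ)))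
                 (*-nonneg (<⇒≤ 0<d) (+-nonneg (+-nonneg (*-nonneg 0≤½ (≤⇒0≤- (*-mono 0≤ρθ 0≤ρθ ρθ≤a ρθ≤a))) (*-nonneg (<⇒≤ 0<¼) (*-nonneg 0≤ρθ 0≤ρθ)))
                   (≤⇒0≤- (*-mono (<⇒≤ 0<ρ) (<⇒≤ 0<ρ) ρ≤ ρ≤)))) ⟩
          d * (a * a - ρ * ρ)
            ≡⟨ cong (λ z → d * (z * z - ρ * ρ)) (O.mean-spread k γ) ⟨
          d * (mean l (O.spread k γ) * mean l (O.spread k γ) - ρ * ρ)
            ≤⟨ Rounding.rounding G pos 0<ρ (<⇒≤ 0<d) dense (O.spread k γ) (O.spread01 γ γ01) ⟩
          mean l (λ z → mean l λ z′ → O.spread k γ z * O.spread k γ z′ * K z z′)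
            ≡⟨ O.L-form γ ⟩
          mean l (λ x → mean l λ y → γ x * γ y * O.L x y) ∎
          where
          open ≤-Reasoning
          a : ℚ
          a = mean l (λ x → γ x * O.w k x)
          0≤ρθ : 0ℚ ≤ ρ′ * θ
          0≤ρθ = <⇒≤ (*-pos 0<ρ′ 0<θ)
          ρθ≤a : ρ′ * θ ≤ a
          ρθ≤a = ≤-trans (*-monoˡ (<⇒≤ 0<ρ′) (O.mean-w k)) large
          ρ≤ : ρ ≤ ½ * (ρ′ * θ)
          ρ≤ = proj₂ (proj₂ (proj₂ chosen))
          quarter : ∀ x → ½ * x * (½ * x) ≡ ½ * ½ * (x * x)
          quarter = solve-∀ ℚ-ring
          lem′ : ∀ d s r q → d * (s - r) ≡ ½ * d * s + d * (½ * (s - q) + ½ * ½ * q + (½ * ½ * q - r))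
          lem′ = solve-∀ ℚ-ring
          lem : ∀ d s r h q → h ≡ ½ * ½ * q → d * (s - r) ≡ ½ * d * s + d * (½ * (s - q) + ½ * ½ * q + (h - r))
          lem d s r h q refl = lem′ d s r q

      walkDensity≥ : C * (d ^ℚ (e H ℕ.* suc (suc k ℕ.+ suc k))) ≤ walkDensity (edgeList H) (suc (k ℕ.+ suc k)) l K
      walkDensity≥ = subst (_≤ walkDensity (edgeList H) (suc (k ℕ.+ suc k)) l K) eq (bound (proj₁ c) (proj₁ (proj₂ c)) (proj₂ (proj₂ c)))
        where
        c = MinDegree.core pos K (adj-01 G) (adjℚ-sym G) η (<⇒≤ 0<η) (subst (_≤ mean₂ l K) (sym (four-quarters d)) d≤)
        rearrange : ∀ d a b → ½ * (½ * d * (a * b * (a * b))) ≡ ½ * ½ * (a * a) * (d * (b * b))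
        rearrange = solve-∀ ℚ-ring
        q : ℚ
        q = d ^ℚ suc k
        open ≡-Reasoning
        eq : ½ * ½ * ((½ * (½ * d * (θ * θ))) ^ℚ e H) ≡ C * (d ^ℚ (e H ℕ.* suc (suc k ℕ.+ suc k)))
        eq = begin
          ½ * ½ * ((½ * (½ * d * (θ * θ))) ^ℚ e H)
            ≡⟨ cong (λ z → ½ * ½ * ((½ * (½ * d * (z * z))) ^ℚ e H)) (^ℚ-distrib-* (½ * ½) d (suc k)) ⟩
          ½ * ½ * ((½ * (½ * d * ((½ * ½) ^ℚ suc k * q * ((½ * ½) ^ℚ suc k * q)))) ^ℚ e H)
            ≡⟨ cong (λ z → ½ * ½ * (z ^ℚ e H)) (rearrange d ((½ * ½) ^ℚ suc k) q) ⟩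
          ½ * ½ * ((κ * (d * (q * q))) ^ℚ e H)
            ≡⟨ cong (λ z → ½ * ½ * ((κ * (d * z)) ^ℚ e H)) (^ℚ-+ d (suc k) (suc k)) ⟨
          ½ * ½ * ((κ * (d ^ℚ suc (suc k ℕ.+ suc k))) ^ℚ e H)
            ≡⟨ cong (½ * ½ *_) (^ℚ-distrib-* κ (d ^ℚ suc (suc k ℕ.+ suc k)) (e H)) ⟩
          ½ * ½ * (κ ^ℚ e H * ((d ^ℚ suc (suc k ℕ.+ suc k)) ^ℚ e H))
            ≡⟨ *-assoc (½ * ½) (κ ^ℚ e H) ((d ^ℚ suc (suc k ℕ.+ suc k)) ^ℚ e H) ⟨
          C * ((d ^ℚ suc (suc k ℕ.+ suc k)) ^ℚ e H)
            ≡⟨ cong (C *_) (^ℚ-* d (e H) (suc (suc k ℕ.+ suc k))) ⟨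
          C * (d ^ℚ (e H ℕ.* suc (suc k ℕ.+ suc k))) ∎

-- Averages over the vertices of a subdivision.

join : ∀ {a b} → (Fin a → X) → (Fin b → X) → Fin (a ℕ.+ b) → X
join {a = a} g h i = Sum.[ g , h ]′ (splitAt a i)

E-join : ∀ a b (l : List X) F → Extensional F →
  E (a ℕ.+ b) (λ _ → l) F ≡ E a (λ _ → l) λ g → E b (λ _ → l) λ h → F (join g h)
E-join zero    b l F ext = refl
E-join (suc a) b l F ext = mean-cong l λ x → trans (E-join a b l (λ f → F (x ◂ f)) (◂-ext ext x))
  (E-cong a (λ _ → l) λ g → E-cong b (λ _ → l) λ h → ext _ _ λ where
    zero    → refl
    (suc i) → shift x g h (splitAt a i))
  where
  shift : ∀ {A B : Set} {a} x (g : Fin a → A) (h : B → A) s → Sum.[ g , h ]′ s ≡ Sum.[ x ◂ g , h ]′ (Sum.map₁ suc s)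
  shift x g h (inj₁ _) = refl
  shift x g h (inj₂ _) = refl

-- Each row holds the internal vertices of one path. Keeping the rows separate lets the average of a
-- product over edges of H factorise.
E₂ : ∀ m s → List X → ((Fin m → Fin s → X) → ℚ) → ℚ
E₂ zero    s l F = F (λ ())
E₂ (suc m) s l F = E s (λ _ → l) λ p → E₂ m s l λ r → F (p ◂ r)

E₂-cong : ∀ m s (l : List X) {F G} → (∀ r → F r ≡ G r) → E₂ m s l F ≡ E₂ m s l G
E₂-cong zero    s l e = e _
E₂-cong (suc m) s l e = E-cong s (λ _ → l) λ p → E₂-cong m s l λ r → e (p ◂ r)

E₂-mono : ∀ m s (l : List X) {F G} → (∀ r → F r ≤ G r) → E₂ m s l F ≤ E₂ m s l G
E₂-mono zero    s l e = e _
E₂-mono (suc m) s l e = E-mono s (λ _ → l) λ p → E₂-mono m s l λ r → e (p ◂ r)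

E₂-*ˡ : ∀ m s (l : List X) c F → E₂ m s l (λ r → c * F r) ≡ c * E₂ m s l F
E₂-*ˡ zero    s l c F = refl
E₂-*ˡ (suc m) s l c F = trans (E-cong s (λ _ → l) λ p → E₂-*ˡ m s l c _) (E-*ˡ s (λ _ → l) c _)

grid : ∀ {m s} → (Fin m → Fin s → X) → Fin (m ℕ.* s) → X
grid {m = m} {s} r i = r (proj₁ (remQuot {m} s i)) (proj₂ (remQuot {m} s i))

E-grid : ∀ m s (l : List X) F → Extensional F → E (m ℕ.* s) (λ _ → l) F ≡ E₂ m s l (F ∘ grid)
E-grid zero    s l F ext = ext _ _ λ ()
E-grid {X = X} (suc m) s l F ext = trans (E-join s (m ℕ.* s) l F ext) (E-cong s (λ _ → l) λ p →
  trans (E-grid m s l (λ h → F (join p h)) λ f g e → ext _ _ λ i → [,]-cong (λ _ → refl) e (splitAt s i))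
    (E₂-cong m s l λ r → ext _ _ (pointwise p r)))
  where
  pointwise : (p : Fin s → X) (r : Fin m → Fin s → X) (i : Fin (s ℕ.+ m ℕ.* s)) → join p (grid r) i ≡ grid (p ◂ r) i
  pointwise p r i with splitAt s {m ℕ.* s} i
  ... | inj₁ _ = refl
  ... | inj₂ _ = refl

E₂-∏ : ∀ m s (l : List X) (Q : Fin m → (Fin s → X) → ℚ) →
  E₂ m s l (λ r → ∏ (allFin m) λ i → Q i (r i)) ≡ ∏ (allFin m) λ i → E s (λ _ → l) (Q i)
E₂-∏ zero    s l Q = refl
E₂-∏ (suc m) s l Q = begin
  E s (λ _ → l) (λ p → E₂ m s l λ r → ∏ (allFin (suc m)) λ i → Q i ((p ◂ r) i))
    ≡⟨ E-cong s (λ _ → l) (λ p → trans (E₂-cong m s l λ r → ∏-Fin-suc (λ i → Q i ((p ◂ r) i))) (E₂-*ˡ m s l (Q zero p) _)) ⟩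
  E s (λ _ → l) (λ p → Q zero p * E₂ m s l λ r → ∏ (allFin m) λ i → Q (suc i) (r i))
    ≡⟨ trans (E-cong s (λ _ → l) λ p → *-comm (Q zero p) R) (trans (E-*ˡ s (λ _ → l) R (Q zero)) (*-comm R (E s (λ _ → l) (Q zero)))) ⟩
  E s (λ _ → l) (Q zero) * E₂ m s l (λ r → ∏ (allFin m) λ i → Q (suc i) (r i))
    ≡⟨ cong (E s (λ _ → l) (Q zero) *_) (E₂-∏ m s l (Q ∘ suc)) ⟩
  E s (λ _ → l) (Q zero) * ∏ (allFin m) (λ i → E s (λ _ → l) (Q (suc i)))
    ≡⟨ ∏-Fin-suc (λ i → E s (λ _ → l) (Q i)) ⟨
  ∏ (allFin (suc m)) (λ i → E s (λ _ → l) (Q i)) ∎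
  where
  open ≡-Reasoning
  R : ℚ
  R = E₂ m s l (λ r → ∏ (allFin m) (λ i → Q (suc i) (r i)))

∏-lookup : ∀ (l : List A) F → ∏ (allFin (length l)) (F ∘ List.lookup l) ≡ ∏ l F
∏-lookup []      F = refl
∏-lookup (x ∷ l) F = trans (∏-Fin-suc (F ∘ List.lookup (x ∷ l))) (cong (F x *_) (∏-lookup l F))

∏-[] : ∀ (p : A → Bool) l c → ((∀ x → x ∈ l → p x ≡ true) → c ≡ true) → ∏ l ([_] ∘ p) ≤ [ c ]
∏-[] p l true  imp = proj₂ (∏-01 l λ x → []-01 (p x))
∏-[] p l false imp with dichotomy l
  where
  dichotomy : ∀ l → (∀ x → x ∈ l → p x ≡ true) ⊎ ∏ l ([_] ∘ p) ≡ 0ℚ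
  dichotomy []      = inj₁ λ _ ()
  dichotomy (x ∷ l) with p x in eq | dichotomy l
  ... | false | _      = inj₂ (*-zeroˡ (∏ l ([_] ∘ p)))
  ... | true  | inj₁ f = inj₁ λ { y (here refl) → eq ; y (there y∈) → f y y∈ }
  ... | true  | inj₂ z = inj₂ (trans (*-identityˡ _) z)
... | inj₁ f = case imp f of λ ()
... | inj₂ z = ≤-reflexive z

isPath : ∀ (adj : X → X → Bool) s → X → (Fin s → X) → X → Bool
isPath adj zero    a y b = adj a b
isPath adj (suc s) a y b = adj a (y zero) ∧ isPath adj s (y zero) (y ∘ suc) b

E-isPath : ∀ (adj : X → X → Bool) (l : List X) s a b →
  E s (λ _ → l) (λ y → [ isPath adj s a y b ]) ≡ walk l (λ a b → [ adj a b ]) s a b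
E-isPath adj l zero    a b = refl
E-isPath adj l (suc s) a b = mean-cong l λ z → trans (E-cong s (λ _ → l) λ f → [∧] (adj a z) (isPath adj s z f b))
  (trans (E-*ˡ s (λ _ → l) [ adj a z ] _) (cong ([ adj a z ] *_) (E-isPath adj l s z b)))

isPath-first : ∀ (adj : X → X → Bool) s a (y : Fin s → X) b → isPath adj s a y b ≡ true → ∀ j → toℕ j ≡ 0 → adj a (y j) ≡ true
isPath-first adj (suc s) a y b e zero _ = proj₁ (∧-true e)

isPath-step : ∀ (adj : X → X → Bool) s a (y : Fin s → X) b → isPath adj s a y b ≡ true →
  ∀ j j′ → suc (toℕ j) ≡ toℕ j′ → adj (y j) (y j′) ≡ true
isPath-step adj (suc s) a y b e zero    (suc j′) q =
  isPath-first adj s (y zero) (y ∘ suc) b (proj₂ (∧-true {adj a (y zero)} e)) j′ (sym (ℕ.suc-injective q))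
isPath-step adj (suc s) a y b e (suc j) (suc j′) q =
  isPath-step adj s (y zero) (y ∘ suc) b (proj₂ (∧-true {adj a (y zero)} e)) j j′ (ℕ.suc-injective q)

isPath-last : ∀ (adj : X → X → Bool) s a (y : Fin s → X) b → isPath adj s a y b ≡ true →
  ∀ j → suc (toℕ j) ≡ s → adj (y j) b ≡ true
isPath-last adj (suc zero)    a y b e zero    q = proj₂ (∧-true {adj a (y zero)} e)
isPath-last adj (suc (suc s)) a y b e (suc j) q =
  isPath-last adj (suc s) (y zero) (y ∘ suc) b (proj₂ (∧-true {adj a (y zero)} e)) j (ℕ.suc-injective q)

-- Subdivisions

module Subdivision (H : Graph) (s : ℕ) where

  m : ℕ
  m = e H

  V : Set
  V = Fin (n H) ⊎ (Fin m × Fin s)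

  edge : Fin m → Fin (n H) × Fin (n H)
  edge = List.lookup (edgeList H)

  edge-≺ : ∀ i → proj₁ (edge i) ≺ proj₂ (edge i)
  edge-≺ i = proj₁ (∈-edgeList⁻ H (∈-lookup {xs = edgeList H} i))

  dec : Fin (n (subdivision H s)) → V
  dec x = Sum.map₂ (remQuot s) (splitAt (n H) x)

  arc : V → V → Bool
  arc (inj₁ u) (inj₁ v) = false
  arc (inj₁ u) (inj₂ (i , j)) = (toℕ j ℕ.≡ᵇ 0) ∧ (toℕ (proj₁ (edge i)) ℕ.≡ᵇ toℕ u)
  arc (inj₂ (i , j)) (inj₂ (i' , j')) = (toℕ i ℕ.≡ᵇ toℕ i') ∧ (suc (toℕ j) ℕ.≡ᵇ toℕ j')
  arc (inj₂ (i , j)) (inj₁ v) = (suc (toℕ j) ℕ.≡ᵇ s) ∧ (toℕ (proj₂ (edge i)) ℕ.≡ᵇ toℕ v)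

  -- Identifies the adjacency of `subdivision` with the restated `arc`, on which one can argue by
  -- cases.
  adj-arc : ∀ x y → adj (subdivision H s) x y ≡ arc (dec x) (dec y) ∨ arc (dec y) (dec x)
  adj-arc x y with splitAt (n H) x | splitAt (n H) y
  ... | inj₁ _ | inj₁ _ = refl
  ... | inj₁ _ | inj₂ _ = refl
  ... | inj₂ _ | inj₁ _ = refl
  ... | inj₂ _ | inj₂ _ = refl

  ∨-true : ∀ {a b} → a ∨ b ≡ true → a ≡ true ⊎ b ≡ true
  ∨-true {true}  e = inj₁ refl
  ∨-true {false} e = inj₂ e

  ≡ᵇ⇒≡ : ∀ {a b} → (a ℕ.≡ᵇ b) ≡ true → a ≡ b
  ≡ᵇ⇒≡ {a} {b} e = ℕ.≡ᵇ⇒≡ a b (≡⇒T e)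

  ≡ᵇ-refl : ∀ a → (a ℕ.≡ᵇ a) ≡ true
  ≡ᵇ-refl a = T⇒≡ (ℕ.≡⇒≡ᵇ a a refl)

  module _ (G : Graph) (x : Fin (n H) → Fin (n G)) (r : Fin m → Fin s → Fin (n G)) where

    place : V → Fin (n G)
    place (inj₁ u)       = x u
    place (inj₂ (i , j)) = r i j

    paths : Fin m → Bool
    paths i = isPath (adj G) s (x (proj₁ (edge i))) (r i) (x (proj₂ (edge i)))

    place-arc : (∀ i → paths i ≡ true) → ∀ v v′ → arc v v′ ≡ true → adj G (place v) (place v′) ≡ true
    place-arc ok (inj₁ u) (inj₂ (i , j)) e with ∧-true {toℕ j ℕ.≡ᵇ 0} e
    ... | p , q = subst (λ u → adj G (x u) (r i j) ≡ true) (Fin.toℕ-injective (≡ᵇ⇒≡ q)) (isPath-first (adj G) s _ (r i) _ (ok i) j (≡ᵇ⇒≡ p))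
    place-arc ok (inj₂ (i , j)) (inj₂ (i′ , j′)) e with ∧-true {toℕ i ℕ.≡ᵇ toℕ i′} e
    ... | p , q with Fin.toℕ-injective {i = i} {j = i′} (≡ᵇ⇒≡ p)
    ... | refl = isPath-step (adj G) s _ (r i) _ (ok i) j j′ (≡ᵇ⇒≡ q)
    place-arc ok (inj₂ (i , j)) (inj₁ v) e with ∧-true {suc (toℕ j) ℕ.≡ᵇ s} e
    ... | p , q = subst (λ v → adj G (r i j) (x v) ≡ true) (Fin.toℕ-injective (≡ᵇ⇒≡ q)) (isPath-last (adj G) s _ (r i) _ (ok i) j (≡ᵇ⇒≡ p))

    place-hom : (∀ i → paths i ≡ true) → isHom (subdivision H s) G (join x (grid r)) ≡ true
    place-hom ok = isHom-intro (subdivision H s) G (join x (grid r)) λ u v uv →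
      subst₂ (λ a b → adj G a b ≡ true) (sym (join-place u)) (sym (join-place v)) (go u v (∨-true (trans (sym (adj-arc u v)) uv)))
      where
      join-place : ∀ u → join x (grid r) u ≡ place (dec u)
      join-place u with splitAt (n H) u
      ... | inj₁ _ = refl
      ... | inj₂ _ = refl
      go : ∀ u v → arc (dec u) (dec v) ≡ true ⊎ arc (dec v) (dec u) ≡ true → adj G (place (dec u)) (place (dec v)) ≡ true
      go u v (inj₁ a) = place-arc ok (dec u) (dec v) a
      go u v (inj₂ a) = trans (adj-sym G _ _) (place-arc ok (dec v) (dec u) a)

  -- Given the images of the vertices of H, the path interiors are independent, and the probability
  -- that one of them forms a path is the walk kernel at its ends. A full system of paths is a
  -- homomorphism of the subdivision.
  walkDensity≤t : ∀ G → 0 ℕ.< n G → walkDensity (edgeList H) s (allFin (n G)) (adjℚ G) ≤ t (subdivision H s) G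
  walkDensity≤t G pos = begin
    E (n H) (λ _ → l) (hom (edgeList H) (walk l (adjℚ G) s))
      ≡⟨ E-cong (n H) (λ _ → l) (λ x → sym (trans (E₂-∏ m s l _) (trans (∏-cong (allFin m) λ i → E-isPath (adj G) l s (x (proj₁ (edge i))) (x (proj₂ (edge i))))
           (∏-lookup (edgeList H) _)))) ⟩
    E (n H) (λ _ → l) (λ x → E₂ m s l λ r → ∏ (allFin m) ([_] ∘ paths G x r))
      ≤⟨ E-mono (n H) (λ _ → l) (λ x → E₂-mono m s l λ r → ∏-[] (paths G x r) (allFin m) _ λ ok → place-hom G x r λ i → ok i (∈-allFin i)) ⟩
    E (n H) (λ _ → l) (λ x → E₂ m s l λ r → F (join x (grid r)))
      ≡⟨ E-cong (n H) (λ _ → l) (λ x → sym (E-grid m s l (λ h → F (join x h)) λ f g e → F-ext _ _ λ i → [,]-cong (λ _ → refl) e (splitAt (n H) i))) ⟩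
    E (n H) (λ _ → l) (λ x → E (m ℕ.* s) (λ _ → l) λ h → F (join x h))
      ≡⟨ E-join (n H) (m ℕ.* s) l F F-ext ⟨
    E (n (subdivision H s)) (λ _ → l) F
      ≡⟨ t-as-E (subdivision H s) G pos ⟨
    t (subdivision H s) G ∎
    where
    open ≤-Reasoning
    l : List (Fin (n G))
    l = allFin (n G)
    F : (Fin (n (subdivision H s)) → Fin (n G)) → ℚ
    F f = [ isHom (subdivision H s) G f ]
    F-ext : Extensional F
    F-ext = isHom-ext (subdivision H s) G

  odd : ℕ → Bool
  odd zero    = false
  odd (suc k) = not (odd k)

  colour : V → Bool
  colour (inj₁ u)       = false
  colour (inj₂ (i , j)) = odd (suc (toℕ j))

  -- Colours alternate along each path; the last internal vertex has the colour `odd s`, which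
  -- differs from `false` at the end precisely for odd s.
  bipartite : odd s ≡ true → Bipartite (subdivision H s)
  bipartite odd-s = colour ∘ dec , λ u v uv same → go u v (∨-true (trans (sym (adj-arc u v)) uv)) same
    where
    arc-colour : ∀ v v′ → arc v v′ ≡ true → colour v ≢ colour v′
    arc-colour (inj₁ u) (inj₂ (i , j)) e same with ∧-true {toℕ j ℕ.≡ᵇ 0} e
    ... | p , _ = case trans same (cong (odd ∘ suc) (≡ᵇ⇒≡ {toℕ j} p)) of λ ()
    arc-colour (inj₂ (i , j)) (inj₂ (i′ , j′)) e same with ∧-true {toℕ i ℕ.≡ᵇ toℕ i′} e
    ... | _ , q = not-≢ (odd (toℕ j′)) (trans (cong odd (sym (≡ᵇ⇒≡ {suc (toℕ j)} {toℕ j′} q))) same)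
      where
      not-≢ : ∀ b → b ≢ not b
      not-≢ true  ()
      not-≢ false ()
    arc-colour (inj₂ (i , j)) (inj₁ v) e same with ∧-true {suc (toℕ j) ℕ.≡ᵇ s} e
    ... | p , _ = case trans (sym (trans (cong odd (≡ᵇ⇒≡ {suc (toℕ j)} {s} p)) odd-s)) same of λ ()
    go : ∀ u v → arc (dec u) (dec v) ≡ true ⊎ arc (dec v) (dec u) ≡ true → colour (dec u) ≢ colour (dec v)
    go u v (inj₁ a) = arc-colour (dec u) (dec v) a
    go u v (inj₂ a) = ≢-sym (arc-colour (dec v) (dec u) a)

-- The number of edges of a subdivision.

module SubdivisionEdges (H : Graph) (s′ : ℕ) where

  open Subdivision H (suc s′)

  s : ℕ
  s = suc s′

  enc : V → Fin (n (subdivision H s))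
  enc (inj₁ u)       = u Fin.↑ˡ (m ℕ.* s)
  enc (inj₂ (i , j)) = n H Fin.↑ʳ Fin.combine i j

  dec-enc : ∀ v → dec (enc v) ≡ v
  dec-enc (inj₁ u)       = cong (Sum.map₂ (remQuot s)) (Fin.splitAt-↑ˡ (n H) u (m ℕ.* s))
  dec-enc (inj₂ (i , j)) = trans (cong (Sum.map₂ (remQuot s)) (Fin.splitAt-↑ʳ (n H) (m ℕ.* s) (Fin.combine i j)))
    (cong inj₂ (Fin.remQuot-combine i j))

  enc-injective : ∀ {v v′} → enc v ≡ enc v′ → v ≡ v′
  enc-injective {v} {v′} q = trans (sym (dec-enc v)) (trans (cong dec q) (dec-enc v′))

  last : Fin s
  last = Fin.fromℕ s′

  -- The edges on the path replacing edge i: slot zero is the one at its second endpoint,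
  -- slot suc j the one entering the j-th internal vertex.
  segment : Fin m → Fin (suc s) → V × V
  segment i zero          = inj₁ (proj₂ (edge i)) , inj₂ (i , last)
  segment i (suc zero)    = inj₁ (proj₁ (edge i)) , inj₂ (i , zero)
  segment i (suc (suc j)) = inj₂ (i , Fin.inject₁ j) , inj₂ (i , suc j)

  segment-arc : ∀ i r → arc (proj₁ (segment i r)) (proj₂ (segment i r)) ∨ arc (proj₂ (segment i r)) (proj₁ (segment i r)) ≡ true
  segment-arc i zero          = trans (cong (arc (inj₁ (proj₂ (edge i))) (inj₂ (i , last)) ∨_) (cong₂ _∧_ (trans (cong (ℕ._≡ᵇ s′) (Fin.toℕ-fromℕ s′)) (≡ᵇ-refl s′)) (≡ᵇ-refl (toℕ (proj₂ (edge i)))))) (∨-zeroʳ (arc (inj₁ (proj₂ (edge i))) (inj₂ (i , last))))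
  segment-arc i (suc zero)    = cong (_∨ arc (inj₂ (i , zero)) (inj₁ (proj₁ (edge i)))) (≡ᵇ-refl (toℕ (proj₁ (edge i))))
  segment-arc i (suc (suc j)) = cong (_∨ arc (inj₂ (i , suc j)) (inj₂ (i , Fin.inject₁ j)))
    (cong₂ _∧_ (≡ᵇ-refl (toℕ i)) (trans (cong (ℕ._≡ᵇ toℕ j) (Fin.toℕ-inject₁ j)) (≡ᵇ-refl (toℕ j))))

  inner≺ : ∀ u p → enc (inj₁ u) ≺ enc (inj₂ p)
  inner≺ u (i , j) = subst₂ ℕ._<_ (sym (Fin.toℕ-↑ˡ u (m ℕ.* s))) (sym (Fin.toℕ-↑ʳ (n H) (Fin.combine i j)))
    (ℕ.<-≤-trans (Fin.toℕ<n u) (ℕ.m≤m+n (n H) _))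

  -- The edge list keeps increasing pairs only. Original vertices are numbered before internal ones,
  -- hence the original vertex comes first in both end segments.
  segment-≺ : ∀ i r → enc (proj₁ (segment i r)) ≺ enc (proj₂ (segment i r))
  segment-≺ i zero          = inner≺ _ _
  segment-≺ i (suc zero)    = inner≺ _ _
  segment-≺ i (suc (suc j)) = subst₂ ℕ._<_ (sym (value (Fin.inject₁ j))) (sym (value (suc j)))
    (ℕ.+-monoʳ-< (n H) (ℕ.+-monoʳ-< (s ℕ.* toℕ i) (s≤s (ℕ.≤-reflexive (Fin.toℕ-inject₁ j)))))
    where
    value : ∀ j → toℕ (enc (inj₂ (i , j))) ≡ n H ℕ.+ (s ℕ.* toℕ i ℕ.+ toℕ j)
    value j = trans (Fin.toℕ-↑ʳ (n H) (Fin.combine i j)) (cong (n H ℕ.+_) (Fin.toℕ-combine i j))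

  -- The delicate case is a path with one internal vertex, where both end segments share it; they
  -- differ because the ends of an edge of H do.
  segment-injective : ∀ i r i′ r′ → segment i r ≡ segment i′ r′ → i ≡ i′ × r ≡ r′
  segment-injective i zero          i′ zero           q = ,-injectiveˡ (inj₂-injective (,-injectiveʳ q)) , refl
  segment-injective i (suc zero)    i′ (suc zero)     q = ,-injectiveˡ (inj₂-injective (,-injectiveʳ q)) , refl
  segment-injective i (suc (suc j)) i′ (suc (suc j′)) q =
    ,-injectiveˡ (inj₂-injective (,-injectiveʳ q)) , cong suc (,-injectiveʳ (inj₂-injective (,-injectiveʳ q)))
  segment-injective i zero i′ (suc zero) q with ,-injectiveˡ (inj₂-injective (,-injectiveʳ q))
  ... | refl = ⊥-elim (≺⇒≢ (edge-≺ i) (sym (inj₁-injective (,-injectiveˡ q))))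
  segment-injective i (suc zero) i′ zero q with ,-injectiveˡ (inj₂-injective (,-injectiveʳ q))
  ... | refl = ⊥-elim (≺⇒≢ (edge-≺ i) (inj₁-injective (,-injectiveˡ q)))
  segment-injective i zero          i′ (suc (suc _)) ()
  segment-injective i (suc zero)    i′ (suc (suc _)) ()
  segment-injective i (suc (suc _)) i′ zero          ()
  segment-injective i (suc (suc _)) i′ (suc zero)    ()

  member : ∀ i r → (enc (proj₁ (segment i r)) , enc (proj₂ (segment i r))) ∈ edgeList (subdivision H s)
  member i r = ∈-edgeList⁺ (subdivision H s) (segment-≺ i r)
    (trans (adj-arc _ _) (trans (cong₂ (λ v v′ → arc v v′ ∨ arc v′ v) (dec-enc (proj₁ (segment i r))) (dec-enc (proj₂ (segment i r)))) (segment-arc i r)))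

  -- Powers of a density in [0,1] decrease with the exponent, so a lower bound on the number of
  -- edges is the direction in which the exponents have to be compared.
  edges≥ : e H ℕ.* suc s ℕ.≤ e (subdivision H s)
  edges≥ = Fin.injective⇒≤ {f = slot} slot-injective
    where
    slot : Fin (e H ℕ.* suc s) → Fin (e (subdivision H s))
    slot x = Any.index (member (proj₁ (remQuot {e H} (suc s) x)) (proj₂ (remQuot {e H} (suc s) x)))
    slot-injective : ∀ {x y} → slot x ≡ slot y → x ≡ y
    slot-injective {x} {y} q = trans (sym (Fin.combine-remQuot {e H} (suc s) x))
      (trans (cong₂ Fin.combine (proj₁ same) (proj₂ same)) (Fin.combine-remQuot {e H} (suc s) y))
      where
      i j : Fin m
      i = proj₁ (remQuot {e H} (suc s) x)
      j = proj₁ (remQuot {e H} (suc s) y)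
      r r′ : Fin (suc s)
      r = proj₂ (remQuot {e H} (suc s) x)
      r′ = proj₂ (remQuot {e H} (suc s) y)
      pairs≡ : (enc (proj₁ (segment i r)) , enc (proj₂ (segment i r))) ≡ (enc (proj₁ (segment j r′)) , enc (proj₂ (segment j r′)))
      pairs≡ = trans (Any.lookup-index (member i r)) (trans (cong (List.lookup (edgeList (subdivision H s))) q) (sym (Any.lookup-index (member j r′))))
      same : i ≡ j × r ≡ r′
      same = segment-injective i r j r′ (cong₂ _,_ (enc-injective (,-injectiveˡ pairs≡)) (enc-injective (,-injectiveʳ pairs≡)))

-- The two conclusions.

^ℚ-mono : ∀ {a b} k → 0ℚ ≤ a → a ≤ b → a ^ℚ k ≤ b ^ℚ k
^ℚ-mono zero    p q = ≤-refl
^ℚ-mono (suc k) p q = *-mono p (^ℚ-nonneg k p) q (^ℚ-mono k p q)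

1^ℚ : ∀ k → 1ℚ ^ℚ k ≡ 1ℚ
1^ℚ zero    = refl
1^ℚ (suc k) = trans (*-identityˡ (1ℚ ^ℚ k)) (1^ℚ k)

t-empty : ∀ H G → n G ≡ 0 → t H G ≡ 1ℚ
t-empty H G eq = cong (λ m → density (homCount H G) m (n H)) eq

t-nonneg : ∀ H G → 0 ℕ.< n G → 0ℚ ≤ t H G
t-nonneg H G pos = subst (0ℚ ≤_) (sym (t-as-E H G pos)) (E-nonneg (n H) (λ _ → allFin (n G)) λ f → proj₁ ([]-01 (isHom H G f)))

t-K2≤ : ∀ G → 0 ℕ.< n G → t K2 G ≤ mean₂ (allFin (n G)) (adjℚ G)
t-K2≤ G pos = ≤-trans (t≤hom K2 G pos)
  (≤-reflexive (mean-cong (allFin (n G)) λ a → mean-cong (allFin (n G)) λ b → *-identityʳ (adjℚ G a b)))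

odd-double : ∀ H s k → Subdivision.odd H s (suc (k ℕ.+ k)) ≡ true
odd-double H s zero    = refl
odd-double H s (suc k) = trans (cong (λ j → Subdivision.odd H s (suc (suc j))) (ℕ.+-suc k k))
  (trans (not-involutive _) (odd-double H s k))

subdivision-Sidorenko : ∀ H → KNRS H → ∀ k → Sidorenko (subdivision H (suc (k ℕ.+ k)))
subdivision-Sidorenko H knrs k = Subdivision.bipartite H s (odd-double H s k) , bound
  where
  s : ℕ
  s = suc (k ℕ.+ k)
  H′ : Graph
  H′ = subdivision H s
  module Even = EvenSubdivision H knrs k
  E₀≤ : Even.E₀ ℕ.≤ e H′
  E₀≤ = subst (λ j → e H ℕ.* suc j ℕ.≤ e H′) (sym (ℕ.+-suc k k)) (SubdivisionEdges.edges≥ H (k ℕ.+ k))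
  empty : ∀ G → n G ≡ 0 → (t K2 G ^ℚ e H′) ≤ t H′ G
  empty G eq = ≤-reflexive (trans (cong (_^ℚ e H′) (t-empty K2 G eq)) (trans (1^ℚ (e H′)) (sym (t-empty H′ G eq))))
  inhabited : ∀ G → 0 ℕ.< n G → (t K2 G ^ℚ e H′) ≤ t H′ G
  inhabited G 0<n = begin
    t K2 G ^ℚ e H′                                  ≤⟨ ^ℚ-mono (e H′) (t-nonneg K2 G 0<n) (t-K2≤ G 0<n) ⟩
    mean₂ (allFin (n G)) (adjℚ G) ^ℚ e H′           ≤⟨ ^ℚ-antimono p01 E₀≤ ⟩
    mean₂ (allFin (n G)) (adjℚ G) ^ℚ Even.E₀        ≤⟨ Even.sharp 0<n (adjℚ G) (adj-01 G) (adjℚ-sym G) ⟩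
    walkDensity (edgeList H) s (allFin (n G)) (adjℚ G) ≤⟨ Subdivision.walkDensity≤t H s G 0<n ⟩
    t H′ G                                          ∎
    where
    open ≤-Reasoning
    p01 : In01 (mean₂ (allFin (n G)) (adjℚ G))
    p01 = mean-01 (allFin-nonEmpty 0<n) λ a → mean-01 (allFin-nonEmpty 0<n) λ b → adj-01 G a b
  bound : ∀ G → (t K2 G ^ℚ e H′) ≤ t H′ G
  bound G = Sum.[ inhabited G , empty G ∘ sym ]′ (ℕ.m≤n⇒m<n∨m≡n {0} {n G} z≤n)

subdivision-WeaklyKNRS : ∀ H → KNRS H → ∀ k → WeaklyKNRS (subdivision H (suc (k ℕ.+ suc k)))
subdivision-WeaklyKNRS H knrs k = Odd.C , Odd.0<C , Odd.C≤1 , λ d 0<d →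
  -- The size threshold 1 excludes the empty graph; the largeness that KNRS asks for is reached by
  -- the blow-up.
  Odd.ρ d 0<d , Odd.0<ρ d 0<d , 1 , λ G pos dense →
    ≤-trans (*-monoˡ (<⇒≤ Odd.0<C) (^ℚ-antimono (<⇒≤ 0<d , Odd.d≤1 d 0<d G pos dense) (SubdivisionEdges.edges≥ H (k ℕ.+ suc k))))
      (≤-trans (Odd.walkDensity≥ d 0<d G pos dense) (Subdivision.walkDensity≤t H (suc (k ℕ.+ suc k)) G pos))
  where
  module Odd = OddSubdivision H knrs k

theorem1p5 : ∀ (k : ℕ) → 1 ℕ.≤ k → (H : Graph) → KNRS H →
    Sidorenko (subdivision H (2 ℕ.* k ℕ.∸ 1)) × WeaklyKNRS (subdivision H (2 ℕ.* k))
theorem1p5 (suc k) _ H knrs =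
  -- The theorem's k is `suc k` here, so the two subdivisions have 2k + 1 and 2k + 2 internal
  -- vertices per edge.
  subst (λ s → Sidorenko (subdivision H s)) (sym (trans (cong (k ℕ.+_) (ℕ.+-identityʳ (suc k))) (ℕ.+-suc k k))) (subdivision-Sidorenko H knrs k) ,
  subst (λ s → WeaklyKNRS (subdivision H s)) (cong (λ j → suc (k ℕ.+ j)) (sym (ℕ.+-identityʳ (suc k)))) (subdivision-WeaklyKNRS H knrs k)
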